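{- For every odd integer $n\ge3$, $P_n(z)=(1+z)\,q_n(z^2)$, and both $1+z$ and $q_n(z^2)$ are irreducible in $\mathbb{Q}[z]$; that is, this is the factorization of $P_n(z)$ into irreducibles over $\mathbb{Q}$.
   Context: For $0\le k\le n$ let $\mathcal{B}(n,k)=\binom{n}{\lfloor (n-k)/2\rfloor}$ and $P_n(z)=\sum_{k=0}^n\mathcal{B}(n,k)z^{n-k}$. Let $q_n(z)=\sum_{k=0}^{\lfloor n/2\rfloor}\binom{n}{k}z^k$ (the truncated binomial polynomial). -}

module Defs where

open import Data.Nat as ℕ using (ℕ; zero; suc; _∸_)
open import Data.Nat.DivMod using (_/_)
open import Data.Nat.Combinatorics using (_C_)
open import Data.Integer using (+_)
open import Data.Rational as ℚ using (ℚ; 0ℚ; 1ℚ)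
open import Data.List using (List; []; _∷_; map)
open import Data.Sum using (_⊎_)
open import Data.Product using (Σ; _×_)
open import Relation.Nullary using (¬_)
open import Relation.Binary.PropositionalEquality using (_≡_)

-- Polynomials in ℚ[z]: coefficient lists, lowest degree first.
Poly : Set
Poly = List ℚ

coeff : Poly → ℕ → ℚ
coeff []       _       = 0ℚ
coeff (a ∷ p)  zero    = a
coeff (a ∷ p)  (suc k) = coeff p k

infix 4 _≈ₚ_
_≈ₚ_ : Poly → Poly → Set
p ≈ₚ q = ∀ k → coeff p k ≡ coeff q k

infixl 6 _+ₚ_
_+ₚ_ : Poly → Poly → Poly
[]      +ₚ q       = q
(a ∷ p) +ₚ []      = a ∷ p
(a ∷ p) +ₚ (b ∷ q) = (a ℚ.+ b) ∷ (p +ₚ q)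

scale : ℚ → Poly → Poly
scale c p = map (c ℚ.*_) p

infixl 7 _*ₚ_
_*ₚ_ : Poly → Poly → Poly
[]      *ₚ q = []
(a ∷ p) *ₚ q = scale a q +ₚ (0ℚ ∷ (p *ₚ q))

oneₚ : Poly
oneₚ = 1ℚ ∷ []

IsUnit : Poly → Set
IsUnit p = Σ Poly (λ g → p *ₚ g ≈ₚ oneₚ)

Irreducible : Poly → Set
Irreducible p = (¬ IsUnit p) × (∀ f g → p ≈ₚ f *ₚ g → IsUnit f ⊎ IsUnit g)

compSq : Poly → Poly
compSq []      = []
compSq (a ∷ p) = a ∷ 0ℚ ∷ compSq p

ℕ→ℚ : ℕ → ℚ
ℕ→ℚ m = (+ m) ℚ./ 1

fromCoeffs : ℕ → (ℕ → ℚ) → Poly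
fromCoeffs d c = go (suc d) zero
  where
  go : ℕ → ℕ → Poly
  go zero    i = []
  go (suc r) i = c i ∷ go r (suc i)

𝓑 : ℕ → ℕ → ℕ
𝓑 n k = n C ((n ∸ k) / 2)

-- P_n(z) = Σ_{k=0}^n 𝓑(n,k) z^{n-k}; coefficient of z^j is 𝓑(n, n-j)
P : ℕ → Poly
P n = fromCoeffs n (λ j → ℕ→ℚ (𝓑 n (n ∸ j)))

q : ℕ → Poly
q n = fromCoeffs (n / 2) (λ k → ℕ→ℚ (n C k))

onePlusZ : Poly
onePlusZ = 1ℚ ∷ 1ℚ ∷ []

{-# OPTIONS --safe #-}
module Submission where

-- Let n = 2m + 1, let p be a prime with m < p ≤ n, and let j = n - p.  Modulo p, q_n(x) ≡ (1 + x)^j, while p² divides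
-- neither the leading coefficient C(n, m) nor q_n(-1) = ± C(2m, m).  For a factorisation q_n(z²) = A(z) B(z), the product
-- of the norms A(z) A(-z) and B(z) B(-z), written as polynomials in y = z² + 1, is the square of q_n(y - 1), and an
-- Eisenstein argument at y = 0 shows that A or B has degree 0, j or 2j.
--
-- If A and B have degrees k, l > 0 with k ≤ l, every prime in (m, n] is therefore n - k, n - k/2 or n - l/2.  Erdős's
-- estimate of C(n, m) shows that (m, n] contains more than three primes for large m, and explicit quadruples of primes do
-- so from m = 14 on.  For smaller m, n may be prime (then j = 0), or the primes 2 (n = 9) and 3 (n = 15) help.

open import Defs
open import Data.Nat using (ℕ; _≤_; _%_)
open import Data.Product using (_×_)
open import Relation.Binary.PropositionalEquality using (_≡_)

-- The obstacle is that A and B need not be polynomials in z², so the shape of q_n modulo p says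
-- nothing about them directly. Norms bring both into the variable y, at the price of a square. For
-- j > 0 the Newton polygon of that square runs from (0, 2) to (2j, 0), and its one intermediate
-- lattice point (j, 1) is the reason that j appears beside 0 and 2j. These are degrees modulo p.
-- Since p² does not divide C(n, m), p divides the leading coefficient of at most one of A and B, so
-- one of them, but perhaps only one, keeps its degree. A single prime therefore leaves several
-- possibilities for (k, l), and the contradiction comes from having more primes than possible
-- values of n - j. The argument at p tolerates a scalar c prime to p in front of q_n(z²), so
-- denominators are handled one prime at a time.

module BinomialPrimes where

  open import Data.Nat
  open import Data.Nat.Properties
  open import Data.Nat.DivMod using (_/_; _%_; m≡m%n+[m/n]*n; m%n<n)
  open import Data.Nat.Divisibility
  open import Data.Nat.Primality
  open import Data.Nat.Primality.Factorisation using (factorise)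
  open import Data.Nat.Combinatorics using (_C_; nCn≡1; nCk≡nC[n∸k]; k>n⇒nCk≡0; nCk+nC[k+1]≡[n+1]C[k+1])
  open import Data.Nat.Induction using (<-rec)
  open import Data.Nat.ListAction using (product)
  open import Data.Nat.Tactic.RingSolver using (solve-∀)
  open import Data.Fin as Fin using (Fin; zero; suc)
  open import Data.Fin.Properties using (pigeonhole)
  open import Data.List using ([]; _∷_)
  open import Data.List.Relation.Unary.All using ([]; _∷_)
  open import Data.Product
  open import Data.Sum
  open import Data.Empty
  open import Data.Unit using (tt)
  open import Relation.Nullary
  open import Relation.Nullary.Decidable using (True; toWitness; _×-dec_)
  open import Relation.Binary.PropositionalEquality

  -- Primes and absorption identities for binomial coefficients

  prime≥2 : ∀ {p} → Prime p → 2 ≤ p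
  prime≥2 {p} pp = nonTrivial⇒n>1 p {{prime⇒nonTrivial pp}}

  prime∤1 : ∀ {p} → Prime p → ¬ p ∣ 1
  prime∤1 pp p∣1 = <⇒≱ (prime≥2 pp) (∣⇒≤ p∣1)

  prime∤* : ∀ {p m n} → Prime p → ¬ p ∣ m → ¬ p ∣ n → ¬ p ∣ m * n
  prime∤* {m = m} {n} pp p∤m p∤n p∣mn with euclidsLemma m n pp p∣mn
  ... | inj₁ p∣m = p∤m p∣m
  ... | inj₂ p∣n = p∤n p∣n

  ∤⇒>0 : ∀ {p u} → ¬ p ∣ u → 0 < u
  ∤⇒>0 {p} {zero} p∤u = ⊥-elim (p∤u (p ∣0))
  ∤⇒>0 {p} {suc u} p∤u = s≤s z≤n

  -- Pascal's recursion as a definition, so that inductions compute; `C≡binom` links it to `_C_`.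
  binom : ℕ → ℕ → ℕ
  binom _       zero    = 1
  binom zero    (suc k) = 0
  binom (suc n) (suc k) = binom n k + binom n (suc k)

  nC0≡1 : ∀ n → n C 0 ≡ 1
  nC0≡1 n = trans (nCk≡nC[n∸k] {k = 0} {n = n} z≤n) (nCn≡1 n)

  C≡binom : ∀ n k → n C k ≡ binom n k
  C≡binom n zero = nC0≡1 n
  C≡binom zero (suc k) = k>n⇒nCk≡0 {0} {suc k} (s≤s z≤n)
  C≡binom (suc n) (suc k) =
    trans (sym (nCk+nC[k+1]≡[n+1]C[k+1] n k)) (cong₂ _+_ (C≡binom n k) (C≡binom n (suc k)))

  binom-pos : ∀ {n k} → k ≤ n → 0 < binom n k
  binom-pos {n} {zero} _ = s≤s z≤n
  binom-pos {suc n} {suc k} (s≤s k≤n) = <-≤-trans (binom-pos k≤n) (m≤m+n _ _)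

  binom-zero : ∀ {n k} → n < k → binom n k ≡ 0
  binom-zero {zero} {suc k} _ = refl
  binom-zero {suc n} {suc k} (s≤s n<k) = cong₂ _+_ (binom-zero n<k) (binom-zero (m<n⇒m<1+n n<k))

  binom-1 : ∀ n → binom n 1 ≡ n
  binom-1 zero = refl
  binom-1 (suc n) = cong suc (binom-1 n)

  absorption : ∀ n k → suc k * binom (suc n) (suc k) ≡ suc n * binom n k
  absorption zero zero = refl
  absorption zero (suc k) = *-zeroʳ (suc (suc k))
  absorption (suc n) zero = trans (*-identityˡ _) (trans (binom-1 (suc (suc n))) (sym (*-identityʳ _)))
  absorption (suc n) (suc k) = begin
    suc (suc k) * (c₁ + c₂)
      ≡⟨ *-distribˡ-+ (suc (suc k)) c₁ c₂ ⟩
    (c₁ + suc k * c₁) + suc (suc k) * c₂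
      ≡⟨ cong₂ (λ s t → (c₁ + s) + t) (absorption n k) (absorption n (suc k)) ⟩
    (c₁ + suc n * binom n k) + suc n * binom n (suc k)
      ≡⟨ +-assoc c₁ _ _ ⟩
    c₁ + (suc n * binom n k + suc n * binom n (suc k))
      ≡⟨ cong (c₁ +_) (*-distribˡ-+ (suc n) (binom n k) (binom n (suc k))) ⟨
    c₁ + suc n * c₁ ∎
    where open ≡-Reasoning
          c₁ = binom (suc n) (suc k)
          c₂ = binom (suc n) (suc (suc k))

  absorption′ : ∀ k r → suc k * binom (k + r) (suc k) ≡ r * binom (k + r) k
  absorption′ k r = +-cancelˡ-≡ (suc k * binom (k + r) k) _ _ (begin
    suc k * binom (k + r) k + suc k * binom (k + r) (suc k) ≡⟨ *-distribˡ-+ (suc k) (binom (k + r) k) _ ⟨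
    suc k * binom (suc (k + r)) (suc k) ≡⟨ absorption (k + r) k ⟩
    (suc k + r) * binom (k + r) k ≡⟨ *-distribʳ-+ (binom (k + r) k) (suc k) r ⟩
    suc k * binom (k + r) k + r * binom (k + r) k ∎)
    where open ≡-Reasoning

  absorption″ : ∀ k r → suc r * binom (suc (k + r)) k ≡ suc (k + r) * binom (k + r) k
  absorption″ k r = trans
    (subst (λ n → suc r * binom n k ≡ suc k * binom n (suc k)) (+-suc k r) (sym (absorption′ k (suc r))))
    (absorption (k + r) k)

  -- Prime powers in binomial coefficients

  p-split : ∀ {p} → Prime p → ∀ n → 0 < n → ∃₂ λ a u → n ≡ p ^ a * u × ¬ p ∣ u
  p-split {p} pp = <-rec _ step
    where
    step : ∀ n → (∀ {m} → m < n → 0 < m → ∃₂ λ a u → m ≡ p ^ a * u × ¬ p ∣ u) →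
           0 < n → ∃₂ λ a u → n ≡ p ^ a * u × ¬ p ∣ u
    step n rec 0<n with p ∣? n
    ... | no p∤n = 0 , n , sym (*-identityˡ n) , p∤n
    ... | yes (divides zero eq) = ⊥-elim (<⇒≢ 0<n (sym eq))
    ... | yes (divides q@(suc _) eq) =
      let a , u , q≡ , p∤u = rec q<n (s≤s z≤n)
      in suc a , u , trans eq (trans (cong (_* p) q≡) (trans (*-comm (p ^ a * u) p) (sym (*-assoc p (p ^ a) u)))) , p∤u
      where
      q<n : q < n
      q<n = subst (q <_) (sym eq) (m<m*n q p (prime≥2 pp))

  ^-pos : ∀ {p} → Prime p → ∀ e → 0 < p ^ e
  ^-pos {p} pp e = m^n>0 p {{prime⇒nonZero pp}} e

  ∣^* : ∀ {p} a b u → a ≤ b → p ^ a * u ∣ p ^ b * u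
  ∣^* {p} a b u a≤b = *-monoˡ-∣ u (subst (p ^ a ∣_) (trans (sym (^-distribˡ-+-* p a (b ∸ a))) (cong (p ^_) (m+[n∸m]≡n a≤b))) (m∣m*n _))

  -- Leibniz's harmonic triangle at the prime p: the reciprocals of k C(n,k) are iterated differences of the reciprocals 1/n.
  leibniz : ∀ {p} → Prime p → ∀ e k n → n < p ^ suc e → suc k ≤ n →
            ∃ λ u → ¬ p ∣ u × suc k * binom n (suc k) ∣ p ^ e * u
  leibniz {p} pp e zero n n<p^ 1≤n with p-split pp n 1≤n
  ... | a , u , n≡ , p∤u = u , p∤u , subst (_∣ p ^ e * u) (trans (sym n≡) (sym (trans (*-identityˡ _) (binom-1 n)))) (∣^* a e u a≤e)
    where
    0<u = ∤⇒>0 p∤u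
    a≤e : a ≤ e
    a≤e with a ≤? e
    ... | yes q = q
    ... | no a≰e = ⊥-elim (<⇒≱ n<p^ (≤-trans (^-monoʳ-≤ p {{prime⇒nonZero pp}} (≰⇒> a≰e))
                     (subst (p ^ a ≤_) (sym n≡) (m≤m*n (p ^ a) u {{>-nonZero 0<u}}))))
  leibniz {p} pp e (suc k) (suc n) n<p^ (s≤s k<n)
    with leibniz pp e k n (<-trans (n<1+n n) n<p^) k<n | leibniz pp e k (suc n) n<p^ (m≤n⇒m≤1+n k<n)
  ... | u₁ , p∤u₁ , divides x eq₁ | u₂ , p∤u₂ , divides y eq₂ =
    u₁ * u₂ , prime∤* pp p∤u₁ p∤u₂ , subst (_∣ M) (sym (absorption n (suc k))) (∣m+n∣m⇒∣n (divides X sum) (divides Y refl))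
    where
    K = suc k
    r = n ∸ K
    n≡ : K + r ≡ n
    n≡ = m+[n∸m]≡n k<n
    b = binom n K
    c = binom (suc n) K
    M = p ^ e * (u₁ * u₂)
    X = x * u₂
    Y = y * u₁
    Xb : X * (K * b) ≡ M
    Xb = trans (trans (solve₁ x u₂ (K * b)) (cong (_* u₂) (sym eq₁))) (*-assoc (p ^ e) u₁ u₂)
      where solve₁ : ∀ a b c → a * b * c ≡ a * c * b
            solve₁ = solve-∀
    Yc : Y * (K * c) ≡ M
    Yc = trans (trans (solve₁ y u₁ (K * c)) (cong (_* u₁) (sym eq₂))) (solve₂ (p ^ e) u₁ u₂)
      where solve₁ : ∀ a b c → a * b * c ≡ a * c * b
            solve₁ = solve-∀
            solve₂ : ∀ a b c → a * c * b ≡ a * (b * c)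
            solve₂ = solve-∀
    ab : suc r * c ≡ suc n * b
    ab = subst (λ t → suc r * binom (suc t) K ≡ suc t * binom t K) n≡ (absorption″ K r)
    -- With X = M / (K b) and Y = M / (K c), this is 1 / ((n + 1) b) = 1 / (K b) - 1 / (K c) cleared
    -- of denominators; hence (n + 1) b divides M.
    sum : Y * (suc n * b) + M ≡ X * (suc n * b)
    sum = *-cancelˡ-≡ _ _ K (begin
      K * (Y * (suc n * b) + M) ≡⟨ cong (λ t → K * (Y * t + M)) ab ⟨
      K * (Y * (suc r * c) + M) ≡⟨ s₁ K Y r c M ⟩
      suc r * (Y * (K * c)) + K * M ≡⟨ cong (λ t → suc r * t + K * M) Yc ⟩
      suc r * M + K * M ≡⟨ s₂ r K M ⟩
      suc (K + r) * M ≡⟨ cong (λ t → suc t * M) n≡ ⟩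
      suc n * M ≡⟨ cong (suc n *_) Xb ⟨
      suc n * (X * (K * b)) ≡⟨ s₃ n X K b ⟩
      K * (X * (suc n * b)) ∎)
      where
      open ≡-Reasoning
      s₁ : ∀ K Y r c M → K * (Y * (suc r * c) + M) ≡ suc r * (Y * (K * c)) + K * M
      s₁ = solve-∀
      s₂ : ∀ r K M → suc r * M + K * M ≡ suc (K + r) * M
      s₂ = solve-∀
      s₃ : ∀ n X K b → suc n * (X * (K * b)) ≡ K * (X * (suc n * b))
      s₃ = solve-∀

  -- Otherwise `leibniz` makes the coefficient a divisor of p^e u with u prime to p, which has no
  -- room for p^(e+1). No count of carries or of multiples in factorials is involved.
  p^e∣binom⇒p^e≤n : ∀ {p} → Prime p → ∀ e n k → k ≤ n → p ^ suc e ∣ binom n k → p ^ suc e ≤ n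
  p^e∣binom⇒p^e≤n {p} pp e n zero _ p∣ = ⊥-elim (prime∤1 pp (∣-trans (m∣m*n (p ^ e)) p∣))
  p^e∣binom⇒p^e≤n {p} pp e n (suc k) k≤n p∣ with p ^ suc e ≤? n
  ... | yes q = q
  ... | no ¬q with leibniz pp e k n (≰⇒> ¬q) k≤n
  ... | u , p∤u , D∣ = ⊥-elim (p∤u (*-cancelʳ-∣ (p ^ e) {{>-nonZero (^-pos pp e)}}
          (subst (p * p ^ e ∣_) (*-comm (p ^ e) u) (∣-trans p∣ (∣-trans (n∣m*n (suc k)) D∣)))))

  binom-fact : ∀ k r → binom (k + r) k * (k ! * r !) ≡ (k + r) !
  binom-fact zero r = trans (+-identityʳ _) (+-identityʳ _)
  binom-fact (suc k) r = begin
    binom (suc (k + r)) (suc k) * (suc k * k ! * r !) ≡⟨ s (binom (suc (k + r)) (suc k)) (suc k) (k !) (r !) ⟩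
    (suc k * binom (suc (k + r)) (suc k)) * (k ! * r !) ≡⟨ cong (_* (k ! * r !)) (absorption (k + r) k) ⟩
    suc (k + r) * binom (k + r) k * (k ! * r !) ≡⟨ *-assoc (suc (k + r)) (binom (k + r) k) _ ⟩
    suc (k + r) * (binom (k + r) k * (k ! * r !)) ≡⟨ cong (suc (k + r) *_) (binom-fact k r) ⟩
    suc (k + r) * (k + r) ! ∎
    where open ≡-Reasoning
          s : ∀ b k f g → b * (k * f * g) ≡ (k * b) * (f * g)
          s = solve-∀

  -- Size and prime divisors of C(2m + 1, m)

  mid : ℕ → ℕ
  mid m = binom (suc (m + m)) m

  -- Two absorptions, through C(2m + 2, m). The ratio 2(2m + 3)/(m + 2) lies between 4(m + 1)/(m +
  -- 2) and 4, and `4^≤mid` and `mid≤4^` multiply these bounds up.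
  mid-suc : ∀ m → suc (suc m) * mid (suc m) ≡ 2 * (3 + (m + m)) * mid m
  mid-suc m = *-cancelˡ-≡ _ _ (suc m) (begin
    suc m * (suc (suc m) * b₂) ≡⟨ s₁ (suc m) (suc (suc m)) b₂ ⟩
    suc (suc m) * (suc m * b₂) ≡⟨ cong (suc (suc m) *_) e₁ ⟩
    suc (suc m) * (suc (suc (suc (m + m))) * b₁) ≡⟨ s₁ (suc (suc m)) (suc (suc (suc (m + m)))) b₁ ⟩
    suc (suc (suc (m + m))) * (suc (suc m) * b₁) ≡⟨ cong (suc (suc (suc (m + m))) *_) e₂ ⟩
    suc (suc (suc (m + m))) * (suc (suc (m + m)) * mid m) ≡⟨ s₂ m (mid m) ⟩
    suc m * (2 * (3 + (m + m)) * mid m) ∎)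
    where
    open ≡-Reasoning
    b₁ = binom (suc (suc (m + m))) m
    b₂ = mid (suc m)
    s₁ : ∀ a b c → a * (b * c) ≡ b * (a * c)
    s₁ = solve-∀
    s₂ : ∀ m b → suc (suc (suc (m + m))) * (suc (suc (m + m)) * b) ≡ suc m * (2 * (3 + (m + m)) * b)
    s₂ = solve-∀
    e₁ : suc m * b₂ ≡ suc (suc (suc (m + m))) * b₁
    e₁ = subst (λ t → suc m * binom (suc (suc t)) (suc m) ≡ suc (suc (suc (m + m))) * b₁) (sym (+-suc m m))
           (absorption (suc (suc (m + m))) m)
    e₂ : suc (suc m) * b₁ ≡ suc (suc (m + m)) * mid m
    e₂ = subst (λ t → suc (suc m) * binom (suc t) m ≡ suc t * binom t m) (+-suc m m) (absorption″ m (suc m))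

  mid≤4^ : ∀ m → mid m ≤ 4 ^ m
  mid≤4^ zero = ≤-refl
  mid≤4^ (suc m) = *-cancelˡ-≤ (suc (suc m)) (begin
    suc (suc m) * mid (suc m) ≡⟨ mid-suc m ⟩
    2 * (3 + (m + m)) * mid m ≤⟨ *-mono-≤ (subst (2 * (3 + (m + m)) ≤_) (s m) (m≤n+m _ 2)) (mid≤4^ m) ⟩
    suc (suc m) * 4 * 4 ^ m ≡⟨ *-assoc (suc (suc m)) 4 (4 ^ m) ⟩
    suc (suc m) * 4 ^ suc m ∎)
    where open ≤-Reasoning
          s : ∀ m → 2 + 2 * (3 + (m + m)) ≡ suc (suc m) * 4
          s = solve-∀

  4^≤mid : ∀ m → 4 ^ m ≤ suc m * mid m
  4^≤mid zero = ≤-refl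
  4^≤mid (suc m) = begin
    4 * 4 ^ m ≤⟨ *-monoʳ-≤ 4 (4^≤mid m) ⟩
    4 * (suc m * mid m) ≡⟨ *-assoc 4 (suc m) (mid m) ⟨
    4 * suc m * mid m ≤⟨ *-monoˡ-≤ (mid m) (subst (4 * suc m ≤_) (s m) (m≤n+m _ 2)) ⟩
    2 * (3 + (m + m)) * mid m ≡⟨ mid-suc m ⟨
    suc (suc m) * mid (suc m) ∎
    where open ≤-Reasoning
          s : ∀ m → 2 + 4 * suc m ≡ 2 * (3 + (m + m))
          s = solve-∀

  -- The factors from c p + 1 to c p + i stop short of the next multiple of p.
  fact-quotient : ∀ {p} → Prime p → ∀ c i → i < p → ∃ λ v → ¬ p ∣ v × (c * p + i) ! ≡ (c * p) ! * v
  fact-quotient {p} pp c zero _ = 1 , prime∤1 pp , trans (cong _! (+-identityʳ (c * p))) (sym (*-identityʳ ((c * p) !)))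
  fact-quotient {p} pp c (suc i) i<p with fact-quotient pp c i (<-trans (n<1+n i) i<p)
  ... | v , p∤v , eq = suc (c * p + i) * v , prime∤* pp p∤ p∤v , (begin
    (c * p + suc i) ! ≡⟨ cong _! (+-suc (c * p) i) ⟩
    suc (c * p + i) * (c * p + i) ! ≡⟨ cong (suc (c * p + i) *_) eq ⟩
    suc (c * p + i) * ((c * p) ! * v) ≡⟨ s (suc (c * p + i)) ((c * p) !) v ⟩
    (c * p) ! * (suc (c * p + i) * v) ∎)
    where
    open ≡-Reasoning
    s : ∀ a b c → a * (b * c) ≡ b * (a * c)
    s = solve-∀
    p∤ : ¬ p ∣ suc (c * p + i)
    p∤ q = <⇒≱ i<p (∣⇒≤ (∣m+n∣m⇒∣n (subst (p ∣_) (sym (+-suc (c * p) i)) q) (n∣m*n c)))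

  fact-multiple : ∀ {p} → Prime p → ∀ c → ∃ λ v → ¬ p ∣ v × (suc c * p) ! ≡ suc c * p * ((c * p) ! * v)
  fact-multiple {suc p} pp c with fact-quotient pp c p ≤-refl
  ... | v , p∤v , eq = v , p∤v , trans (cong _! (trans (cong suc (+-comm p (c * suc p))) (sym (+-suc (c * suc p) p))))
     (trans (cong _! (+-suc (c * suc p) p)) (cong₂ _*_ (trans (sym (+-suc (c * suc p) p)) (+-comm (c * suc p) (suc p))) eq))

  -- Here m! and (m+1)! account for all the factors p of (2m+1)!.
  ∤mid : ∀ {p} → Prime p → 3 ≤ p → ∀ m → suc (m + m) < 3 * p → p ≤ suc m → ¬ p ∣ mid m
  ∤mid {p} pp 3≤p m L<3p p≤m+1 p∣ with m≤n⇒m<n∨m≡n p≤m+1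
  ... | inj₂ refl with fact-quotient pp 0 m ≤-refl | fact-quotient pp 1 m ≤-refl | fact-multiple pp 0
  ... | v₀ , p∤v₀ , e₀ | v₁ , p∤v₁ , e₁ | v₂ , p∤v₂ , e₂ = p∤v₁ (subst (p ∣_) (*-cancelˡ-≡ _ _ (p !) {{p !≢0}} eq) (∣-trans p∣ (m∣m*n _)))
    where
    f : mid m * (m ! * suc m !) ≡ (p + m) !
    f = subst (λ t → binom t m * (m ! * suc m !) ≡ t !) (+-suc m m) (binom-fact m (suc m))
    s : ∀ b m s → b * (m * s) ≡ s * (b * m)
    s = solve-∀
    eq : p ! * (mid m * m !) ≡ p ! * v₁
    eq = trans (sym (s (mid m) (m !) (p !))) (trans f (trans (cong (λ t → (t + m) !) (sym (+-identityʳ p))) (trans e₁ (cong (λ t → t ! * v₁) (+-identityʳ p)))))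
  ∤mid {p} pp 3≤p m L<3p p≤m+1 p∣ | inj₁ (s≤s p≤m) = prime∤* pp p∤2 (prime∤* pp p∤w p∤v₂) (subst (p ∣_) eq (∣-trans p∣ (m∣m*n _)))
    where
    t = m ∸ p
    m≡ : m ≡ 1 * p + t
    m≡ = trans (sym (m+[n∸m]≡n p≤m)) (cong (_+ t) (sym (+-identityʳ p)))
    L≡ : suc (m + m) ≡ 2 * p + suc (t + t)
    L≡ = trans (cong (λ m → suc (m + m)) m≡) (s p t)
      where s : ∀ p t → suc ((1 * p + t) + (1 * p + t)) ≡ 2 * p + suc (t + t)
            s = solve-∀
    -- With m = p + t, the bound 2m + 1 < 3p leaves exactly one, one and two multiples of p in m!,
    -- (m + 1)! and (2m + 1)!. Their factors p cancel, and what remains of 2p is the 2, which is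
    -- harmless because p ≥ 3.
    2t+1<p : suc (t + t) < p
    2t+1<p = +-cancelˡ-< (2 * p) _ _ (subst₂ _<_ L≡ (s p) L<3p)
      where s : ∀ p → 3 * p ≡ 2 * p + p
            s = solve-∀
    Q₀ = fact-quotient pp 1 t (≤-<-trans (m≤m+n t t) (<-trans (n<1+n _) 2t+1<p))
    Q₁ = fact-quotient pp 1 (suc t) (≤-<-trans (s≤s (m≤m+n t t)) 2t+1<p)
    Q₂ = fact-quotient pp 2 (suc (t + t)) 2t+1<p
    W = fact-multiple pp 1
    a = proj₁ Q₀
    b = proj₁ Q₁
    v₂ = proj₁ Q₂
    p∤v₂ = proj₁ (proj₂ Q₂)
    w = proj₁ W
    p∤w = proj₁ (proj₂ W)
    V = fact-multiple pp 0
    v = proj₁ V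
    F = (1 * p) !
    F≡ : F ≡ p * v
    F≡ = trans (proj₂ (proj₂ V)) (cong₂ _*_ (+-identityʳ p) (+-identityʳ v))
    p∤2 : ¬ p ∣ 2
    p∤2 q = <⇒≱ 3≤p (∣⇒≤ q)
    open ≡-Reasoning
    f : mid m * ((F * a) * (F * b)) ≡ 2 * p * (F * w) * v₂
    f = begin
      mid m * ((F * a) * (F * b)) ≡⟨ cong₂ (λ x y → mid m * (x * y)) (sym (trans (cong _! m≡) (proj₂ (proj₂ Q₀))))
            (sym (trans (cong _! (trans (cong suc m≡) (sym (+-suc (1 * p) t)))) (proj₂ (proj₂ Q₁)))) ⟩
      mid m * (m ! * suc m !) ≡⟨ subst (λ t → binom t m * (m ! * suc m !) ≡ t !) (+-suc m m) (binom-fact m (suc m)) ⟩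
      suc (m + m) ! ≡⟨ cong _! L≡ ⟩
      (2 * p + suc (t + t)) ! ≡⟨ proj₂ (proj₂ Q₂) ⟩
      (2 * p) ! * v₂ ≡⟨ cong (_* v₂) (proj₂ (proj₂ W)) ⟩
      2 * p * (F * w) * v₂ ∎
    eq : mid m * (v * (a * b)) ≡ 2 * (w * v₂)
    eq = *-cancelˡ-≡ _ _ (p * F) {{m*n≢0 p F {{prime⇒nonZero pp}} {{(1 * p) !≢0}}}} (begin
      p * F * (mid m * (v * (a * b))) ≡⟨ s₁ p F (mid m) v a b ⟩
      mid m * (F * a * ((p * v) * b)) ≡⟨ cong (λ z → mid m * (F * a * (z * b))) (sym F≡) ⟩
      mid m * ((F * a) * (F * b)) ≡⟨ f ⟩
      2 * p * (F * w) * v₂ ≡⟨ s₂ p F w v₂ ⟩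
      p * F * (2 * (w * v₂)) ∎)
      where
      s₁ : ∀ p F m v a b → p * F * (m * (v * (a * b))) ≡ m * (F * a * ((p * v) * b))
      s₁ = solve-∀
      s₂ : ∀ p F w v → 2 * p * (F * w) * v ≡ p * F * (2 * (w * v))
      s₂ = solve-∀

  -- Products over primes and the bound 4^n for the primorial

  Πprod : (ℕ → ℕ) → ℕ → ℕ
  Πprod w zero = 1
  Πprod w (suc t) = Πprod w t * w (suc t)

  Πprod-* : ∀ u v t → Πprod (λ i → u i * v i) t ≡ Πprod u t * Πprod v t
  Πprod-* u v zero = refl
  Πprod-* u v (suc t) = trans (cong (_* (u (suc t) * v (suc t))) (Πprod-* u v t)) (s (Πprod u t) (Πprod v t) (u (suc t)) (v (suc t)))
    where s : ∀ a b c d → a * b * (c * d) ≡ a * c * (b * d)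
          s = solve-∀

  primePart : ℕ → ℕ
  primePart i with prime? i
  ... | yes _ = i
  ... | no  _ = 1

  primePart-prime : ∀ {i} → Prime i → primePart i ≡ i
  primePart-prime {i} pi with prime? i
  ... | yes _ = refl
  ... | no ¬pi = ⊥-elim (¬pi pi)

  primePart≥1 : ∀ i → 1 ≤ primePart i
  primePart≥1 i with prime? i
  ... | yes pi = ≤-trans (s≤s z≤n) (prime≥2 pi)
  ... | no _ = ≤-refl

  primorial : ℕ → ℕ
  primorial = Πprod primePart

  primesIn : ℕ → ℕ → ℕ
  primesIn a r = Πprod (λ i → primePart (a + i)) r

  primorial-+ : ∀ a r → primorial (a + r) ≡ primorial a * primesIn a r
  primorial-+ a zero = trans (cong primorial (+-identityʳ a)) (sym (*-identityʳ _))
  primorial-+ a (suc r) = begin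
    primorial (a + suc r) ≡⟨ cong primorial (+-suc a r) ⟩
    primorial (a + r) * primePart (suc (a + r)) ≡⟨ cong₂ (λ x y → x * primePart y) (primorial-+ a r) (sym (+-suc a r)) ⟩
    primorial a * primesIn a r * primePart (a + suc r) ≡⟨ *-assoc (primorial a) _ _ ⟩
    primorial a * (primesIn a r * primePart (a + suc r)) ∎
    where open ≡-Reasoning

  ∤primesIn : ∀ {p} → Prime p → ∀ a r → a + r < p → ¬ p ∣ primesIn a r
  ∤primesIn pp a zero _ = prime∤1 pp
  ∤primesIn {p} pp a (suc r) lt = prime∤* pp (∤primesIn pp a r (<-trans (subst (a + r <_) (sym (+-suc a r)) ≤-refl) lt)) ∤last
    where
    ∤last : ¬ p ∣ primePart (a + suc r)
    ∤last with prime? (a + suc r)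
    ... | no _ = prime∤1 pp
    ... | yes pa = λ p∣ → <⇒≱ lt (∣⇒≤ {{prime⇒nonZero pa}} p∣)

  -- A further prime exceeds all the earlier ones, so by Euclid's lemma it divides the cofactor x of
  -- their product in N.
  primesIn-∣ : ∀ N a r → (∀ {p} → Prime p → a < p → p ≤ a + r → p ∣ N) → primesIn a r ∣ N
  primesIn-∣ N a zero h = 1∣ N
  primesIn-∣ N a (suc r) h with primesIn-∣ N a r (λ pp l u → h pp l (≤-trans u (+-monoʳ-≤ a (n≤1+n r))))
  ... | divides x eq with prime? (a + suc r)
  ...   | no _ = subst (_∣ N) (sym (*-identityʳ _)) (divides x eq)
  ...   | yes pa with euclidsLemma x (primesIn a r) pa (subst (a + suc r ∣_) eq (h pa (subst (a <_) (sym (+-suc a r)) (s≤s (m≤m+n a r))) ≤-refl))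
  ...     | inj₁ (divides y eq′) = divides y (trans eq (trans (cong (_* primesIn a r) eq′) (trans (*-assoc y _ _) (cong (y *_) (*-comm (a + suc r) _)))))
  ...     | inj₂ q = ⊥-elim (∤primesIn pa a r (subst (a + r <_) (sym (+-suc a r)) ≤-refl) q)

  -- The prime p divides (k + r)! but, being larger than k and r, neither k! nor r!.
  ∣binom : ∀ {p} → Prime p → ∀ k r → k < p → r < p → p ≤ k + r → p ∣ binom (k + r) k
  ∣binom {p} pp k r k<p r<p p≤ with euclidsLemma (binom (k + r) k) _ pp (subst (p ∣_) (sym (binom-fact k r)) (m≤n⇒m!∣n!′ p≤))
    where
    m≤n⇒m!∣n!′ : p ≤ k + r → p ∣ (k + r) !
    m≤n⇒m!∣n!′ q = ∣-trans (p∣p! p pp) (m≤n⇒m!∣n! q)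
      where p∣p! : ∀ p → Prime p → p ∣ p !
            p∣p! zero pp = ⊥-elim (¬prime[0] pp)
            p∣p! (suc p) pp = m∣m*n (p !)
  ... | inj₁ q = q
  ... | inj₂ q = ⊥-elim (prime∤* pp (p∤ k k<p) (p∤ r r<p) q)
    where
    p∤ : ∀ i → i < p → ¬ p ∣ i !
    p∤ i i<p q with fact-quotient pp 0 i i<p
    ... | v , p∤v , eq = p∤v (subst (p ∣_) (trans eq (*-identityˡ v)) q)

  halve : ∀ n → (∃ λ m → n ≡ m + m) ⊎ (∃ λ m → n ≡ suc (m + m))
  halve zero = inj₁ (0 , refl)
  halve (suc n) with halve n
  ... | inj₁ (m , eq) = inj₂ (m , cong suc eq)
  ... | inj₂ (m , eq) = inj₁ (suc m , trans (cong suc eq) (cong suc (sym (+-suc m m))))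

  -- Strong induction by parity. An even n > 2 contributes no prime. For n = 2m + 1 the primes in (m
  -- + 1, n] all divide C(n, m) ≤ 4^m, and the induction hypothesis bounds those up to m + 1.
  primorial≤4^ : ∀ n → primorial n ≤ 4 ^ n
  primorial≤4^ = <-rec _ step
    where
    step : ∀ n → (∀ {m} → m < n → primorial m ≤ 4 ^ m) → primorial n ≤ 4 ^ n
    step n rec with halve n
    ... | inj₁ (zero , refl) = ≤-refl
    ... | inj₁ (suc zero , refl) = m≤m+n 2 14
    ... | inj₁ (suc m@(suc k) , refl) with prime? (suc m + suc m)
    ...   | yes pn = ⊥-elim (prime⇒¬composite pn (composite {d = 2} (s≤s (s≤s (≤-trans (s≤s z≤n) (m≤n+m (suc (suc k)) k)))) (divides (suc m) (s (suc m)))))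
      where s : ∀ m → m + m ≡ m * 2
            s = solve-∀
    ...   | no ¬p = ≤-trans (≤-reflexive (*-identityʳ _)) (≤-trans (rec ≤-refl) (^-monoʳ-≤ 4 (n≤1+n (m + suc m))))
    step n rec | inj₂ (zero , refl) = m≤m+n 1 3
    step n rec | inj₂ (m@(suc m′) , refl) = begin
      primorial (suc m + m) ≡⟨ primorial-+ (suc m) m ⟩
      primorial (suc m) * primesIn (suc m) m ≤⟨ *-mono-≤ (rec (s≤s (m<m+n m (s≤s z≤n)))) (∣⇒≤ {{>-nonZero (binom-pos (m≤n⇒m≤1+n (m≤m+n m m)))}} div) ⟩
      4 ^ suc m * mid m ≤⟨ *-monoʳ-≤ (4 ^ suc m) (mid≤4^ m) ⟩
      4 ^ suc m * 4 ^ m ≡⟨ ^-distribˡ-+-* 4 (suc m) m ⟨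
      4 ^ (suc m + m) ∎
      where
      open ≤-Reasoning
      div : primesIn (suc m) m ∣ mid m
      div = primesIn-∣ (mid m) (suc m) m λ {p} pp l u →
        subst (λ t → p ∣ binom t m) (+-suc m m) (∣binom pp m (suc m) (<-trans (n<1+n m) l) l (subst (p ≤_) (sym (+-suc m m)) u))

  primeFactor : ∀ N → 2 ≤ N → ∃ λ p → Prime p × p ∣ N
  primeFactor N@(suc _) 2≤N with factorise N
  ... | record { factors = [] ; isFactorisation = eq } = ⊥-elim (<⇒≢ 2≤N (sym eq))
  ... | record { factors = p ∷ ps ; isFactorisation = eq ; factorsPrime = pp ∷ _ } = p , pp , subst (p ∣_) (sym eq) (m∣m*n (product ps))

  -- N is the product of its maximal prime powers, which are split off from the largest prime
  -- downwards; weights at other indices can only enlarge the product.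
  ≤Πprod : ∀ (w : ℕ → ℕ) → (∀ i → 1 ≤ w i) → ∀ t N → 0 < N → (∀ {p} → Prime p → p ∣ N → p ≤ t) →
           (∀ {p} → Prime p → ∀ e → p ^ e ∣ N → p ^ e ≤ w p) → N ≤ Πprod w t
  ≤Πprod w w≥1 zero N 0<N small bd with 2 ≤? N
  ... | no ¬2≤N = ≤-pred (≰⇒> ¬2≤N)
  ... | yes 2≤N with primeFactor N 2≤N
  ...   | p , pp , p∣N = ⊥-elim (<⇒≱ (prime≥2 pp) (≤-trans (small pp p∣N) z≤n))
  ≤Πprod w w≥1 (suc t) N 0<N small bd with prime? (suc t)
  ... | no ¬p = ≤-trans (≤Πprod w w≥1 t N 0<N small′ bd) (m≤m*n _ (w (suc t)) {{>-nonZero (w≥1 (suc t))}})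
    where
    small′ : ∀ {p} → Prime p → p ∣ N → p ≤ t
    small′ pp p∣N with m≤n⇒m<n∨m≡n (small pp p∣N)
    ... | inj₁ (s≤s q) = q
    ... | inj₂ refl = ⊥-elim (¬p pp)
  ... | yes pt with p-split pt N 0<N
  ...   | a , u , N≡ , p∤u = begin
    N ≡⟨ N≡ ⟩
    suc t ^ a * u ≡⟨ *-comm (suc t ^ a) u ⟩
    u * suc t ^ a ≤⟨ *-mono-≤ (≤Πprod w w≥1 t u (∤⇒>0 p∤u) small′ (λ pp e q → bd pp e (∣-trans q u∣N))) (bd pt a (subst (suc t ^ a ∣_) (sym N≡) (m∣m*n u))) ⟩
    Πprod w (suc t) ∎
    where
    open ≤-Reasoning
    u∣N : u ∣ N
    u∣N = subst (u ∣_) (sym N≡) (n∣m*n (suc t ^ a))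
    small′ : ∀ {p} → Prime p → p ∣ u → p ≤ t
    small′ pp p∣u with m≤n⇒m<n∨m≡n (small pp (∣-trans p∣u u∣N))
    ... | inj₁ (s≤s q) = q
    ... | inj₂ refl = ⊥-elim (p∤u p∣u)

  when : {A : Set} → Dec A → ℕ → ℕ
  when (yes _) n = n
  when (no  _) n = 1

  when-yes : ∀ {A : Set} (d : Dec A) n → A → when d n ≡ n
  when-yes (yes _) n _ = refl
  when-yes (no ¬a) n a = ⊥-elim (¬a a)

  when≥1 : ∀ {A : Set} (d : Dec A) {n} → 1 ≤ n → 1 ≤ when d n
  when≥1 (yes _) 1≤n = 1≤n
  when≥1 (no _) 1≤n = ≤-refl

  Πprod-mono : ∀ f → (∀ i → 1 ≤ f i) → ∀ {a b} → a ≤ b → Πprod f a ≤ Πprod f b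
  Πprod-mono f f≥1 {b = zero} z≤n = ≤-refl
  Πprod-mono f f≥1 {a} {suc b} a≤b with m≤n⇒m<n∨m≡n a≤b
  ... | inj₂ refl = ≤-refl
  ... | inj₁ (s≤s q) = ≤-trans (Πprod-mono f f≥1 q) (m≤m*n _ (f (suc b)) {{>-nonZero (f≥1 (suc b))}})

  Πprod-upTo : ∀ f → (∀ i → 1 ≤ f i) → ∀ s t → Πprod (λ i → when (i ≤? s) (f i)) t ≤ Πprod f s
  Πprod-upTo f f≥1 s t = ≤-trans (go t) (Πprod-mono f f≥1 (m⊓n≤n t s))
    where
    go : ∀ t → Πprod (λ i → when (i ≤? s) (f i)) t ≤ Πprod f (t ⊓ s)
    go zero = ≤-refl
    go (suc t) with suc t ≤? s
    ... | yes q = ≤-trans (*-monoˡ-≤ (f (suc t)) (≤-trans (go t) (≤-reflexive (cong (Πprod f) (m≤n⇒m⊓n≡m (<⇒≤ q))))))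
                    (≤-reflexive (cong (Πprod f) (sym (m≤n⇒m⊓n≡m q))))
    ... | no ¬q = ≤-trans (≤-reflexive (*-identityʳ _)) (≤-trans (go t)
                    (≤-reflexive (cong (Πprod f) (trans (m≥n⇒m⊓n≡n (≤-pred (≰⇒> ¬q))) (sym (m≥n⇒m⊓n≡n (<⇒≤ (≰⇒> ¬q))))))))

  Πprod-const : ∀ c t → Πprod (λ _ → c) t ≡ c ^ t
  Πprod-const c zero = refl
  Πprod-const c (suc t) = trans (cong (_* c) (Πprod-const c t)) (*-comm (c ^ t) c)

  Πprod-at : ∀ c x → 1 ≤ c → ∀ t → Πprod (λ i → when (i ≟ x) c) t ≤ c
  Πprod-at c x 1≤c t = ≤-trans (go t) (bound (x ≤? t))
    where
    bound : ∀ {A : Set} (d : Dec A) → when d c ≤ c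
    bound (yes _) = ≤-refl
    bound (no _) = 1≤c
    go : ∀ t → Πprod (λ i → when (i ≟ x) c) t ≤ when (x ≤? t) c
    go zero = when≥1 (x ≤? 0) 1≤c
    go (suc t) with suc t ≟ x
    ... | yes refl with suc t ≤? t | suc t ≤? suc t | go t
    ...   | yes q | _ | _ = ⊥-elim (<-irrefl refl q)
    ...   | no _ | no ¬q | _ = ⊥-elim (¬q ≤-refl)
    ...   | no _ | yes _ | r = ≤-trans (*-monoˡ-≤ c r) (≤-reflexive (*-identityˡ c))
    go (suc t) | no ¬q with x ≤? t | x ≤? suc t | go t
    ...   | yes q | no ¬r | _ = ⊥-elim (¬r (m≤n⇒m≤1+n q))
    ...   | yes _ | yes _ | r = ≤-trans (≤-reflexive (*-identityʳ _)) r
    ...   | no _ | yes _ | r = ≤-trans (≤-reflexive (*-identityʳ _)) (≤-trans r 1≤c)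
    ...   | no _ | no _ | r = ≤-trans (≤-reflexive (*-identityʳ _)) r

  -- Numerical inequalities for Erdős's argument

  √-floor : ∀ n → ∃ λ s → s * s ≤ n × n < suc s * suc s
  √-floor zero = 0 , z≤n , s≤s z≤n
  √-floor (suc n) with √-floor n
  ... | s , l , u with suc s * suc s ≤? suc n
  ...   | yes q = suc s , q , ≤-<-trans u (*-mono-< (n<1+n (suc s)) (n<1+n (suc s)))
  ...   | no ¬q = s , m≤n⇒m≤1+n l , ≰⇒> ¬q

  ^-distribʳ-* : ∀ a b n → (a * b) ^ n ≡ a ^ n * b ^ n
  ^-distribʳ-* a b zero = refl
  ^-distribʳ-* a b (suc n) = trans (cong (a * b *_) (^-distribʳ-* a b n)) (s a b (a ^ n) (b ^ n))
    where s : ∀ a b c d → a * b * (c * d) ≡ a * c * (b * d)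
          s = solve-∀

  ^8-step : ∀ a b x → .{{NonZero a}} → b ^ 8 ≤ 2 * a ^ 8 → a * suc x ≤ b * x → suc x ^ 8 ≤ 2 * x ^ 8
  ^8-step a b x b^8≤ le = *-cancelˡ-≤ (a ^ 8) {{m^n≢0 a 8}} (begin
    a ^ 8 * suc x ^ 8 ≡⟨ ^-distribʳ-* a (suc x) 8 ⟨
    (a * suc x) ^ 8 ≤⟨ ^-monoˡ-≤ 8 le ⟩
    (b * x) ^ 8 ≡⟨ ^-distribʳ-* b x 8 ⟩
    b ^ 8 * x ^ 8 ≤⟨ *-monoˡ-≤ (x ^ 8) b^8≤ ⟩
    2 * a ^ 8 * x ^ 8 ≡⟨ s (a ^ 8) (x ^ 8) ⟩
    a ^ 8 * (2 * x ^ 8) ∎)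
    where open ≤-Reasoning
          s : ∀ a x → 2 * a * x ≡ a * (2 * x)
          s = solve-∀

  -- The start 44 is sharp: 45^8 < 2^44, but 44^8 > 2^43. From there on (s + 2)/(s + 1) is at most
  -- 45/44, whose eighth power is below 2.
  suc^8≤2^ : ∀ {s} → 44 ≤′ s → suc s ^ 8 ≤ 2 ^ s
  suc^8≤2^ (≤′-reflexive refl) = ≤ᵇ⇒≤ (45 ^ 8) (2 ^ 44) tt
  suc^8≤2^ (≤′-step {s} 44≤s) =
    ≤-trans (^8-step 44 45 (suc s) (≤ᵇ⇒≤ (45 ^ 8) (2 * 44 ^ 8) tt) le) (*-monoʳ-≤ 2 (suc^8≤2^ 44≤s))
    where
    le : 44 * suc (suc s) ≤ 45 * suc s
    le = subst₂ _≤_ (s₁ s) (s₂ s) (+-monoʳ-≤ (44 * suc s) (≤-trans (≤′⇒≤ 44≤s) (n≤1+n s)))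
      where
      s₁ : ∀ s → 44 * suc s + 44 ≡ 44 * suc (suc s)
      s₁ s = trans (+-comm (44 * suc s) 44) (sym (*-suc 44 (suc s)))
      s₂ : ∀ s → 44 * suc s + suc s ≡ 45 * suc s
      s₂ s = +-comm (44 * suc s) (suc s)

  ^-square : ∀ a n → (a * a) ^ n ≡ a ^ (n + n)
  ^-square a n = trans (^-distribʳ-* a a n) (sym (^-distribˡ-+-* a n n))

  -- Since h is at most a third of 2(d + h) + 1, d is at least about a sixth of it, hence about s²/6
  -- or more. Then 8d is at least about 4s²/3, which outgrows s² + 4s.
  small-square : ∀ s d h → 44 ≤ s → s * s ≤ suc ((d + h) + (d + h)) → 3 * h ≤ suc ((d + h) + (d + h)) → ¬ d * 8 ≤ s * (s + 4)
  small-square s d h 44≤s s²≤ 3h≤ 8d≤ = <⇒≱ (<-≤-trans 12s+12<44s (*-monoˡ-≤ s 44≤s)) s*s≤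
    where
    open ≤-Reasoning
    h≤ : h ≤ suc (d + d)
    h≤ = +-cancelˡ-≤ (h + h) _ _ (subst₂ _≤_ (e₁ h) (e₂ d h) 3h≤)
      where
      e₁ : ∀ h → 3 * h ≡ h + h + h
      e₁ = solve-∀
      e₂ : ∀ d h → suc ((d + h) + (d + h)) ≡ h + h + suc (d + d)
      e₂ = solve-∀
    s²≤′ : s * s ≤ 6 * d + 3
    s²≤′ = ≤-trans s²≤ (≤-trans (s≤s (+-mono-≤ (+-monoʳ-≤ d h≤) (+-monoʳ-≤ d h≤))) (≤-reflexive (e d)))
      where
      e : ∀ d → suc ((d + suc (d + d)) + (d + suc (d + d))) ≡ 6 * d + 3
      e = solve-∀
    s*s≤ : s * s ≤ 12 * s + 12
    s*s≤ = +-cancelˡ-≤ (3 * (s * s)) _ _ (begin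
      3 * (s * s) + s * s ≡⟨ e₁ (s * s) ⟩
      4 * (s * s) ≤⟨ *-monoʳ-≤ 4 s²≤′ ⟩
      4 * (6 * d + 3) ≡⟨ e₂ d ⟩
      3 * (d * 8) + 12 ≤⟨ +-monoˡ-≤ 12 (*-monoʳ-≤ 3 8d≤) ⟩
      3 * (s * (s + 4)) + 12 ≡⟨ e₃ s ⟩
      3 * (s * s) + (12 * s + 12) ∎)
      where
      e₁ : ∀ x → 3 * x + x ≡ 4 * x
      e₁ = solve-∀
      e₂ : ∀ d → 4 * (6 * d + 3) ≡ 3 * (d * 8) + 12
      e₂ = solve-∀
      e₃ : ∀ s → 3 * (s * (s + 4)) + 12 ≡ 3 * (s * s) + (12 * s + 12)
      e₃ = solve-∀
    12s+12<44s : 12 * s + 12 < 44 * s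
    12s+12<44s = subst (12 * s + 12 <_) (e s) (+-monoʳ-< (12 * s) (<-≤-trans (m≤m+n 13 31) (≤-trans 44≤s (m≤n*m s 32))))
      where
      e : ∀ s → 12 * s + 32 * s ≡ 44 * s
      e = solve-∀

  -- Erdős's proof of Bertrand's postulate; the exceptional primes cost at most a factor (2m + 1)³.
  primes-large : ∀ m → 968 ≤ m → ∀ x₁ x₂ x₃ →
    ¬ (∀ {p} → Prime p → m < p → p ≤ suc (m + m) → p ≡ x₁ ⊎ p ≡ x₂ ⊎ p ≡ x₃)
  primes-large m 968≤m x₁ x₂ x₃ exc = small-square s d h 44≤s
     (subst (λ z → s * s ≤ suc (z + z)) m≡ s²≤L)
     (subst (λ z → 3 * h ≤ suc (z + z)) m≡ 3h≤L) (≮⇒≥ (λ lt → <⇒≱ (^-monoʳ-< 4 (s≤s (s≤s z≤n)) lt) 4^≤))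
    where
    L = suc (m + m)
    N = mid m
    √ = √-floor L
    s = proj₁ √
    s²≤L = proj₁ (proj₂ √)
    L<S² = proj₂ (proj₂ √)
    h = L / 3
    d = m ∸ h
    1937≤L : 1937 ≤ L
    1937≤L = s≤s (+-mono-≤ 968≤m 968≤m)
    44≤s : 44 ≤ s
    44≤s with 44 ≤? s
    ... | yes q = q
    ... | no ¬q = ⊥-elim (<⇒≱ L<S² (≤-trans (*-mono-≤ (≰⇒> ¬q) (≰⇒> ¬q)) (≤-trans (n≤1+n 1936) 1937≤L)))
    L≡ : L ≡ L % 3 + h * 3
    L≡ = m≡m%n+[m/n]*n L 3
    3h≤L : 3 * h ≤ L
    3h≤L = subst₂ _≤_ (*-comm h 3) (sym L≡) (m≤n+m (h * 3) (L % 3))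
    L<3h+3 : L < 3 * suc h
    L<3h+3 = subst₂ _<_ (sym L≡) (*-comm (suc h) 3) (+-monoˡ-< (h * 3) (m%n<n L 3))
    h≤m : h ≤ m
    h≤m = *-cancelˡ-≤ 3 (≤-trans 3h≤L (subst (L ≤_) (e m) (+-monoˡ-≤ (m + m) (≤-trans (m≤m+n 1 967) 968≤m))))
      where e : ∀ m → m + (m + m) ≡ 3 * m
            e = solve-∀
    m≡ : m ≡ d + h
    m≡ = sym (m∸n+n≡m h≤m)
    e : ℕ → ℕ → ℕ
    e x i = when (i ≟ x) L
    e≥1 : ∀ x i → 1 ≤ e x i
    e≥1 x i = when≥1 (i ≟ x) (s≤s z≤n)
    -- The weights bound the power of p in `N`. It is always at most `L`, which serves up to s, the
    -- integer part of √L. Beyond s the exponent is at most 1, so p itself serves up to h, a third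
    -- of `L`. From there to m + 1 no prime divides `N`, and a prime above m is one of the
    -- exceptions, with weight `L` again.
    w₁ w₂ w₃ w : ℕ → ℕ
    w₁ i = when (i ≤? s) L
    w₂ i = when (i ≤? h) (primePart i)
    w₃ i = e x₁ i * (e x₂ i * e x₃ i)
    w i = w₁ i * (w₂ i * w₃ i)
    w₁≥1 : ∀ i → 1 ≤ w₁ i
    w₁≥1 i = when≥1 (i ≤? s) (s≤s z≤n)
    w₂≥1 : ∀ i → 1 ≤ w₂ i
    w₂≥1 i = when≥1 (i ≤? h) (primePart≥1 i)
    w₃≥1 : ∀ i → 1 ≤ w₃ i
    w₃≥1 i = *-mono-≤ (e≥1 x₁ i) (*-mono-≤ (e≥1 x₂ i) (e≥1 x₃ i))
    ≤*ʳ : ∀ {a b c} → a ≤ b → 1 ≤ c → a ≤ b * c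
    ≤*ʳ {a} {b} {c} a≤b 1≤c = ≤-trans a≤b (m≤m*n b c {{>-nonZero 1≤c}})
    ≤*ˡ : ∀ {a b c} → a ≤ b → 1 ≤ c → a ≤ c * b
    ≤*ˡ {a} {b} {c} a≤b 1≤c = ≤-trans a≤b (m≤n*m b c {{>-nonZero 1≤c}})
    m≤L : m ≤ L
    m≤L = m≤n⇒m≤1+n (m≤m+n m m)
    ≤w : ∀ {p} → Prime p → ∀ f → p ^ f ∣ N → p ^ f ≤ w p
    ≤w {p} pp zero _ = *-mono-≤ (w₁≥1 p) (*-mono-≤ (w₂≥1 p) (w₃≥1 p))
    ≤w {p} pp (suc f) p∣ with p ≤? s
    ... | yes p≤s = ≤*ʳ (≤-trans p^≤L (≤-refl {L})) (*-mono-≤ (w₂≥1 p) (w₃≥1 p))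
      where p^≤L = p^e∣binom⇒p^e≤n pp f L m m≤L p∣
    ... | no p≰s = subst (_≤ 1 * (w₂ p * w₃ p)) (sym p^≡p) (≤*ˡ {c = 1} p≤ (s≤s z≤n))
      where
      p^≤L = p^e∣binom⇒p^e≤n pp f L m m≤L p∣
      s<p : s < p
      s<p = ≰⇒> p≰s
      exponent-1 : ∀ g → p ^ suc g ≤ L → p ^ suc g ≡ p
      exponent-1 zero _ = *-identityʳ p
      exponent-1 (suc g) q = ⊥-elim (<⇒≱ L<S² (≤-trans (*-mono-≤ s<p s<p) (≤-trans
        (subst (p * p ≤_) (*-assoc p p (p ^ g)) (m≤m*n (p * p) (p ^ g) {{>-nonZero (^-pos pp g)}})) q)))
      p^≡p : p ^ suc f ≡ p
      p^≡p = exponent-1 f p^≤L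
      p∣N : p ∣ N
      p∣N = ∣-trans (m∣m*n (p ^ f)) p∣
      p≤L : p ≤ L
      p≤L = subst (_≤ L) p^≡p p^≤L
      p≤ : p ≤ w₂ p * w₃ p
      p≤ with p ≤? h
      ... | yes _ = ≤*ʳ (≤-reflexive (sym (primePart-prime pp))) (w₃≥1 p)
      ... | no p≰h = ≤*ˡ {c = 1} (p≤w₃ (exc pp m<p p≤L)) (s≤s z≤n)
        where
        3≤p : 3 ≤ p
        3≤p = ≤-trans (m≤m+n 3 41) (≤-trans 44≤s (<⇒≤ s<p))
        m<p : m < p
        m<p with p ≤? suc m
        ... | yes q = ⊥-elim (∤mid pp 3≤p m (<-≤-trans L<3h+3 (*-monoʳ-≤ 3 (≰⇒> p≰h))) q p∣N)
        ... | no ¬q = <-trans (n<1+n m) (≰⇒> ¬q)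
        p≤e : ∀ {x} → p ≡ x → p ≤ e x p
        p≤e {x} eq = ≤-trans p≤L (≤-reflexive (sym (when-yes (p ≟ x) L eq)))
        p≤w₃ : p ≡ x₁ ⊎ p ≡ x₂ ⊎ p ≡ x₃ → p ≤ w₃ p
        p≤w₃ (inj₁ q) = ≤*ʳ (p≤e q) (*-mono-≤ (e≥1 x₂ p) (e≥1 x₃ p))
        p≤w₃ (inj₂ (inj₁ q)) = ≤*ˡ (≤*ʳ (p≤e q) (e≥1 x₃ p)) (e≥1 x₁ p)
        p≤w₃ (inj₂ (inj₂ q)) = ≤*ˡ (≤*ˡ (p≤e q) (e≥1 x₂ p)) (e≥1 x₁ p)
    N≤Πw : N ≤ Πprod w L
    N≤Πw = ≤Πprod w (λ i → *-mono-≤ (w₁≥1 i) (*-mono-≤ (w₂≥1 i) (w₃≥1 i))) L N (binom-pos m≤L)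
      (λ {p} pp p∣N → subst (_≤ L) (*-identityʳ p) (p^e∣binom⇒p^e≤n pp 0 L m m≤L (subst (_∣ N) (sym (*-identityʳ p)) p∣N))) ≤w
    open ≤-Reasoning
    Πw≤ : Πprod w L ≤ L ^ s * (4 ^ h * (L * (L * L)))
    Πw≤ = begin
      Πprod w L ≡⟨ Πprod-* w₁ _ L ⟩
      Πprod w₁ L * Πprod (λ i → w₂ i * w₃ i) L ≡⟨ cong (Πprod w₁ L *_) (Πprod-* w₂ w₃ L) ⟩
      Πprod w₁ L * (Πprod w₂ L * Πprod w₃ L) ≡⟨ cong (λ z → Πprod w₁ L * (Πprod w₂ L * z))
          (trans (Πprod-* (e x₁) _ L) (cong (Πprod (e x₁) L *_) (Πprod-* (e x₂) (e x₃) L))) ⟩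
      Πprod w₁ L * (Πprod w₂ L * (Πprod (e x₁) L * (Πprod (e x₂) L * Πprod (e x₃) L)))
        ≤⟨ *-mono-≤ (≤-trans (Πprod-upTo (λ _ → L) (λ _ → s≤s z≤n) s L) (≤-reflexive (Πprod-const L s)))
            (*-mono-≤ (≤-trans (Πprod-upTo primePart primePart≥1 h L) (primorial≤4^ h))
              (*-mono-≤ (Πprod-at L x₁ (s≤s z≤n) L) (*-mono-≤ (Πprod-at L x₂ (s≤s z≤n) L) (Πprod-at L x₃ (s≤s z≤n) L)))) ⟩
      L ^ s * (4 ^ h * (L * (L * L))) ∎
    -- The primorial of h is paid for by 4^h out of 4^m. Of the four extra factors `L`, three are
    -- the exceptions and one bounds the m + 1 in `4^≤mid`.
    4^d≤ : 4 ^ d ≤ L ^ (4 + s)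
    4^d≤ = *-cancelʳ-≤ _ _ (4 ^ h) {{m^n≢0 4 h}} (begin
      4 ^ d * 4 ^ h ≡⟨ ^-distribˡ-+-* 4 d h ⟨
      4 ^ (d + h) ≡⟨ cong (4 ^_) m≡ ⟨
      4 ^ m ≤⟨ 4^≤mid m ⟩
      suc m * N ≤⟨ *-mono-≤ (s≤s (m≤m+n m m)) (≤-trans N≤Πw Πw≤) ⟩
      L * (L ^ s * (4 ^ h * (L * (L * L)))) ≡⟨ r L (L ^ s) (4 ^ h) ⟩
      L ^ (4 + s) * 4 ^ h ∎)
      where r : ∀ l a b → l * (a * (b * (l * (l * l)))) ≡ l * (l * (l * (l * a))) * b
            r = solve-∀
    -- Eighth powers replace logarithms: L < (s + 1)² and (s + 1)^8 ≤ 2^s bring both sides to base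
    -- 4. As d is about s²/6, the exponent has to exceed 6.
    4^≤ : 4 ^ (d * 8) ≤ 4 ^ (s * (s + 4))
    4^≤ = begin
      4 ^ (d * 8) ≡⟨ ^-*-assoc 4 d 8 ⟨
      (4 ^ d) ^ 8 ≤⟨ ^-monoˡ-≤ 8 4^d≤ ⟩
      (L ^ k) ^ 8 ≤⟨ ^-monoˡ-≤ 8 (^-monoˡ-≤ k (<⇒≤ L<S²)) ⟩
      ((suc s * suc s) ^ k) ^ 8 ≡⟨ cong (_^ 8) (^-square (suc s) k) ⟩
      (suc s ^ (k + k)) ^ 8 ≡⟨ ^-swap (suc s) (k + k) 8 ⟩
      (suc s ^ 8) ^ (k + k) ≤⟨ ^-monoˡ-≤ (k + k) S^8≤ ⟩
      (2 ^ s) ^ (k + k) ≡⟨ ^-square (2 ^ s) k ⟨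
      (2 ^ s * 2 ^ s) ^ k ≡⟨ cong (_^ k) (^-distribʳ-* 2 2 s) ⟨
      (4 ^ s) ^ k ≡⟨ ^-*-assoc 4 s k ⟩
      4 ^ (s * k) ≡⟨ cong (λ z → 4 ^ (s * z)) (+-comm 4 s) ⟩
      4 ^ (s * (s + 4)) ∎
      where
      k = 4 + s
      ^-swap : ∀ a b c → (a ^ b) ^ c ≡ (a ^ c) ^ b
      ^-swap a b c = trans (^-*-assoc a b c) (trans (cong (a ^_) (*-comm b c)) (sym (^-*-assoc a c b)))
      S^8≤ : suc s ^ 8 ≤ 2 ^ s
      S^8≤ = suc^8≤2^ (≤⇒≤′ 44≤s)

  -- Ranges of m settled by four explicit primes

  ThreeExceptions : ℕ → ℕ → ℕ → ℕ → Set
  ThreeExceptions m x₁ x₂ x₃ = ∀ {p} → Prime p → m < p → p ≤ suc (m + m) → p ≡ x₁ ⊎ p ≡ x₂ ⊎ p ≡ x₃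

  -- Primes in (hi, 2 lo + 1] lie in (m, 2m + 1] for every m from lo to hi, so one decidable check
  -- settles a whole range of m.
  PrimeCluster : ℕ → ℕ → ℕ → ℕ → ℕ → ℕ → Set
  PrimeCluster lo hi a b c d =
    Prime a × Prime b × Prime c × Prime d × a < b × b < c × c < d × hi < a × d ≤ suc (lo + lo)

  primeCluster? : ∀ lo hi a b c d → Dec (PrimeCluster lo hi a b c d)
  primeCluster? lo hi a b c d = prime? a ×-dec prime? b ×-dec prime? c ×-dec prime? d ×-dec
    a <? b ×-dec b <? c ×-dec c <? d ×-dec hi <? a ×-dec d ≤? suc (lo + lo)

  cluster-excludes : ∀ lo hi a b c d → True (primeCluster? lo hi a b c d) →
    ∀ m → lo ≤ m → m ≤ hi → ∀ x₁ x₂ x₃ → ¬ ThreeExceptions m x₁ x₂ x₃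
  cluster-excludes lo hi a b c d t m lo≤m m≤hi x₁ x₂ x₃ exc
    with toWitness {a? = primeCluster? lo hi a b c d} t
  ... | pa , pb , pc , pd , a<b , b<c , c<d , hi<a , d≤ = distinct (pigeonhole (n<1+n 3) class)
    where
    m<a : m < a
    m<a = ≤-<-trans m≤hi hi<a
    d≤L : d ≤ suc (m + m)
    d≤L = ≤-trans d≤ (s≤s (+-mono-≤ lo≤m lo≤m))
    cluster : Fin 4 → ℕ
    cluster zero = a
    cluster (suc zero) = b
    cluster (suc (suc zero)) = c
    cluster (suc (suc (suc zero))) = d
    exceptional : Fin 3 → ℕ
    exceptional zero = x₁
    exceptional (suc zero) = x₂
    exceptional (suc (suc zero)) = x₃
    index : ∀ {p} → p ≡ x₁ ⊎ p ≡ x₂ ⊎ p ≡ x₃ → ∃ λ i → exceptional i ≡ p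
    index (inj₁ eq) = zero , sym eq
    index (inj₂ (inj₁ eq)) = suc zero , sym eq
    index (inj₂ (inj₂ eq)) = suc (suc zero) , sym eq
    located : ∀ i → ∃ λ j → exceptional j ≡ cluster i
    located zero = index (exc pa m<a (≤-trans (<⇒≤ (<-trans a<b (<-trans b<c c<d))) d≤L))
    located (suc zero) = index (exc pb (<-trans m<a a<b) (≤-trans (<⇒≤ (<-trans b<c c<d)) d≤L))
    located (suc (suc zero)) = index (exc pc (<-trans m<a (<-trans a<b b<c)) (≤-trans (<⇒≤ c<d) d≤L))
    located (suc (suc (suc zero))) = index (exc pd (<-trans m<a (<-trans a<b (<-trans b<c c<d))) d≤L)
    class : Fin 4 → Fin 3
    class i = proj₁ (located i)
    cluster-mono : ∀ i j → i Fin.< j → cluster i < cluster j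
    cluster-mono zero (suc zero) _ = a<b
    cluster-mono zero (suc (suc zero)) _ = <-trans a<b b<c
    cluster-mono zero (suc (suc (suc zero))) _ = <-trans a<b (<-trans b<c c<d)
    cluster-mono (suc zero) (suc (suc zero)) _ = b<c
    cluster-mono (suc zero) (suc (suc (suc zero))) _ = <-trans b<c c<d
    cluster-mono (suc (suc zero)) (suc (suc (suc zero))) _ = c<d
    cluster-mono (suc zero) (suc zero) (s≤s ())
    cluster-mono (suc (suc zero)) (suc zero) (s≤s ())
    cluster-mono (suc (suc (suc zero))) (suc zero) (s≤s ())
    cluster-mono (suc (suc zero)) (suc (suc zero)) (s≤s (s≤s ()))
    cluster-mono (suc (suc (suc zero))) (suc (suc zero)) (s≤s (s≤s ()))
    cluster-mono (suc (suc (suc zero))) (suc (suc (suc zero))) (s≤s (s≤s (s≤s ())))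
    distinct : (∃₂ λ i j → i Fin.< j × class i ≡ class j) → ⊥
    distinct (i , j , i<j , eq) = <-irrefl (trans (sym (proj₂ (located i))) (trans (cong exceptional eq) (proj₂ (located j)))) (cluster-mono i j i<j)

  -- Each quadruple is used up to just below its smallest prime, and the last range, ending at 1360,
  -- passes the threshold 968 of `primes-large`. The start is 14 because (13, 27] contains only 17,
  -- 19 and 23.
  ¬ThreeExceptions : ∀ m → 14 ≤ m → ∀ x₁ x₂ x₃ → ¬ ThreeExceptions m x₁ x₂ x₃
  ¬ThreeExceptions m l with m ≤? 16
  ... | yes u = cluster-excludes 14 16 17 19 23 29 tt m l u
  ... | no ¬u with ≰⇒> ¬u | m ≤? 18
  ...   | l | yes u = cluster-excludes 17 18 19 23 29 31 tt m l u
  ...   | _ | no ¬u with ≰⇒> ¬u | m ≤? 22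
  ...     | l | yes u = cluster-excludes 19 22 23 29 31 37 tt m l u
  ...     | _ | no ¬u with ≰⇒> ¬u | m ≤? 36
  ...       | l | yes u = cluster-excludes 23 36 37 41 43 47 tt m l u
  ...       | _ | no ¬u with ≰⇒> ¬u | m ≤? 60
  ...         | l | yes u = cluster-excludes 37 60 61 67 71 73 tt m l u
  ...         | _ | no ¬u with ≰⇒> ¬u | m ≤? 102
  ...           | l | yes u = cluster-excludes 61 102 103 107 109 113 tt m l u
  ...           | _ | no ¬u with ≰⇒> ¬u | m ≤? 190
  ...             | l | yes u = cluster-excludes 103 190 191 193 197 199 tt m l u
  ...             | _ | no ¬u with ≰⇒> ¬u | m ≤? 358
  ...               | l | yes u = cluster-excludes 191 358 359 367 373 379 tt m l u
  ...               | _ | no ¬u with ≰⇒> ¬u | m ≤? 690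
  ...                 | l | yes u = cluster-excludes 359 690 691 701 709 719 tt m l u
  ...                 | _ | no ¬u with ≰⇒> ¬u | m ≤? 1360
  ...                   | l | yes u = cluster-excludes 691 1360 1361 1367 1373 1381 tt m l u
  ...                   | _ | no ¬u = λ x₁ x₂ x₃ exc → primes-large m (≤-trans (m≤m+n 968 393) (≰⇒> ¬u)) x₁ x₂ x₃ exc

module IntegerPolynomials where

  open BinomialPrimes
  open import Data.Nat as ℕ using (ℕ; zero; suc; z≤n; s≤s)
  import Data.Nat.Properties as ℕ
  import Data.Nat.Divisibility as ℕ∣
  open import Data.Nat.Induction using (<-rec)
  open import Data.Nat.Primality using (Prime; euclidsLemma)
  open import Data.Integer using (ℤ; +_; 0ℤ; 1ℤ; _+_; _*_; -_; _-_; NonZero; _≟_) renaming (∣_∣ to abs)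
  open import Data.Integer.Properties
  open import Data.Integer.Divisibility.Signed
  open import Data.Integer.Tactic.RingSolver using (solve-∀)
  open import Data.List using (List; []; _∷_; map)
  open import Data.Maybe using (Maybe; just; nothing)
  open import Data.Product hiding (map)
  open import Data.Sum hiding (map)
  open import Data.Empty
  open import Function using (_∘_)
  open import Level using (0ℓ)
  open import Algebra.Bundles using (CommutativeRing)
  open import Algebra.Solver.Ring.AlmostCommutativeRing using (fromCommutativeRing; _-Raw-AlmostCommutative⟶_)
  open import Relation.Nullary
  open import Relation.Binary.Definitions using (tri<; tri≈; tri>)
  open import Relation.Binary.PropositionalEquality
  open import Relation.Binary.Structures using (IsEquivalence)

  -- The ring of formal power series over the integers

  Series : Set
  Series = ℕ → ℤ

  infix 4 _≐_
  -- A record instead of a bare function type, so that unification recovers both series from the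
  -- type of an equation.
  record _≐_ (a b : Series) : Set where
    constructor pointwise
    field at : ∀ n → a n ≡ b n
  open _≐_ public

  tail : Series → Series
  tail a n = a (suc n)

  infixl 6 _⊕_
  infixl 7 _⊗_
  infixl 7 _·_

  _⊕_ : Series → Series → Series
  (a ⊕ b) n = a n + b n

  _⊗_ : Series → Series → Series
  (a ⊗ b) zero    = a 0 * b 0
  (a ⊗ b) (suc n) = a 0 * b (suc n) + (tail a ⊗ b) n

  _·_ : ℤ → Series → Series
  (x · a) n = x * a n

  ⊖_ : Series → Series
  (⊖ a) n = - a n

  const : ℤ → Series
  const x zero    = x
  const x (suc n) = 0ℤ

  ⊗-cong : ∀ {a a′ b b′} → (∀ n → a n ≡ a′ n) → (∀ n → b n ≡ b′ n) → ∀ n → (a ⊗ b) n ≡ (a′ ⊗ b′) n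
  ⊗-cong p q zero = cong₂ _*_ (p 0) (q 0)
  ⊗-cong p q (suc n) = cong₂ _+_ (cong₂ _*_ (p 0) (q (suc n))) (⊗-cong (λ i → p (suc i)) q n)

  ⊗-distribʳ : ∀ a b c n → ((a ⊕ b) ⊗ c) n ≡ (a ⊗ c) n + (b ⊗ c) n
  ⊗-distribʳ a b c zero = *-distribʳ-+ (c 0) (a 0) (b 0)
  ⊗-distribʳ a b c (suc n) = trans (cong (λ t → (a 0 + b 0) * c (suc n) + t) (⊗-distribʳ (tail a) (tail b) c n)) (s (a 0) (b 0) (c (suc n)) _ _)
    where s : ∀ a b c x y → (a + b) * c + (x + y) ≡ (a * c + x) + (b * c + y)
          s = solve-∀

  ·-⊗ : ∀ x a b n → ((x · a) ⊗ b) n ≡ x * (a ⊗ b) n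
  ·-⊗ x a b zero = *-assoc x (a 0) (b 0)
  ·-⊗ x a b (suc n) = trans (cong (λ t → x * a 0 * b (suc n) + t) (·-⊗ x (tail a) b n)) (s x (a 0) (b (suc n)) _)
    where s : ∀ x a b t → x * a * b + x * t ≡ x * (a * b + t)
          s = solve-∀

  ⊗-sucʳ : ∀ a b n → (a ⊗ b) (suc n) ≡ (a ⊗ tail b) n + a (suc n) * b 0
  ⊗-sucʳ a b zero = refl
  ⊗-sucʳ a b (suc n) = trans (cong (λ t → a 0 * b (suc (suc n)) + t) (⊗-sucʳ (tail a) b n)) (sym (+-assoc (a 0 * b (suc (suc n))) _ _))

  ⊗-comm : ∀ a b n → (a ⊗ b) n ≡ (b ⊗ a) n
  ⊗-comm a b zero = *-comm (a 0) (b 0)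
  ⊗-comm a b (suc n) = trans (cong₂ _+_ (*-comm (a 0) (b (suc n))) (⊗-comm (tail a) b n))
    (trans (+-comm (b (suc n) * a 0) _) (sym (⊗-sucʳ b a n)))

  ⊗-assoc : ∀ a b c n → ((a ⊗ b) ⊗ c) n ≡ (a ⊗ (b ⊗ c)) n
  ⊗-assoc a b c zero = *-assoc (a 0) (b 0) (c 0)
  ⊗-assoc a b c (suc n) = begin
    a 0 * b 0 * c (suc n) + (((a 0 · tail b) ⊕ (tail a ⊗ b)) ⊗ c) n
      ≡⟨ cong (λ t → a 0 * b 0 * c (suc n) + t) (⊗-distribʳ (a 0 · tail b) (tail a ⊗ b) c n) ⟩
    a 0 * b 0 * c (suc n) + (((a 0 · tail b) ⊗ c) n + ((tail a ⊗ b) ⊗ c) n)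
      ≡⟨ cong₂ (λ x y → a 0 * b 0 * c (suc n) + (x + y)) (·-⊗ (a 0) (tail b) c n) (⊗-assoc (tail a) b c n) ⟩
    a 0 * b 0 * c (suc n) + (a 0 * (tail b ⊗ c) n + (tail a ⊗ (b ⊗ c)) n)
      ≡⟨ s (a 0) (b 0) (c (suc n)) _ _ ⟩
    a 0 * (b 0 * c (suc n) + (tail b ⊗ c) n) + (tail a ⊗ (b ⊗ c)) n ∎
    where open ≡-Reasoning
          s : ∀ a b c x y → a * b * c + (a * x + y) ≡ a * (b * c + x) + y
          s = solve-∀

  0⊗ : ∀ b n → ((λ _ → 0ℤ) ⊗ b) n ≡ 0ℤ
  0⊗ b zero = *-zeroˡ (b 0)
  0⊗ b (suc n) = cong₂ _+_ (*-zeroˡ (b (suc n))) (0⊗ b n)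

  const-⊗ : ∀ x b n → (const x ⊗ b) n ≡ x * b n
  const-⊗ x b zero = refl
  const-⊗ x b (suc n) = trans (cong (λ t → x * b (suc n) + t) (0⊗ b n)) (+-identityʳ _)

  ≐-isEquivalence : IsEquivalence _≐_
  ≐-isEquivalence = record
    { refl = pointwise λ _ → refl
    ; sym = λ p → pointwise λ n → sym (at p n)
    ; trans = λ p q → pointwise λ n → trans (at p n) (at q n)
    }

  seriesRing : CommutativeRing 0ℓ 0ℓ
  seriesRing = record
    { Carrier = Series ; _≈_ = _≐_ ; _+_ = _⊕_ ; _*_ = _⊗_ ; -_ = ⊖_ ; 0# = const 0ℤ ; 1# = const 1ℤ
    ; isCommutativeRing = record
      { isRing = record
        { +-isAbelianGroup = record
          { isGroup = record
            { isMonoid = record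
              { isSemigroup = record
                { isMagma = record
                  { isEquivalence = ≐-isEquivalence
                  ; ∙-cong = λ p q → pointwise λ n → cong₂ _+_ (at p n) (at q n) }
                ; assoc = λ a b c → pointwise λ n → +-assoc (a n) (b n) (c n) }
              ; identity = (λ a → pointwise λ n → trans (cong (_+ a n) (const0 n)) (+-identityˡ (a n)))
                         , (λ a → pointwise λ n → trans (cong (λ t → a n + t) (const0 n)) (+-identityʳ (a n))) }
            ; inverse = (λ a → pointwise λ n → trans (+-inverseˡ (a n)) (sym (const0 n)))
                      , (λ a → pointwise λ n → trans (+-inverseʳ (a n)) (sym (const0 n)))
            ; ⁻¹-cong = λ p → pointwise λ n → cong -_ (at p n) }
          ; comm = λ a b → pointwise λ n → +-comm (a n) (b n) }
        ; *-cong = λ p q → pointwise (⊗-cong (at p) (at q))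
        ; *-assoc = λ a b c → pointwise (⊗-assoc a b c)
        ; *-identity = (λ a → pointwise λ n → trans (const-⊗ 1ℤ a n) (*-identityˡ (a n)))
                     , (λ a → pointwise λ n → trans (⊗-comm a (const 1ℤ) n) (trans (const-⊗ 1ℤ a n) (*-identityˡ (a n))))
        ; distrib = (λ a b c → pointwise λ n → trans (⊗-comm a (b ⊕ c) n)
                       (trans (⊗-distribʳ b c a n) (cong₂ _+_ (⊗-comm b a n) (⊗-comm c a n))))
                  , (λ a b c → pointwise (⊗-distribʳ b c a)) }
      ; *-comm = λ a b → pointwise (⊗-comm a b) } }
    where
    const0 : ∀ n → const 0ℤ n ≡ 0ℤ
    const0 zero = refl
    const0 (suc n) = refl

  open CommutativeRing seriesRing public using () renaming (refl to ≐-refl; sym to ≐-sym; trans to ≐-trans; +-cong to ⊕-cong≐; *-cong to ⊗-cong≐; -‿cong to ⊖-cong≐)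

  -- The ring solver has to compare coefficients, and equality of series is undecidable; integers
  -- embedded as constants serve instead.
  const-hom : CommutativeRing.rawRing +-*-commutativeRing -Raw-AlmostCommutative⟶ fromCommutativeRing seriesRing
  const-hom = record
    { ⟦_⟧ = const
    ; +-homo = λ x y → pointwise λ { zero → refl ; (suc n) → refl }
    ; *-homo = λ x y → pointwise λ { zero → refl ; (suc n) → sym (trans (const-⊗ x (const y) (suc n)) (*-zeroʳ x)) }
    ; -‿homo = λ x → pointwise λ { zero → refl ; (suc n) → refl }
    ; 0-homo = ≐-refl
    ; 1-homo = ≐-refl
    }

  const-≟ : (x y : ℤ) → Maybe (const x ≐ const y)
  const-≟ x y with x ≟ y
  ... | yes refl = just ≐-refl
  ... | no _ = nothing

  module SeriesSolver where
    open import Algebra.Solver.Ring (CommutativeRing.rawRing +-*-commutativeRing) (fromCommutativeRing seriesRing) const-hom const-≟ public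

  -- The old variable x = y - 1, as a series in y = x + 1.
  Y : Series
  Y zero = - 1ℤ
  Y (suc n) = const 1ℤ n

  -- The norm of u + v z, where z² = x.
  norm : Series → Series → Series
  norm u v = u ⊗ u ⊕ ⊖ (Y ⊗ (v ⊗ v))

  open SeriesSolver using (solve; _:=_; _:+_; _:*_; :-_; con)

  -- The arguments on the left are the components of (u + v z)(u′ + v′ z) under z² = `Y`.
  norm-mult : ∀ u v u′ v′ → norm (u ⊗ u′ ⊕ Y ⊗ (v ⊗ v′)) (u ⊗ v′ ⊕ v ⊗ u′) ≐ norm u v ⊗ norm u′ v′
  norm-mult u v u′ v′ = solve 5 (λ y u v u′ v′ →
    let n = λ u v → u :* u :+ :- (y :* (v :* v)) in
    n (u :* u′ :+ y :* (v :* v′)) (u :* v′ :+ v :* u′) := n u v :* n u′ v′) ≐-refl Y u v u′ v′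

  -- Divisibility of the coefficients of a product

  ∣0 : ∀ d → d ∣ 0ℤ
  ∣0 d = divides 0ℤ (sym (*-zeroˡ d))

  ≡0⇒∣ : ∀ {d x} → x ≡ 0ℤ → d ∣ x
  ≡0⇒∣ {d} refl = ∣0 d

  ∣-cong : ∀ {d x y} → x ≡ y → d ∣ x → d ∣ y
  ∣-cong refl p = p

  ∣-∣⇒∣ : ∀ {d x y} → d ∣ x - y → d ∣ y → d ∣ x
  ∣-∣⇒∣ {d} {x} {y} p q = ∣-cong (s x y) (∣m∣n⇒∣m+n p q)
    where s : ∀ x y → x - y + y ≡ x
          s = solve-∀

  ∣-∣⇒∣′ : ∀ {d x y} → d ∣ x - y → d ∣ x → d ∣ y
  ∣-∣⇒∣′ {d} {x} {y} p q = ∣-cong (s x y) (∣m∣n⇒∣m-n q p)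
    where s : ∀ x y → x - (x - y) ≡ y
          s = solve-∀

  ∣-*-mono : ∀ {d e x y} → d ∣ x → e ∣ y → d * e ∣ x * y
  ∣-*-mono {d} {e} (divides a refl) (divides b refl) = divides (a * b) (s a d b e)
    where s : ∀ a d b e → a * d * (b * e) ≡ a * b * (d * e)
          s = solve-∀

  ⊗-∣ : ∀ {d} a b n → (∀ i j → i ℕ.+ j ≡ n → d ∣ a i * b j) → d ∣ (a ⊗ b) n
  ⊗-∣ a b zero h = h 0 0 refl
  ⊗-∣ a b (suc n) h = ∣m∣n⇒∣m+n (h 0 (suc n) refl) (⊗-∣ (tail a) b n λ i j eq → h (suc i) j (cong suc eq))

  ⊗-∣-term : ∀ {d} a b r s → (∀ i j → i ℕ.+ j ≡ r ℕ.+ s → i ≢ r → d ∣ a i * b j) → d ∣ (a ⊗ b) (r ℕ.+ s) - a r * b s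
  ⊗-∣-term a b zero zero h = ≡0⇒∣ (+-inverseʳ (a 0 * b 0))
  ⊗-∣-term a b zero (suc s) h = ∣-cong (e (a 0 * b (suc s)) _) (⊗-∣ (tail a) b s λ i j eq → h (suc i) j (cong suc eq) λ ())
    where e : ∀ x y → y ≡ x + y - x
          e = solve-∀
  ⊗-∣-term a b (suc r) s h = ∣-cong (e (a 0 * b (suc (r ℕ.+ s))) _ _)
    (∣m∣n⇒∣m+n (h 0 _ refl λ ()) (⊗-∣-term (tail a) b r s λ i j eq i≢r → h (suc i) j (cong suc eq) (i≢r ∘ ℕ.suc-injective)))
    where e : ∀ x y z → x + (y - z) ≡ x + y - z
          e = solve-∀

  +≡+⇒<⊎< : ∀ {i j r s} → i ℕ.+ j ≡ r ℕ.+ s → i ≢ r → (i ℕ.< r × s ℕ.< j) ⊎ (r ℕ.< i × j ℕ.< s)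
  +≡+⇒<⊎< {i} {j} {r} {s} eq i≢r with ℕ.<-cmp i r
  ... | tri≈ _ i≡r _ = ⊥-elim (i≢r i≡r)
  ... | tri< i<r _ _ = inj₁ (i<r , ℕ.≰⇒> λ j≤s → ℕ.<⇒≢ (ℕ.+-mono-<-≤ i<r j≤s) eq)
  ... | tri> _ _ r<i = inj₂ (r<i , ℕ.≰⇒> λ s≤j → ℕ.<⇒≢ (ℕ.+-mono-<-≤ r<i s≤j) (sym eq))

  -- Any other pair of indices with sum r + s has one index below r or s respectively, so only a
  -- single term survives modulo d.
  ⊗-low : ∀ {d} a b r s → (∀ i → i ℕ.< r → d ∣ a i) → (∀ i → i ℕ.< s → d ∣ b i) → d ∣ (a ⊗ b) (r ℕ.+ s) - a r * b s
  ⊗-low a b r s ha hb = ⊗-∣-term a b r s λ i j eq i≢r → [ (λ p → ∣m⇒∣m*n (b j) (ha i (proj₁ p))) , (λ p → ∣n⇒∣m*n (a i) (hb j (proj₂ p))) ]′ (+≡+⇒<⊎< eq i≢r)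

  -- For d = 0 divisibility means vanishing, and the lemma yields exact leading coefficients.
  ⊗-high : ∀ {d} a b r s → (∀ i → r ℕ.< i → d ∣ a i) → (∀ i → s ℕ.< i → d ∣ b i) → d ∣ (a ⊗ b) (r ℕ.+ s) - a r * b s
  ⊗-high a b r s ha hb = ⊗-∣-term a b r s λ i j eq i≢r → [ (λ p → ∣n⇒∣m*n (a i) (hb j (proj₂ p))) , (λ p → ∣m⇒∣m*n (b j) (ha i (proj₁ p))) ]′ (+≡+⇒<⊎< eq i≢r)

  -- Divisibility begins at r and s themselves, so the last term that may survive is at (r - 1) + (s
  -- - 1); hence the bound with suc n.
  ⊗-beyond : ∀ {d} a b r s → (∀ i → r ℕ.≤ i → d ∣ a i) → (∀ i → s ℕ.≤ i → d ∣ b i) → ∀ n → r ℕ.+ s ℕ.≤ suc n → d ∣ (a ⊗ b) n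
  ⊗-beyond {d} a b r s ha hb n le = ⊗-∣ a b n term
    where
    term : ∀ i j → i ℕ.+ j ≡ n → d ∣ a i * b j
    term i j eq with r ℕ.≤? i | s ℕ.≤? j
    ... | yes q | _ = ∣m⇒∣m*n (b j) (ha i q)
    ... | no _ | yes q = ∣n⇒∣m*n (a i) (hb j q)
    ... | no p | no q = ⊥-elim (ℕ.1+n≰n (subst (ℕ._≤ n) (trans (ℕ.+-suc i j) (cong suc eq))
                                 (ℕ.≤-pred (ℕ.≤-trans (ℕ.+-mono-≤ (ℕ.≰⇒> p) (ℕ.≰⇒> q)) le))))

  euclid : ∀ {p} → Prime p → ∀ x y → + p ∣ x * y → + p ∣ x ⊎ + p ∣ y
  euclid {p} pp x y d with euclidsLemma (abs x) (abs y) pp (subst (λ t → p ℕ∣.∣ t) (abs-* x y) (∣⇒∣ᵤ d))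
  ... | inj₁ q = inj₁ (∣ᵤ⇒∣ q)
  ... | inj₂ q = inj₂ (∣ᵤ⇒∣ q)

  module _ (d : ℤ) (a : Series) where

    lowest : ∀ k → (∀ i → i ℕ.≤ k → d ∣ a i) ⊎ ∃ λ s → s ℕ.≤ k × ¬ d ∣ a s × (∀ i → i ℕ.< s → d ∣ a i)
    lowest zero with d ∣? a 0
    ... | yes q = inj₁ λ { zero _ → q }
    ... | no ¬q = inj₂ (0 , z≤n , ¬q , λ _ ())
    lowest (suc k) with lowest k
    ... | inj₂ (s , s≤k , r) = inj₂ (s , ℕ.m≤n⇒m≤1+n s≤k , r)
    ... | inj₁ all with d ∣? a (suc k)
    ...   | no ¬q = inj₂ (suc k , ℕ.≤-refl , ¬q , λ i i<k → all i (ℕ.≤-pred i<k))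
    ...   | yes q = inj₁ λ i i≤ → [ (λ lt → all i (ℕ.≤-pred lt)) , (λ { refl → q }) ]′ (ℕ.m≤n⇒m<n∨m≡n i≤)

    highest : ∀ k → (∀ i → k ℕ.< i → d ∣ a i) → (∀ i → d ∣ a i) ⊎ ∃ λ s → s ℕ.≤ k × ¬ d ∣ a s × (∀ i → s ℕ.< i → d ∣ a i)
    highest k above with d ∣? a k
    ... | no ¬q = inj₂ (k , ℕ.≤-refl , ¬q , above)
    highest zero above | yes q = inj₁ λ { zero → q ; (suc i) → above (suc i) (s≤s z≤n) }
    highest (suc k) above | yes q with highest k (λ i k<i → [ above i , (λ { refl → q }) ]′ (ℕ.m≤n⇒m<n∨m≡n k<i))
    ... | inj₁ all = inj₁ all
    ... | inj₂ (s , s≤k , r) = inj₂ (s , ℕ.m≤n⇒m≤1+n s≤k , r)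

  +prime-nonZero : ∀ {p} → Prime p → NonZero (+ p)
  +prime-nonZero {suc p} pp = _
  +prime-nonZero {zero} pp with prime≥2 pp
  ... | ()

  p²∣*⇒p²∣ : ∀ {p} → Prime p → ∀ x y → ¬ (+ p) ∣ x → (+ p) * (+ p) ∣ x * y → (+ p) * (+ p) ∣ y
  p²∣*⇒p²∣ {p} pp x y p∤x d with euclid pp x y (∣-trans (∣m⇒∣m*n (+ p) ∣-refl) d)
  ... | inj₁ q = ⊥-elim (p∤x q)
  ... | inj₂ (divides z refl) with euclid pp x z (*-cancelʳ-∣ (+ p) {{+prime-nonZero pp}} (∣-cong (sym (*-assoc x z (+ p))) d))
  ...   | inj₁ q = ⊥-elim (p∤x q)
  ...   | inj₂ q = *-monoˡ-∣ (+ p) q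

  ∤-∣⇒∤ : ∀ {p} → Prime p → ∀ {x y z} → ¬ (+ p) ∣ y → ¬ (+ p) ∣ z → (+ p) ∣ x - y * z → ¬ (+ p) ∣ x
  ∤-∣⇒∤ pp {x} {y} {z} ¬y ¬z d q = [ ¬y , ¬z ]′ (euclid pp y z (∣-∣⇒∣′ d q))

  +-bounded : ∀ {s s′ t t′} → s ℕ.≤ s′ → t ℕ.≤ t′ → s ℕ.+ t ≡ s′ ℕ.+ t′ → s ≡ s′
  +-bounded {s} {s′} s≤ t≤ eq with ℕ.m≤n⇒m<n∨m≡n s≤
  ... | inj₂ e = e
  ... | inj₁ lt = ⊥-elim (ℕ.<⇒≢ (ℕ.+-mono-<-≤ lt t≤) eq)

  double-injective : ∀ {s j} → s ℕ.+ s ≡ j ℕ.+ j → s ≡ j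
  double-injective {s} {j} eq with ℕ.<-cmp s j
  ... | tri≈ _ e _ = e
  ... | tri< lt _ _ = ⊥-elim (ℕ.<⇒≢ (ℕ.+-mono-< lt lt) eq)
  ... | tri> _ _ gt = ⊥-elim (ℕ.<⇒≢ (ℕ.+-mono-< gt gt) (sym eq))

  -- An Eisenstein argument for squares

  module _ {p} (pp : Prime p) where
    private
      p̂ = + p

    -- Since s < t, every term of the coefficient at s except α s * β 0 has both factors divisible
    -- by p. So p² divides β 0, while p divides α 0 because 0 < s.
    ¬lopsided : ∀ α β s t → s ℕ.< t → 0 ℕ.< s → ¬ p̂ ∣ α s →
      (∀ i → i ℕ.< s → p̂ ∣ α i) → (∀ i → i ℕ.< t → p̂ ∣ β i) →
      p̂ * p̂ ∣ (α ⊗ β) s → p̂ * (p̂ * p̂) ∣ (α ⊗ β) 0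
    ¬lopsided α β s t s<t 0<s ¬αs lowα lowβ d = ∣-*-mono (lowα 0 0<s) (p²∣*⇒p²∣ pp (α s) (β 0) ¬αs αsβ0)
      where
      αsβ0 : p̂ * p̂ ∣ α s * β 0
      αsβ0 = ∣-∣⇒∣′ (⊗-∣-term α β s 0 λ i j eq i≢s →
        [ (λ q → ∣-*-mono (lowα i (proj₁ q)) (lowβ j (ℕ.≤-<-trans (ℕ.≤-trans (ℕ.m≤n+m j i) (ℕ.≤-reflexive (trans eq (ℕ.+-identityʳ s)))) s<t)))
        , (λ { (_ , ()) }) ]′ (+≡+⇒<⊎< {i} {j} {s} {0} eq i≢s))
        (subst (λ z → p̂ * p̂ ∣ (α ⊗ β) z) (sym (ℕ.+-identityʳ s)) d)

    -- Up to the index 2j, the Newton polygon of α ⊗ β at p is a segment of slope -1/j, so each factor covers a multiple of j.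
    eisenstein-square : ∀ α β j k l → (∀ i → k ℕ.< i → α i ≡ 0ℤ) → (∀ i → l ℕ.< i → β i ≡ 0ℤ) →
      (∀ i → i ≢ j ℕ.+ j → p̂ ∣ (α ⊗ β) i) → ¬ p̂ ∣ (α ⊗ β) (j ℕ.+ j) →
      (∀ i → i ℕ.< j → p̂ * p̂ ∣ (α ⊗ β) i) → ¬ p̂ * (p̂ * p̂) ∣ (α ⊗ β) 0 →
      ∃₂ λ s t → s ℕ.+ t ≡ j ℕ.+ j × s ℕ.≤ k × t ℕ.≤ l × (s ≡ 0 ⊎ s ≡ j ⊎ t ≡ 0) ×
        (¬ p̂ ∣ α k → s ≡ k) × (¬ p̂ ∣ β l → t ≡ l)
    eisenstein-square α β j k l α-deg β-deg h₁ h₂ h₃ h₄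
      with highest p̂ α k (λ i lt → ≡0⇒∣ (α-deg i lt)) | highest p̂ β l (λ i lt → ≡0⇒∣ (β-deg i lt))
    ... | inj₁ all | _ = ⊥-elim (h₂ (⊗-∣ α β (j ℕ.+ j) λ i i′ _ → ∣m⇒∣m*n (β i′) (all i)))
    ... | inj₂ _ | inj₁ all = ⊥-elim (h₂ (⊗-∣ α β (j ℕ.+ j) λ i i′ _ → ∣n⇒∣m*n (α i) (all i′)))
    ... | inj₂ (s′ , s′≤k , ¬αs′ , highα) | inj₂ (t′ , t′≤l , ¬βt′ , highβ)
      with lowest p̂ α k | lowest p̂ β l
    ...   | inj₁ all | _ = ⊥-elim (¬αs′ (all s′ s′≤k))
    ...   | inj₂ _ | inj₁ all = ⊥-elim (¬βt′ (all t′ t′≤l))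
    ...   | inj₂ (s , s≤k , ¬αs , lowα) | inj₂ (t , t≤l , ¬βt , lowβ) =
      s , t , s+t≡ , s≤k , t≤l , trichotomy ,
      (λ ¬αk → top ¬αk s≤k (subst (λ z → ∀ i → z ℕ.< i → p̂ ∣ α i) (sym s≡s′) highα)) ,
      (λ ¬βl → top ¬βl t≤l (subst (λ z → ∀ i → z ℕ.< i → p̂ ∣ β i) (sym t≡t′) highβ))
      where
      unit-index : ∀ n → ¬ p̂ ∣ (α ⊗ β) n → n ≡ j ℕ.+ j
      unit-index n ¬d with n ℕ.≟ j ℕ.+ j
      ... | yes e = e
      ... | no ¬e = ⊥-elim (¬d (h₁ n ¬e))
      s+t≡ : s ℕ.+ t ≡ j ℕ.+ j
      s+t≡ = unit-index _ (∤-∣⇒∤ pp ¬αs ¬βt (⊗-low α β s t lowα lowβ))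
      s′+t′≡ : s′ ℕ.+ t′ ≡ j ℕ.+ j
      s′+t′≡ = unit-index _ (∤-∣⇒∤ pp ¬αs′ ¬βt′ (⊗-high α β s′ t′ highα highβ))
      s≤s′ : s ℕ.≤ s′
      s≤s′ = ℕ.≮⇒≥ (¬αs′ ∘ lowα s′)
      t≤t′ : t ℕ.≤ t′
      t≤t′ = ℕ.≮⇒≥ (¬βt′ ∘ lowβ t′)
      -- Modulo p the product is a single monomial in degree 2j, so each factor is a monomial too:
      -- its lowest and its highest unit coefficient coincide.
      s≡s′ : s ≡ s′
      s≡s′ = +-bounded s≤s′ t≤t′ (trans s+t≡ (sym s′+t′≡))
      t≡t′ : t ≡ t′
      t≡t′ = +-bounded t≤t′ s≤s′ (trans (ℕ.+-comm t s) (trans (trans s+t≡ (sym s′+t′≡)) (ℕ.+-comm s′ t′)))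
      top : ∀ {γ : Series} {r m} → ¬ p̂ ∣ γ m → r ℕ.≤ m → (∀ i → r ℕ.< i → p̂ ∣ γ i) → r ≡ m
      top {m = m} ¬γm r≤m high with ℕ.m≤n⇒m<n∨m≡n r≤m
      ... | inj₂ e = e
      ... | inj₁ lt = ⊥-elim (¬γm (high m lt))
      <j : ∀ {a b} → a ℕ.< b → a ℕ.+ b ≡ j ℕ.+ j → a ℕ.< j
      <j {a} {b} a<b eq = ℕ.≰⇒> λ j≤a → ℕ.<⇒≢ (ℕ.+-mono-≤-< j≤a (ℕ.≤-<-trans j≤a a<b)) (sym eq)
      -- Unequal positive s and t put the smaller one below j, where p² divides the coefficient of
      -- the product; `¬lopsided` then contradicts the hypothesis on the constant term.
      trichotomy : s ≡ 0 ⊎ s ≡ j ⊎ t ≡ 0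
      trichotomy with s ℕ.≟ 0 | t ℕ.≟ 0 | ℕ.<-cmp s t
      ... | yes e | _ | _ = inj₁ e
      ... | no _ | yes e | _ = inj₂ (inj₂ e)
      ... | no _ | no _ | tri≈ _ s≡t _ = inj₂ (inj₁ (double-injective (trans (cong (s ℕ.+_) s≡t) s+t≡)))
      ... | no s≢0 | no _ | tri< s<t _ _ = ⊥-elim (h₄ (¬lopsided α β s t s<t (ℕ.n≢0⇒n>0 s≢0) ¬αs lowα lowβ (h₃ s (<j s<t s+t≡))))
      ... | no _ | no t≢0 | tri> _ _ t<s = ⊥-elim (h₄ (∣-cong (⊗-comm β α 0)
            (¬lopsided β α t s t<s (ℕ.n≢0⇒n>0 t≢0) ¬βt lowβ lowα (∣-cong (⊗-comm α β t) (h₃ t (<j t<s (trans (ℕ.+-comm t s) s+t≡)))))))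

  -- Integer polynomials, their components over y, and expansion at -1

  Polyᶻ : Set
  Polyᶻ = List ℤ

  ⟦_⟧ : Polyᶻ → Series
  ⟦ [] ⟧    _       = 0ℤ
  ⟦ a ∷ p ⟧ zero    = a
  ⟦ a ∷ p ⟧ (suc k) = ⟦ p ⟧ k

  infixl 6 _+ᶻ_
  _+ᶻ_ : Polyᶻ → Polyᶻ → Polyᶻ
  []      +ᶻ q       = q
  (a ∷ p) +ᶻ []      = a ∷ p
  (a ∷ p) +ᶻ (b ∷ q) = (a + b) ∷ (p +ᶻ q)

  scaleᶻ : ℤ → Polyᶻ → Polyᶻ
  scaleᶻ c = map (c *_)

  infixl 7 _*ᶻ_
  _*ᶻ_ : Polyᶻ → Polyᶻ → Polyᶻ
  []      *ᶻ q = []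
  (a ∷ p) *ᶻ q = scaleᶻ a q +ᶻ (0ℤ ∷ (p *ᶻ q))

  compSqᶻ : Polyᶻ → Polyᶻ
  compSqᶻ []      = []
  compSqᶻ (a ∷ p) = a ∷ 0ℤ ∷ compSqᶻ p

  ⟦+⟧ : ∀ p q i → ⟦ p +ᶻ q ⟧ i ≡ ⟦ p ⟧ i + ⟦ q ⟧ i
  ⟦+⟧ [] q i = sym (+-identityˡ _)
  ⟦+⟧ (a ∷ p) [] i = sym (+-identityʳ _)
  ⟦+⟧ (a ∷ p) (b ∷ q) zero = refl
  ⟦+⟧ (a ∷ p) (b ∷ q) (suc i) = ⟦+⟧ p q i

  ⟦scale⟧ : ∀ c p i → ⟦ scaleᶻ c p ⟧ i ≡ c * ⟦ p ⟧ i
  ⟦scale⟧ c [] i = sym (*-zeroʳ c)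
  ⟦scale⟧ c (a ∷ p) zero = refl
  ⟦scale⟧ c (a ∷ p) (suc i) = ⟦scale⟧ c p i

  ⟦*⟧ : ∀ p q i → ⟦ p *ᶻ q ⟧ i ≡ (⟦ p ⟧ ⊗ ⟦ q ⟧) i
  ⟦*⟧ [] q zero = sym (*-zeroˡ (⟦ q ⟧ 0))
  ⟦*⟧ [] q (suc i) = sym (0⊗ ⟦ q ⟧ (suc i))
  ⟦*⟧ (a ∷ p) q zero = trans (⟦+⟧ (scaleᶻ a q) _ 0) (trans (+-identityʳ _) (⟦scale⟧ a q 0))
  ⟦*⟧ (a ∷ p) q (suc i) = trans (⟦+⟧ (scaleᶻ a q) _ (suc i)) (cong₂ _+_ (⟦scale⟧ a q (suc i)) (⟦*⟧ p q i))

  Y⊗-zero : ∀ s → (Y ⊗ s) 0 ≡ - s 0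
  Y⊗-zero s = -1*i≡-i (s 0)

  Y⊗-suc : ∀ s i → (Y ⊗ s) (suc i) ≡ s i - s (suc i)
  Y⊗-suc s i = trans (cong₂ _+_ (-1*i≡-i (s (suc i))) (trans (const-⊗ 1ℤ s i) (*-identityˡ (s i)))) (+-comm (- s (suc i)) (s i))

  -- The image of p in ℤ[y][z] / (z² - (y - 1)) is U p + V p z.
  U V : Polyᶻ → Series
  U []      = const 0ℤ
  U (a ∷ p) = const a ⊕ Y ⊗ V p
  V []      = const 0ℤ
  V (a ∷ p) = U p

  -- Taylor expansion at -1: T p (y) = p (y - 1).
  T : Polyᶻ → Series
  T []      = const 0ℤ
  T (a ∷ p) = const a ⊕ Y ⊗ T p

  open _-Raw-AlmostCommutative⟶_ const-hom using () renaming (+-homo to const-+; *-homo to const-*)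

  0⊕ : ∀ x → x ≐ const 0ℤ ⊕ x
  0⊕ = solve 1 (λ x → x := con 0ℤ :+ x) ≐-refl

  ⊕0 : ∀ x → x ≐ x ⊕ const 0ℤ
  ⊕0 = solve 1 (λ x → x := x :+ con 0ℤ) ≐-refl

  horner-+ : ∀ a b {p q r} → r ≐ p ⊕ q → const (a + b) ⊕ Y ⊗ r ≐ const a ⊕ Y ⊗ p ⊕ (const b ⊕ Y ⊗ q)
  horner-+ a b {p} {q} r≐ = ≐-trans (⊕-cong≐ (const-+ a b) (⊗-cong≐ (≐-refl {Y}) r≐))
    (solve 5 (λ a b y p q → a :+ b :+ y :* (p :+ q) := a :+ y :* p :+ (b :+ y :* q)) ≐-refl (const a) (const b) Y p q)

  horner-* : ∀ c a {p r} → r ≐ const c ⊗ p → const (c * a) ⊕ Y ⊗ r ≐ const c ⊗ (const a ⊕ Y ⊗ p)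
  horner-* c a {p} r≐ = ≐-trans (⊕-cong≐ (const-* c a) (⊗-cong≐ (≐-refl {Y}) r≐))
    (solve 4 (λ c a y p → c :* a :+ y :* (c :* p) := c :* (a :+ y :* p)) ≐-refl (const c) (const a) Y p)

  ⊗0 : ∀ c → const 0ℤ ≐ c ⊗ const 0ℤ
  ⊗0 = solve 1 (λ c → con 0ℤ := c :* con 0ℤ) ≐-refl

  UV-+ : ∀ p q → U (p +ᶻ q) ≐ U p ⊕ U q × V (p +ᶻ q) ≐ V p ⊕ V q
  UV-+ [] q = 0⊕ (U q) , 0⊕ (V q)
  UV-+ (a ∷ p) [] = ⊕0 (U (a ∷ p)) , ⊕0 (U p)
  UV-+ (a ∷ p) (b ∷ q) = horner-+ a b (proj₂ (UV-+ p q)) , proj₁ (UV-+ p q)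

  UV-scale : ∀ c p → U (scaleᶻ c p) ≐ const c ⊗ U p × V (scaleᶻ c p) ≐ const c ⊗ V p
  UV-scale c [] = ⊗0 (const c) , ⊗0 (const c)
  UV-scale c (a ∷ p) = horner-* c a (proj₂ (UV-scale c p)) , proj₁ (UV-scale c p)

  UV-* : ∀ p q → U (p *ᶻ q) ≐ U p ⊗ U q ⊕ Y ⊗ (V p ⊗ V q) × V (p *ᶻ q) ≐ U p ⊗ V q ⊕ V p ⊗ U q
  UV-* [] q = solve 3 (λ y u v → con 0ℤ := con 0ℤ :* u :+ y :* (con 0ℤ :* v)) ≐-refl Y (U q) (V q)
            , solve 2 (λ u v → con 0ℤ := con 0ℤ :* v :+ con 0ℤ :* u) ≐-refl (U q) (V q)
  UV-* (a ∷ p) q with UV-* p q | UV-+ (scaleᶻ a q) (0ℤ ∷ (p *ᶻ q)) | UV-scale a q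
  ... | u* , v* | u+ , v+ | us , vs =
    ≐-trans u+ (≐-trans (⊕-cong≐ us (⊕-cong≐ (≐-refl {const 0ℤ}) (⊗-cong≐ (≐-refl {Y}) v*)))
      (solve 6 (λ a y u v u′ v′ → a :* u′ :+ (con 0ℤ :+ y :* (u :* v′ :+ v :* u′)) := (a :+ y :* v) :* u′ :+ y :* (u :* v′)) ≐-refl
        (const a) Y (U p) (V p) (U q) (V q)))
    , ≐-trans v+ (≐-trans (⊕-cong≐ vs u*)
      (solve 6 (λ a y u v u′ v′ → a :* v′ :+ (u :* u′ :+ y :* (v :* v′)) := (a :+ y :* v) :* v′ :+ u :* u′) ≐-refl
        (const a) Y (U p) (V p) (U q) (V q)))

  module _ {d : ℤ} where

    Y⊗-∣ : ∀ {s} → (∀ i → d ∣ s i) → ∀ i → d ∣ (Y ⊗ s) i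
    Y⊗-∣ {s} h zero = ∣-cong (sym (Y⊗-zero s)) (∣m⇒∣-m (h 0))
    Y⊗-∣ {s} h (suc i) = ∣-cong (sym (Y⊗-suc s i)) (∣m∣n⇒∣m-n (h i) (h (suc i)))

    const-∣ : ∀ {x} → d ∣ x → ∀ i → d ∣ const x i
    const-∣ h zero = h
    const-∣ h (suc i) = ∣0 d

    UV-∣ : ∀ p → (∀ i → d ∣ ⟦ p ⟧ i) → (∀ i → d ∣ U p i) × (∀ i → d ∣ V p i)
    UV-∣ [] h = const-∣ (∣0 d) , const-∣ (∣0 d)
    UV-∣ (a ∷ p) h with UV-∣ p (h ∘ suc)
    ... | hu , hv = (λ i → ∣m∣n⇒∣m+n (const-∣ (h 0) i) (Y⊗-∣ hv i)) , hu

    T-∣ : ∀ p → (∀ i → d ∣ ⟦ p ⟧ i) → ∀ i → d ∣ T p i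
    T-∣ [] h = const-∣ (∣0 d)
    T-∣ (a ∷ p) h i = ∣m∣n⇒∣m+n (const-∣ (h 0) i) (Y⊗-∣ (T-∣ p (h ∘ suc)) i)

  -1· : ∀ x y {z w : ℤ} → z ≡ x + w → w ≡ - 1ℤ * y → z ≡ x - y
  -1· x y refl refl = cong (_+_ x) (-1*i≡-i y)

  diffᶻ : Polyᶻ → Polyᶻ → Polyᶻ
  diffᶻ p q = p +ᶻ scaleᶻ (- 1ℤ) q

  ⟦diff⟧ : ∀ p q i → ⟦ diffᶻ p q ⟧ i ≡ ⟦ p ⟧ i - ⟦ q ⟧ i
  ⟦diff⟧ p q i = -1· (⟦ p ⟧ i) (⟦ q ⟧ i) (⟦+⟧ p _ i) (⟦scale⟧ (- 1ℤ) q i)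

  -- `U` and `V` recurse on lists, which may differ by trailing zeros. All coefficients of the
  -- difference list vanish, and `UV-∣` at d = 0 transfers this.
  U-cong : ∀ p q → (∀ i → ⟦ p ⟧ i ≡ ⟦ q ⟧ i) → U p ≐ U q × V p ≐ V q
  U-cong p q h = pointwise (λ i → i-j≡0⇒i≡j _ _ (trans (sym (diff-at (U p) (U q) (proj₁ (UV-+ p _)) (proj₁ (UV-scale (- 1ℤ) q)) i)) (0∣⇒≡0 (proj₁ zeros i))))
               , pointwise (λ i → i-j≡0⇒i≡j _ _ (trans (sym (diff-at (V p) (V q) (proj₂ (UV-+ p _)) (proj₂ (UV-scale (- 1ℤ) q)) i)) (0∣⇒≡0 (proj₂ zeros i))))
    where
    zeros = UV-∣ {0ℤ} (diffᶻ p q) λ i → ≡0⇒∣ (trans (⟦diff⟧ p q i) (i≡j⇒i-j≡0 (h i)))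
    diff-at : ∀ {a} b {c} e → a ≐ b ⊕ c → c ≐ const (- 1ℤ) ⊗ e → ∀ i → a i ≡ b i - e i
    diff-at b e p q i = -1· (b i) (e i) (at p i) (trans (at q i) (const-⊗ (- 1ℤ) e i))

  T-+ : ∀ p q → T (p +ᶻ q) ≐ T p ⊕ T q
  T-+ [] q = 0⊕ (T q)
  T-+ (a ∷ p) [] = ⊕0 (T (a ∷ p))
  T-+ (a ∷ p) (b ∷ q) = horner-+ a b (T-+ p q)

  T-scale : ∀ c p → T (scaleᶻ c p) ≐ const c ⊗ T p
  T-scale c [] = ⊗0 (const c)
  T-scale c (a ∷ p) = horner-* c a (T-scale c p)

  T-cong-∣ : ∀ {d} p q → (∀ i → d ∣ ⟦ p ⟧ i - ⟦ q ⟧ i) → ∀ i → d ∣ T p i - T q i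
  T-cong-∣ p q h i = ∣-cong (-1· (T p i) (T q i) (at (T-+ p _) i) (trans (at (T-scale (- 1ℤ) q) i) (const-⊗ (- 1ℤ) (T q) i)))
    (T-∣ (diffᶻ p q) (λ i → ∣-cong (sym (⟦diff⟧ p q i)) (h i)) i)

  -- A polynomial in z² has no z component, and z² becomes y - 1.
  UV-compSq : ∀ p → U (compSqᶻ p) ≐ T p × V (compSqᶻ p) ≐ const 0ℤ
  UV-compSq [] = ≐-refl , ≐-refl
  UV-compSq (a ∷ p) = ⊕-cong≐ (≐-refl {const a}) (⊗-cong≐ (≐-refl {Y}) (proj₁ (UV-compSq p)))
    , ≐-trans (⊕-cong≐ (≐-refl {const 0ℤ}) (⊗-cong≐ (≐-refl {Y}) (proj₂ (UV-compSq p)))) (solve 1 (λ y → con 0ℤ :+ y :* con 0ℤ := con 0ℤ) ≐-refl Y)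

  norm-compSq : ∀ p → norm (U (compSqᶻ p)) (V (compSqᶻ p)) ≐ T p ⊗ T p
  norm-compSq p with UV-compSq p
  ... | hu , hv = ≐-trans (⊕-cong≐ (⊗-cong≐ hu hu) (⊖-cong≐ (⊗-cong≐ (≐-refl {Y}) (⊗-cong≐ hv hv))))
    (solve 2 (λ y t → t :* t :+ :- (y :* (con 0ℤ :* con 0ℤ)) := t :* t) ≐-refl Y (T p))

  -- Powers of 1 + x in the variable y

  [1+x]^ : ℕ → Polyᶻ
  [1+x]^ zero    = 1ℤ ∷ []
  [1+x]^ (suc j) = [1+x]^ j +ᶻ (0ℤ ∷ [1+x]^ j)

  ⟦[1+x]^⟧ : ∀ j i → ⟦ [1+x]^ j ⟧ i ≡ + binom j i
  ⟦[1+x]^⟧ zero zero = refl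
  ⟦[1+x]^⟧ zero (suc i) = refl
  ⟦[1+x]^⟧ (suc j) zero = trans (⟦+⟧ ([1+x]^ j) _ 0) (trans (+-identityʳ _) (⟦[1+x]^⟧ j 0))
  ⟦[1+x]^⟧ (suc j) (suc i) = trans (⟦+⟧ ([1+x]^ j) _ (suc i)) (trans (cong₂ _+_ (⟦[1+x]^⟧ j (suc i)) (⟦[1+x]^⟧ j i)) (cong +_ (ℕ.+-comm (binom j (suc i)) (binom j i))))

  monomial : ℕ → Series
  monomial zero    = const 1ℤ
  monomial (suc j) zero    = 0ℤ
  monomial (suc j) (suc i) = monomial j i

  monomial-≡ : ∀ j → monomial j j ≡ 1ℤ
  monomial-≡ zero = refl
  monomial-≡ (suc j) = monomial-≡ j

  monomial-≢ : ∀ j i → i ≢ j → monomial j i ≡ 0ℤ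
  monomial-≢ zero zero i≢j = ⊥-elim (i≢j refl)
  monomial-≢ zero (suc i) i≢j = refl
  monomial-≢ (suc j) zero i≢j = refl
  monomial-≢ (suc j) (suc i) i≢j = monomial-≢ j i (i≢j ∘ cong suc)

  -- The purpose of the variable y = x + 1: the reduction of q_n modulo p becomes a monomial, as an
  -- Eisenstein argument requires.
  T-[1+x]^ : ∀ j → T ([1+x]^ j) ≐ monomial j
  T-[1+x]^ zero = solve 1 (λ y → con 1ℤ :+ y :* con 0ℤ := con 1ℤ) ≐-refl Y
  T-[1+x]^ (suc j) = pointwise λ i → trans (at (T-+ ([1+x]^ j) _) i) (shift i)
    where
    t = T ([1+x]^ j)
    shift : ∀ i → t i + (const 0ℤ i + (Y ⊗ t) i) ≡ monomial (suc j) i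
    shift zero = trans (cong (λ x → t 0 + (0ℤ + x)) (Y⊗-zero t)) (s (t 0))
      where s : ∀ x → x + (0ℤ + - x) ≡ 0ℤ
            s = solve-∀
    shift (suc i) = trans (cong (λ x → t (suc i) + (0ℤ + x)) (Y⊗-suc t i)) (trans (s (t (suc i)) (t i)) (at (T-[1+x]^ j) i))
      where s : ∀ x y → x + (0ℤ + (y - x)) ≡ y
            s = solve-∀

  -- Degrees and leading coefficients of norms

  -- u(z² + 1) + z v(z² + 1) has degree at most k in z, with coefficient c of z^k.
  record Top (k : ℕ) (c : ℤ) (u v : Series) : Set where
    field
      u-above : ∀ i → k ℕ.< i ℕ.+ i → u i ≡ 0ℤ
      u-top   : ∀ i → i ℕ.+ i ≡ k → u i ≡ c
      v-above : ∀ i → k ℕ.< suc (i ℕ.+ i) → v i ≡ 0ℤ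
      v-top   : ∀ i → suc (i ℕ.+ i) ≡ k → v i ≡ c
  open Top

  const0-at : ∀ i → const 0ℤ i ≡ 0ℤ
  const0-at zero = refl
  const0-at (suc i) = refl

  <suc-double : ∀ i → suc (i ℕ.+ i) ℕ.< suc (suc i ℕ.+ suc i)
  <suc-double i = s≤s (s≤s (ℕ.≤-trans (ℕ.n≤1+n _) (ℕ.≤-reflexive (sym (ℕ.+-suc i i)))))

  -- Multiplication by z exchanges the components, z (u + v z) = `Y` v + u z, and the factor `Y` of
  -- degree 1 with leading coefficient 1 keeps the top coefficient.
  horner-top : ∀ p k → (∀ i → k ℕ.< i → ⟦ p ⟧ i ≡ 0ℤ) → Top k (⟦ p ⟧ k) (U p) (V p)
  horner-top [] k _ = record { u-above = λ i _ → const0-at i ; u-top = λ i _ → const0-at i ; v-above = λ i _ → const0-at i ; v-top = λ i _ → const0-at i }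
  horner-top (a ∷ p) zero h = record
    { u-above = λ { zero () ; (suc i) _ → trans (+-identityˡ _) (Yv0 (suc i)) }
    ; u-top = λ { zero _ → trans (cong (_+_ a) (Yv0 0)) (+-identityʳ a) ; (suc i) () }
    ; v-above = λ i _ → 0∣⇒≡0 (proj₁ zeros i)
    ; v-top = λ i () }
    where
    zeros = UV-∣ {0ℤ} p λ i → ≡0⇒∣ (h (suc i) (s≤s z≤n))
    Yv0 : ∀ i → (Y ⊗ V p) i ≡ 0ℤ
    Yv0 i = 0∣⇒≡0 (Y⊗-∣ (proj₂ zeros) i)
  horner-top (a ∷ p) (suc k) h = record
    { u-above = λ { zero () ; (suc i) lt → trans (u-step i) (cong₂ _-_ (v-above t i (lower i lt)) (v-above t (suc i) (ℕ.<-trans (lower i lt) (<suc-double i)))) }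
    ; u-top = λ { zero () ; (suc i) eq → trans (u-step i) (trans (cong₂ _-_ (v-top t i (lower≡ i eq))
        (v-above t (suc i) (subst (ℕ._< suc (suc i ℕ.+ suc i)) (lower≡ i eq) (<suc-double i)))) (+-identityʳ _)) }
    ; v-above = λ i lt → u-above t i (ℕ.≤-pred lt)
    ; v-top = λ i eq → u-top t i (ℕ.suc-injective eq) }
    where
    t = horner-top p k (λ i lt → h (suc i) (s≤s lt))
    u-step : ∀ i → 0ℤ + (Y ⊗ V p) (suc i) ≡ V p i - V p (suc i)
    u-step i = trans (+-identityˡ _) (Y⊗-suc (V p) i)
    lower : ∀ i → suc k ℕ.< suc i ℕ.+ suc i → k ℕ.< suc (i ℕ.+ i)
    lower i lt = subst (k ℕ.<_) (ℕ.+-suc i i) (ℕ.≤-pred lt)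
    lower≡ : ∀ i → suc i ℕ.+ suc i ≡ suc k → suc (i ℕ.+ i) ≡ k
    lower≡ i eq = trans (sym (ℕ.+-suc i i)) (ℕ.suc-injective eq)

  -- For even k the top coefficient comes from u², for odd k from - `Y` v²; hence the sign. So
  -- degree k in z becomes degree k in y.
  norm-top : ∀ k c u v → Top k c u v → (∀ i → k ℕ.< i → norm u v i ≡ 0ℤ) × (norm u v k ≡ c * c ⊎ norm u v k ≡ - (c * c))
  norm-top k c u v t with halve k
  ... | inj₁ (e , refl) = (λ i lt → cong₂ (λ x y → x + - y) (uu i lt) (Yvv i (ℕ.<⇒≤ lt)))
      , inj₁ (trans (cong₂ (λ x y → x + - y) uu-top (Yvv (e ℕ.+ e) ℕ.≤-refl)) (+-identityʳ _))
    where
    u0 : ∀ i → suc e ℕ.≤ i → 0ℤ ∣ u i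
    u0 i lt = ≡0⇒∣ (u-above t i (ℕ.+-mono-< lt lt))
    v0 : ∀ i → e ℕ.≤ i → 0ℤ ∣ v i
    v0 i le = ≡0⇒∣ (v-above t i (s≤s (ℕ.+-mono-≤ le le)))
    uu : ∀ i → e ℕ.+ e ℕ.< i → (u ⊗ u) i ≡ 0ℤ
    uu i lt = 0∣⇒≡0 (⊗-beyond u u (suc e) (suc e) u0 u0 i (s≤s (ℕ.≤-trans (ℕ.≤-reflexive (ℕ.+-suc e e)) lt)))
    uu-top : (u ⊗ u) (e ℕ.+ e) ≡ c * c
    uu-top = trans (i-j≡0⇒i≡j _ _ (0∣⇒≡0 (⊗-high u u e e u0 u0))) (cong₂ _*_ (u-top t e refl) (u-top t e refl))
    vv : ∀ i → e ℕ.+ e ℕ.≤ suc i → (v ⊗ v) i ≡ 0ℤ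
    vv i le = 0∣⇒≡0 (⊗-beyond v v e e v0 v0 i le)
    Yvv : ∀ i → e ℕ.+ e ℕ.≤ i → (Y ⊗ (v ⊗ v)) i ≡ 0ℤ
    Yvv zero le = trans (Y⊗-zero (v ⊗ v)) (cong -_ (vv 0 (ℕ.m≤n⇒m≤1+n le)))
    Yvv (suc i) le = trans (Y⊗-suc (v ⊗ v) i) (cong₂ _-_ (vv i le) (vv (suc i) (ℕ.m≤n⇒m≤1+n le)))
  ... | inj₂ (e , refl) = (λ { (suc i) (s≤s lt) → cong₂ (λ x y → x + - y) (uu (suc i) (ℕ.m≤n⇒m≤1+n lt)) (trans (Y⊗-suc (v ⊗ v) i) (cong₂ _-_ (vv i lt) (vv (suc i) (ℕ.m≤n⇒m≤1+n lt)))) })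
      , inj₂ (trans (cong₂ (λ x y → x + - y) (uu (suc (e ℕ.+ e)) ℕ.≤-refl)
          (trans (Y⊗-suc (v ⊗ v) (e ℕ.+ e)) (trans (cong₂ _-_ vv-top (vv (suc (e ℕ.+ e)) ℕ.≤-refl)) (+-identityʳ (c * c))))) (+-identityˡ (- (c * c))))
    where
    u0 : ∀ i → suc e ℕ.≤ i → 0ℤ ∣ u i
    u0 i lt = ≡0⇒∣ (u-above t i (ℕ.≤-trans (s≤s (ℕ.≤-reflexive (sym (ℕ.+-suc e e)))) (ℕ.+-mono-≤ lt lt)))
    v0 : ∀ i → suc e ℕ.≤ i → 0ℤ ∣ v i
    v0 i lt = ≡0⇒∣ (v-above t i (s≤s (ℕ.+-mono-< lt lt)))
    uu : ∀ i → suc (e ℕ.+ e) ℕ.≤ i → (u ⊗ u) i ≡ 0ℤ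
    uu i lt = 0∣⇒≡0 (⊗-beyond u u (suc e) (suc e) u0 u0 i (s≤s (ℕ.≤-trans (ℕ.≤-reflexive (ℕ.+-suc e e)) lt)))
    vv : ∀ i → suc (e ℕ.+ e) ℕ.≤ i → (v ⊗ v) i ≡ 0ℤ
    vv i lt = 0∣⇒≡0 (⊗-beyond v v (suc e) (suc e) v0 v0 i (s≤s (ℕ.≤-trans (ℕ.≤-reflexive (ℕ.+-suc e e)) lt)))
    vv-top : (v ⊗ v) (e ℕ.+ e) ≡ c * c
    vv-top = trans (i-j≡0⇒i≡j _ _ (0∣⇒≡0 (⊗-high v v e e v0 v0))) (cong₂ _*_ (v-top t e refl) (v-top t e refl))

  -- The value of q_n at -1

  tabulateᶻ : ℕ → (ℕ → ℤ) → Polyᶻ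
  tabulateᶻ zero    h = []
  tabulateᶻ (suc r) h = h 0 ∷ tabulateᶻ r (h ∘ suc)

  ⟦tabulate⟧ : ∀ r h i → i ℕ.< r → ⟦ tabulateᶻ r h ⟧ i ≡ h i
  ⟦tabulate⟧ (suc r) h zero _ = refl
  ⟦tabulate⟧ (suc r) h (suc i) (s≤s lt) = ⟦tabulate⟧ r (h ∘ suc) i lt

  ⟦tabulate⟧-beyond : ∀ r h i → r ℕ.≤ i → ⟦ tabulateᶻ r h ⟧ i ≡ 0ℤ
  ⟦tabulate⟧-beyond zero h i _ = refl
  ⟦tabulate⟧-beyond (suc r) h (suc i) (s≤s le) = ⟦tabulate⟧-beyond r (h ∘ suc) i le

  [-1]^ : ℕ → ℤ
  [-1]^ zero    = 1ℤ
  [-1]^ (suc r) = - [-1]^ r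

  -- Pascal's rule splits each coefficient into two neighbours of row N, and the alternating sum
  -- telescopes.
  alternating-tail : ∀ N s r → T (tabulateᶻ r (λ i → + binom (suc N) (suc s ℕ.+ i))) 0 ≡ + binom N s - [-1]^ r * + binom N (s ℕ.+ r)
  alternating-tail N s zero = trans (e (+ binom N s)) (cong (λ t → + binom N s - 1ℤ * + binom N t) (sym (ℕ.+-identityʳ s)))
    where e : ∀ x → 0ℤ ≡ x - 1ℤ * x
          e = solve-∀
  alternating-tail N s (suc r) = begin
    + binom (suc N) (suc s ℕ.+ 0) + (Y ⊗ T tl) 0 ≡⟨ cong₂ _+_ (cong (λ t → + binom (suc N) (suc t)) (ℕ.+-identityʳ s)) (Y⊗-zero (T tl)) ⟩
    + b₀ + + b₁ - T tl 0 ≡⟨ cong (λ t → + b₀ + + b₁ - t) (trans tl≡ (alternating-tail N (suc s) r)) ⟩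
    + b₀ + + b₁ - (+ b₁ - σ * + binom N (suc (s ℕ.+ r))) ≡⟨ e (+ b₀) (+ b₁) σ _ ⟩
    + b₀ - (- σ) * + binom N (suc (s ℕ.+ r)) ≡⟨ cong (λ t → + b₀ - (- σ) * + binom N t) (sym (ℕ.+-suc s r)) ⟩
    + b₀ - (- σ) * + binom N (s ℕ.+ suc r) ∎
    where
    open ≡-Reasoning
    b₀ = binom N s
    b₁ = binom N (suc s)
    σ = [-1]^ r
    tl = tabulateᶻ r (λ i → + binom (suc N) (suc s ℕ.+ suc i))
    tabulate-cong : ∀ r {f g : ℕ → ℤ} → (∀ i → f i ≡ g i) → tabulateᶻ r f ≡ tabulateᶻ r g
    tabulate-cong zero h = refl
    tabulate-cong (suc r) h = cong₂ _∷_ (h 0) (tabulate-cong r (h ∘ suc))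
    tl≡ : T tl 0 ≡ T (tabulateᶻ r (λ i → + binom (suc N) (suc (suc s) ℕ.+ i))) 0
    tl≡ = cong (λ p → T p 0) (tabulate-cong r λ i → cong (λ t → + binom (suc N) (suc t)) (ℕ.+-suc s i))
    e : ∀ a b s x → a + b - (b - s * x) ≡ a - (- s) * x
    e = solve-∀

  -- T p 0 is the value of p at -1.
  alternating-sum : ∀ N m → T (tabulateᶻ (suc m) (λ i → + binom (suc N) i)) 0 ≡ [-1]^ m * + binom N m
  alternating-sum N m = trans (cong (_+_ 1ℤ) (trans (Y⊗-zero (T tl)) (cong -_ (alternating-tail N 0 m)))) (e ([-1]^ m * + binom N m))
    where
    tl = tabulateᶻ m (λ i → + binom (suc N) (suc i))
    e : ∀ x → 1ℤ + - (1ℤ - x) ≡ x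
    e = solve-∀

  ∣[-1]^* : ∀ {d} m x → d ∣ [-1]^ m * x → d ∣ x
  ∣[-1]^* zero x h = ∣-cong (*-identityˡ x) h
  ∣[-1]^* (suc m) x h = ∣[-1]^* m x (∣-cong (neg-involutive _) (∣m⇒∣-m (∣-cong (sym (neg-distribˡ-* ([-1]^ m) x)) h)))

  -- Factorisations up to a scalar, and their degrees modulo p

  p³∣x²⇒p²∣x : ∀ {p} → Prime p → ∀ x → + p * (+ p * + p) ∣ x * x → + p * + p ∣ x
  p³∣x²⇒p²∣x {p} pp x d with reduce (euclid pp x x (∣-trans (∣m⇒∣m*n (+ p * + p) ∣-refl) d))
  ... | divides z refl = *-monoˡ-∣ (+ p) (reduce (euclid pp z z
      (*-cancelʳ-∣ (+ p * + p) {{i*j≢0 (+ p) (+ p) {{+prime-nonZero pp}} {{+prime-nonZero pp}}}} (∣-cong (s z (+ p)) d))))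
    where s : ∀ z p → z * p * (z * p) ≡ z * z * (p * p)
          s = solve-∀

  compSq-scale : ∀ c p i → ⟦ compSqᶻ (scaleᶻ c p) ⟧ i ≡ c * ⟦ compSqᶻ p ⟧ i
  compSq-scale c [] i = sym (*-zeroʳ c)
  compSq-scale c (a ∷ p) zero = refl
  compSq-scale c (a ∷ p) (suc zero) = sym (*-zeroʳ c)
  compSq-scale c (a ∷ p) (suc (suc i)) = compSq-scale c p i

  -- The scalar `c` absorbs cleared denominators. `A-deg` and `B-deg` only bound the degrees; when k
  -- + l is the degree of φ, the bounds are attained because c ≠ 0.
  record Factorisation (φ : Series) (k l : ℕ) : Set where
    field
      A B   : Polyᶻ
      c     : ℤ
      c≢0   : c ≢ 0ℤ
      AB≡cφ : ∀ i → (⟦ A ⟧ ⊗ ⟦ B ⟧) i ≡ c * φ i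
      A-deg : ∀ i → k ℕ.< i → ⟦ A ⟧ i ≡ 0ℤ
      B-deg : ∀ i → l ℕ.< i → ⟦ B ⟧ i ≡ 0ℤ

  module _ {p} (pp : Prime p) where
    private
      p̂ = + p

    norm-mult-lists : ∀ A B Q → (∀ i → (⟦ A ⟧ ⊗ ⟦ B ⟧) i ≡ ⟦ compSqᶻ Q ⟧ i) →
      norm (U A) (V A) ⊗ norm (U B) (V B) ≐ T Q ⊗ T Q
    norm-mult-lists A B Q h = ≐-trans (≐-sym (norm-mult (U A) (V A) (U B) (V B)))
      (≐-trans (⊕-cong≐ (⊗-cong≐ u u) (⊖-cong≐ (⊗-cong≐ (≐-refl {Y}) (⊗-cong≐ v v)))) (norm-compSq Q))
      where
      uv = U-cong (A *ᶻ B) (compSqᶻ Q) λ i → trans (⟦*⟧ A B i) (h i)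
      u = ≐-trans (≐-sym (proj₁ (UV-* A B))) (proj₁ uv)
      v = ≐-trans (≐-sym (proj₂ (UV-* A B))) (proj₂ uv)

    -- The norms of A and B multiply to the square of `T` (c Q), which is congruent to c y^j modulo
    -- p and has constant term c Q(-1). These are the data for `eisenstein-square`, and by
    -- `norm-top` a leading coefficient prime to p remains so in the norm.
    local-degrees : ∀ {Q k l} j (F : Factorisation ⟦ compSqᶻ Q ⟧ k l) → let open Factorisation F in ¬ p̂ ∣ c →
      (∀ i → p̂ ∣ ⟦ Q ⟧ i - + binom j i) → ¬ p̂ * p̂ ∣ T Q 0 →
      ∃₂ λ s t → s ℕ.+ t ≡ j ℕ.+ j × s ℕ.≤ k × t ℕ.≤ l × (s ≡ 0 ⊎ s ≡ j ⊎ t ≡ 0) ×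
        (¬ p̂ ∣ ⟦ A ⟧ k → s ≡ k) × (¬ p̂ ∣ ⟦ B ⟧ l → t ≡ l)
    local-degrees {Q} {k} {l} j F p∤c Q≡ Q-1 =
      let s , t , s+t , s≤k , t≤l , tri , hs , ht = eisenstein-square pp α β j k l (proj₁ αtop) (proj₁ βtop) h₁ h₂ h₃ h₄
      in s , t , s+t , s≤k , t≤l , tri , hs ∘ norm-unit (proj₂ αtop) , ht ∘ norm-unit (proj₂ βtop)
      where
      open Factorisation F
      α = norm (U A) (V A)
      β = norm (U B) (V B)
      αtop = norm-top k (⟦ A ⟧ k) (U A) (V A) (horner-top A k A-deg)
      βtop = norm-top l (⟦ B ⟧ l) (U B) (V B) (horner-top B l B-deg)
      norm-unit : ∀ {x y} → x ≡ y * y ⊎ x ≡ - (y * y) → ¬ p̂ ∣ y → ¬ p̂ ∣ x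
      norm-unit {x} {y} (inj₁ refl) p∤y d = [ p∤y , p∤y ]′ (euclid pp y y d)
      norm-unit {x} {y} (inj₂ refl) p∤y d = [ p∤y , p∤y ]′ (euclid pp y y (∣-cong (neg-involutive (y * y)) (∣m⇒∣-m d)))
      S = scaleᶻ c Q
      τ = T S
      αβ : α ⊗ β ≐ τ ⊗ τ
      αβ = norm-mult-lists A B S λ i → trans (AB≡cφ i) (sym (compSq-scale c Q i))
      τ≡ : ∀ i → τ i ≡ c * T Q i
      τ≡ i = trans (at (T-scale c Q) i) (const-⊗ c (T Q) i)
      TQ≡ : ∀ i → p̂ ∣ T Q i - monomial j i
      TQ≡ i = ∣-cong (cong (_-_ (T Q i)) (at (T-[1+x]^ j) i))
        (T-cong-∣ Q ([1+x]^ j) (λ i → ∣-cong (cong (_-_ (⟦ Q ⟧ i)) (sym (⟦[1+x]^⟧ j i))) (Q≡ i)) i)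
      τ-div : ∀ i → i ≢ j → p̂ ∣ τ i
      τ-div i i≢j = ∣-cong (sym (τ≡ i)) (∣n⇒∣m*n c (∣-∣⇒∣ (TQ≡ i) (≡0⇒∣ (monomial-≢ j i i≢j))))
      p∤1 : ¬ p̂ ∣ 1ℤ
      p∤1 d = prime∤1 pp (∣⇒∣ᵤ d)
      τ-unit : ¬ p̂ ∣ τ j
      τ-unit d = [ p∤c , (λ q → p∤1 (∣-cong (monomial-≡ j) (∣-∣⇒∣′ (TQ≡ j) q))) ]′ (euclid pp c (T Q j) (∣-cong (τ≡ j) d))
      to : ∀ {d} i → d ∣ (τ ⊗ τ) i → d ∣ (α ⊗ β) i
      to i = ∣-cong (sym (at αβ i))
      h₁ : ∀ i → i ≢ j ℕ.+ j → p̂ ∣ (α ⊗ β) i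
      h₁ i i≢ = to i (⊗-∣ τ τ i term)
        where
        term : ∀ a b → a ℕ.+ b ≡ i → p̂ ∣ τ a * τ b
        term a b eq with a ℕ.≟ j | b ℕ.≟ j
        ... | no a≢j | _ = ∣m⇒∣m*n (τ b) (τ-div a a≢j)
        ... | yes _ | no b≢j = ∣n⇒∣m*n (τ a) (τ-div b b≢j)
        ... | yes refl | yes refl = ⊥-elim (i≢ (sym eq))
      h₂ : ¬ p̂ ∣ (α ⊗ β) (j ℕ.+ j)
      h₂ d = ∤-∣⇒∤ pp τ-unit τ-unit
        (⊗-low τ τ j j (λ i lt → τ-div i (ℕ.<⇒≢ lt)) (λ i lt → τ-div i (ℕ.<⇒≢ lt))) (∣-cong (at αβ (j ℕ.+ j)) d)
      h₃ : ∀ i → i ℕ.< j → p̂ * p̂ ∣ (α ⊗ β) i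
      h₃ i i<j = to i (⊗-∣ τ τ i λ a b eq → ∣-*-mono
        (τ-div a (ℕ.<⇒≢ (ℕ.≤-<-trans (subst (a ℕ.≤_) eq (ℕ.m≤m+n a b)) i<j)))
        (τ-div b (ℕ.<⇒≢ (ℕ.≤-<-trans (subst (b ℕ.≤_) eq (ℕ.m≤n+m b a)) i<j))))
      h₄ : ¬ p̂ * (p̂ * p̂) ∣ (α ⊗ β) 0
      h₄ d = Q-1 (p²∣*⇒p²∣ pp c (T Q 0) p∤c (∣-cong (τ≡ 0) (p³∣x²⇒p²∣x pp (τ 0) (∣-cong (at αβ 0) d))))

    divide : ∀ A → (∀ i → p̂ ∣ ⟦ A ⟧ i) → ∃ λ A′ → ∀ i → ⟦ A ⟧ i ≡ p̂ * ⟦ A′ ⟧ i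
    divide [] h = [] , λ i → sym (*-zeroʳ p̂)
    divide (a ∷ A) h with h 0 | divide A (h ∘ suc)
    ... | divides x eq | A′ , hA′ = x ∷ A′ , λ { zero → trans eq (*-comm x p̂) ; (suc i) → hA′ i }

    p̂*-cancel : ∀ {x y} → p̂ * x ≡ p̂ * y → x ≡ y
    p̂*-cancel {x} {y} = *-cancelˡ-≡ p̂ x y {{+prime-nonZero pp}}

    p̂*≡0 : ∀ {x} → p̂ * x ≡ 0ℤ → x ≡ 0ℤ
    p̂*≡0 eq = p̂*-cancel (trans eq (sym (*-zeroʳ p̂)))

    gauss : ∀ A B k l → (∀ i → k ℕ.< i → ⟦ A ⟧ i ≡ 0ℤ) → (∀ i → l ℕ.< i → ⟦ B ⟧ i ≡ 0ℤ) →
      (∀ i → p̂ ∣ (⟦ A ⟧ ⊗ ⟦ B ⟧) i) → (∀ i → p̂ ∣ ⟦ A ⟧ i) ⊎ (∀ i → p̂ ∣ ⟦ B ⟧ i)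
    gauss A B k l A-deg B-deg h with highest p̂ ⟦ A ⟧ k (λ i lt → ≡0⇒∣ (A-deg i lt)) | highest p̂ ⟦ B ⟧ l (λ i lt → ≡0⇒∣ (B-deg i lt))
    ... | inj₁ all | _ = inj₁ all
    ... | inj₂ _ | inj₁ all = inj₂ all
    ... | inj₂ (s , _ , ¬s , highA) | inj₂ (t , _ , ¬t , highB) = ⊥-elim (∤-∣⇒∤ pp ¬s ¬t (⊗-high ⟦ A ⟧ ⟦ B ⟧ s t highA highB) (h (s ℕ.+ t)))

    -- Descent on |c|: while p divides c, Gauss's lemma finds p in all coefficients of A or all of
    -- B, and dividing it out shrinks |c|. Other primes may remain in c.
    localise : ∀ {φ k l} → Factorisation φ k l → ∃ λ (F : Factorisation φ k l) → ¬ p̂ ∣ Factorisation.c F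
    localise {φ} {k} {l} F = <-rec (λ n → (F : Factorisation φ k l) → abs (Factorisation.c F) ≡ n →
        ∃ λ (F : Factorisation φ k l) → ¬ p̂ ∣ Factorisation.c F) step _ F refl
      where
      step : ∀ n → (∀ {n′} → n′ ℕ.< n → (F : Factorisation φ k l) → abs (Factorisation.c F) ≡ n′ →
               ∃ λ (F : Factorisation φ k l) → ¬ p̂ ∣ Factorisation.c F) →
             (F : Factorisation φ k l) → abs (Factorisation.c F) ≡ n → ∃ λ (F : Factorisation φ k l) → ¬ p̂ ∣ Factorisation.c F
      step n rec F abs≡ with p̂ ∣? Factorisation.c F
      ... | no p∤c = F , p∤c
      ... | yes (divides x c≡) = descend (gauss A B k l A-deg B-deg (λ i → ∣-cong (sym (AB≡cφ i)) (∣m⇒∣m*n (φ i) (divides x c≡))))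
        where
        open Factorisation F
        x≢0 : x ≢ 0ℤ
        x≢0 refl = c≢0 (trans c≡ (*-zeroˡ p̂))
        0<∣x∣ : 0 ℕ.< abs x
        0<∣x∣ = ℕ.n≢0⇒n>0 (x≢0 ∘ ∣i∣≡0⇒i≡0)
        ∣x∣<n : abs x ℕ.< n
        ∣x∣<n = subst (abs x ℕ.<_) (trans (sym (abs-* x p̂)) (trans (cong abs (sym c≡)) abs≡))
                  (ℕ.m<m*n (abs x) p {{ℕ.>-nonZero 0<∣x∣}} (prime≥2 pp))
        c*≡ : ∀ i → c * φ i ≡ p̂ * (x * φ i)
        c*≡ i = trans (cong (_* φ i) c≡) (s x p̂ (φ i))
          where s : ∀ x p f → x * p * f ≡ p * (x * f)
                s = solve-∀
        descend : (∀ i → p̂ ∣ ⟦ A ⟧ i) ⊎ (∀ i → p̂ ∣ ⟦ B ⟧ i) → ∃ λ (F : Factorisation φ k l) → ¬ p̂ ∣ Factorisation.c F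
        descend (inj₁ all) with divide A all
        ... | A′ , A≡ = rec ∣x∣<n (record { A = A′ ; B = B ; c = x ; c≢0 = x≢0
            ; AB≡cφ = λ i → p̂*-cancel (trans (sym (·-⊗ p̂ ⟦ A′ ⟧ ⟦ B ⟧ i)) (trans (⊗-cong (sym ∘ A≡) (λ _ → refl) i) (trans (AB≡cφ i) (c*≡ i))))
            ; A-deg = λ i lt → p̂*≡0 (trans (sym (A≡ i)) (A-deg i lt)) ; B-deg = B-deg }) refl
        descend (inj₂ all) with divide B all
        ... | B′ , B≡ = rec ∣x∣<n (record { A = A ; B = B′ ; c = x ; c≢0 = x≢0
            ; AB≡cφ = λ i → p̂*-cancel (trans (cong (p̂ *_) (⊗-comm ⟦ A ⟧ ⟦ B′ ⟧ i)) (trans (sym (·-⊗ p̂ ⟦ B′ ⟧ ⟦ A ⟧ i))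
                         (trans (⊗-cong (sym ∘ B≡) (λ _ → refl) i) (trans (⊗-comm ⟦ B ⟧ ⟦ A ⟧ i) (trans (AB≡cφ i) (c*≡ i))))))
            ; A-deg = A-deg ; B-deg = λ i lt → p̂*≡0 (trans (sym (B≡ i)) (B-deg i lt)) }) refl

open BinomialPrimes
open IntegerPolynomials

open import Data.Nat as ℕ using (zero; suc; z≤n; s≤s; _<_; _∸_; _/_; ⌊_/2⌋)
import Data.Nat.Properties as ℕ
import Data.Nat.Divisibility as ℕ∣
open import Data.Nat.DivMod using (/-monoˡ-≤; m*n%n≡0; m*n/n≡m; +-distrib-/-∣ʳ)
open import Data.Nat.Combinatorics using (_C_)
open import Data.Nat.Primality using (Prime; prime?)
open import Data.Integer as ℤ using (ℤ; +_; 0ℤ; 1ℤ; _*_; _-_)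
import Data.Integer.Properties as ℤ
open import Data.Integer.Divisibility.Signed
open import Data.Integer.Tactic.RingSolver using (solve-∀)
open import Data.Rational as ℚ using (ℚ; 0ℚ; 1ℚ; ↥_; ↧_; toℚᵘ)
import Data.Rational.Properties as ℚ
open import Data.Rational.Unnormalised using (mkℚᵘ; *≡*; _≃_)
import Data.Rational.Unnormalised.Properties as ℚᵘ
open import Data.List using ([]; _∷_; length)
open import Data.Product using (∃; ∃₂; _,_)
open import Data.Sum using (_⊎_; inj₁; inj₂; [_,_]′)
open import Data.Empty
open import Data.Unit using (tt)
open import Function using (_∘_)
open import Algebra.Bundles using (CommutativeMonoid)
open import Algebra.Properties.CommutativeSemigroup using (interchange)
open import Relation.Nullary
open import Relation.Nullary.Decidable using (from-yes; from-no; _×-dec_; _⊎-dec_; ¬?)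
open import Relation.Binary.PropositionalEquality

-- Clearing the denominators of rational polynomials

ι : ℤ → ℚ
ι x = x ℚ./ 1

toℚᵘ-ι : ∀ x → toℚᵘ (ι x) ≃ mkℚᵘ x 0
toℚᵘ-ι x = ℚ.toℚᵘ-fromℚᵘ (mkℚᵘ x 0)

ι-+ : ∀ x y → ι (x ℤ.+ y) ≡ ι x ℚ.+ ι y
ι-+ x y = ℚ.toℚᵘ-injective (ℚᵘ.≃-trans (toℚᵘ-ι (x ℤ.+ y)) (ℚᵘ.≃-trans (*≡* (s x y))
  (ℚᵘ.≃-sym (ℚᵘ.≃-trans (ℚ.toℚᵘ-homo-+ (ι x) (ι y)) (ℚᵘ.+-cong (toℚᵘ-ι x) (toℚᵘ-ι y))))))
  where s : ∀ x y → (x ℤ.+ y) ℤ.* 1ℤ ≡ (x ℤ.* 1ℤ ℤ.+ y ℤ.* 1ℤ) ℤ.* 1ℤ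
        s = solve-∀

ι-* : ∀ x y → ι (x ℤ.* y) ≡ ι x ℚ.* ι y
ι-* x y = ℚ.toℚᵘ-injective (ℚᵘ.≃-trans (toℚᵘ-ι (x ℤ.* y)) (ℚᵘ.≃-trans (*≡* refl)
  (ℚᵘ.≃-sym (ℚᵘ.≃-trans (ℚ.toℚᵘ-homo-* (ι x) (ι y)) (ℚᵘ.*-cong (toℚᵘ-ι x) (toℚᵘ-ι y))))))

ι-injective : ∀ {x y} → ι x ≡ ι y → x ≡ y
ι-injective {x} {y} eq with ℚᵘ.≃-trans (ℚᵘ.≃-sym (toℚᵘ-ι x)) (ℚᵘ.≃-trans (ℚᵘ.≃-reflexive (cong toℚᵘ eq)) (toℚᵘ-ι y))
... | *≡* h = trans (sym (ℤ.*-identityʳ x)) (trans h (ℤ.*-identityʳ y))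

ι-↧*≡ι-↥ : ∀ r → ι (↧ r) ℚ.* r ≡ ι (↥ r)
ι-↧*≡ι-↥ r@record{} = ℚ.toℚᵘ-injective (ℚᵘ.≃-trans (ℚ.toℚᵘ-homo-* (ι (↧ r)) r)
  (ℚᵘ.≃-trans (ℚᵘ.*-cong (toℚᵘ-ι (↧ r)) (ℚᵘ.≃-refl {toℚᵘ r})) (ℚᵘ.≃-trans (*≡* (s (↧ r) (↥ r))) (ℚᵘ.≃-sym (toℚᵘ-ι (↥ r))))))
  where s : ∀ d n → d ℤ.* n ℤ.* 1ℤ ≡ n ℤ.* (1ℤ ℤ.* d)
        s = solve-∀

record Cleared (f : Poly) : Set where
  constructor cleared
  field
    list  : Polyᶻ
    denom : ℤ
    denom≢0 : denom ≢ 0ℤ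
    coeffs  : ∀ i → ι denom ℚ.* coeff f i ≡ ι (⟦ list ⟧ i)

≢0-* : ∀ {x y} → x ≢ 0ℤ → y ≢ 0ℤ → x ℤ.* y ≢ 0ℤ
≢0-* {x} {y} x≢0 y≢0 eq = [ x≢0 , y≢0 ]′ (ℤ.i*j≡0⇒i≡0∨j≡0 x eq)

clear : ∀ f → Cleared f
clear [] = cleared [] 1ℤ (λ ()) λ _ → ℚ.*-zeroʳ (ι 1ℤ)
clear (a ∷ f) with clear f
... | cleared A d d≢0 h = cleared (↥ a ℤ.* d ∷ scaleᶻ (↧ a) A) (↧ a ℤ.* d) (≢0-* {↧ a} (λ ()) d≢0) coeffs
  where
  coeffs : ∀ i → ι (↧ a ℤ.* d) ℚ.* coeff (a ∷ f) i ≡ ι (⟦ ↥ a ℤ.* d ∷ scaleᶻ (↧ a) A ⟧ i)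
  coeffs zero = begin
    ι (↧ a ℤ.* d) ℚ.* a ≡⟨ cong (ℚ._* a) (trans (ι-* (↧ a) d) (ℚ.*-comm (ι (↧ a)) (ι d))) ⟩
    ι d ℚ.* ι (↧ a) ℚ.* a ≡⟨ ℚ.*-assoc (ι d) (ι (↧ a)) a ⟩
    ι d ℚ.* (ι (↧ a) ℚ.* a) ≡⟨ cong (ι d ℚ.*_) (ι-↧*≡ι-↥ a) ⟩
    ι d ℚ.* ι (↥ a) ≡⟨ ℚ.*-comm (ι d) (ι (↥ a)) ⟩
    ι (↥ a) ℚ.* ι d ≡⟨ ι-* (↥ a) d ⟨
    ι (↥ a ℤ.* d) ∎
    where open ≡-Reasoning
  coeffs (suc i) = begin
    ι (↧ a ℤ.* d) ℚ.* coeff f i ≡⟨ cong (ℚ._* coeff f i) (ι-* (↧ a) d) ⟩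
    ι (↧ a) ℚ.* ι d ℚ.* coeff f i ≡⟨ ℚ.*-assoc (ι (↧ a)) (ι d) (coeff f i) ⟩
    ι (↧ a) ℚ.* (ι d ℚ.* coeff f i) ≡⟨ cong (ι (↧ a) ℚ.*_) (h i) ⟩
    ι (↧ a) ℚ.* ι (⟦ A ⟧ i) ≡⟨ ι-* (↧ a) (⟦ A ⟧ i) ⟨
    ι (↧ a ℤ.* ⟦ A ⟧ i) ≡⟨ cong ι (⟦scale⟧ (↧ a) A i) ⟨
    ι (⟦ scaleᶻ (↧ a) A ⟧ i) ∎
    where open ≡-Reasoning

coeff-+ : ∀ f g i → coeff (f +ₚ g) i ≡ coeff f i ℚ.+ coeff g i
coeff-+ [] g i = sym (ℚ.+-identityˡ _)
coeff-+ (a ∷ f) [] i = sym (ℚ.+-identityʳ _)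
coeff-+ (a ∷ f) (b ∷ g) zero = refl
coeff-+ (a ∷ f) (b ∷ g) (suc i) = coeff-+ f g i

coeff-scale : ∀ c f i → coeff (scale c f) i ≡ c ℚ.* coeff f i
coeff-scale c [] i = sym (ℚ.*-zeroʳ c)
coeff-scale c (a ∷ f) zero = refl
coeff-scale c (a ∷ f) (suc i) = coeff-scale c f i

coeff-*-zero : ∀ a f g → coeff ((a ∷ f) *ₚ g) 0 ≡ a ℚ.* coeff g 0
coeff-*-zero a f g = trans (coeff-+ (scale a g) (0ℚ ∷ (f *ₚ g)) 0) (trans (ℚ.+-identityʳ _) (coeff-scale a g 0))

coeff-*-suc : ∀ a f g i → coeff ((a ∷ f) *ₚ g) (suc i) ≡ a ℚ.* coeff g (suc i) ℚ.+ coeff (f *ₚ g) i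
coeff-*-suc a f g i = trans (coeff-+ (scale a g) (0ℚ ∷ (f *ₚ g)) (suc i)) (cong (ℚ._+ coeff (f *ₚ g) i) (coeff-scale a g (suc i)))

-- Arbitrary series stand in for the cleared lists, so that the induction on f can pass to `tail` α.
ι-⊗ : ∀ f g (α β : Series) d e → (∀ i → ι d ℚ.* coeff f i ≡ ι (α i)) → (∀ i → ι e ℚ.* coeff g i ≡ ι (β i)) →
  ∀ i → ι (d ℤ.* e) ℚ.* coeff (f *ₚ g) i ≡ ι ((α ⊗ β) i)
ι-⊗ [] g α β d e hf hg i = trans (ℚ.*-zeroʳ (ι (d ℤ.* e))) (cong ι (sym (0∣⇒≡0 (⊗-∣ α β i λ a b _ → ≡0⇒∣ (trans (cong (ℤ._* β b) (α≡0 a)) (ℤ.*-zeroˡ (β b)))))))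
  where α≡0 : ∀ a → α a ≡ 0ℤ
        α≡0 a = ι-injective (trans (sym (hf a)) (ℚ.*-zeroʳ (ι d)))
ι-⊗ (a ∷ f) g α β d e hf hg = go
  where
  term : ∀ i → ι (d ℤ.* e) ℚ.* (a ℚ.* coeff g i) ≡ ι (α 0 ℤ.* β i)
  term i = begin
    ι (d ℤ.* e) ℚ.* (a ℚ.* coeff g i) ≡⟨ cong (ℚ._* (a ℚ.* coeff g i)) (ι-* d e) ⟩
    ι d ℚ.* ι e ℚ.* (a ℚ.* coeff g i) ≡⟨ interchange (CommutativeMonoid.commutativeSemigroup ℚ.*-1-commutativeMonoid) (ι d) (ι e) a (coeff g i) ⟩
    (ι d ℚ.* a) ℚ.* (ι e ℚ.* coeff g i) ≡⟨ cong₂ ℚ._*_ (hf 0) (hg i) ⟩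
    ι (α 0) ℚ.* ι (β i) ≡⟨ ι-* (α 0) (β i) ⟨
    ι (α 0 ℤ.* β i) ∎
    where open ≡-Reasoning
  go : ∀ i → ι (d ℤ.* e) ℚ.* coeff ((a ∷ f) *ₚ g) i ≡ ι ((α ⊗ β) i)
  go zero = trans (cong (ι (d ℤ.* e) ℚ.*_) (coeff-*-zero a f g)) (term 0)
  go (suc i) = begin
    ι (d ℤ.* e) ℚ.* coeff ((a ∷ f) *ₚ g) (suc i) ≡⟨ cong (ι (d ℤ.* e) ℚ.*_) (coeff-*-suc a f g i) ⟩
    ι (d ℤ.* e) ℚ.* (a ℚ.* coeff g (suc i) ℚ.+ coeff (f *ₚ g) i) ≡⟨ ℚ.*-distribˡ-+ (ι (d ℤ.* e)) _ _ ⟩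
    ι (d ℤ.* e) ℚ.* (a ℚ.* coeff g (suc i)) ℚ.+ ι (d ℤ.* e) ℚ.* coeff (f *ₚ g) i
      ≡⟨ cong₂ ℚ._+_ (term (suc i)) (ι-⊗ f g (tail α) β d e (hf ∘ suc) hg i) ⟩
    ι (α 0 ℤ.* β (suc i)) ℚ.+ ι ((tail α ⊗ β) i) ≡⟨ ι-+ (α 0 ℤ.* β (suc i)) _ ⟨
    ι ((α ⊗ β) (suc i)) ∎
    where open ≡-Reasoning

coeff-zero-* : ∀ f g → (∀ i → coeff f i ≡ 0ℚ) → ∀ i → coeff (f *ₚ g) i ≡ 0ℚ
coeff-zero-* [] g h i = refl
coeff-zero-* (a ∷ f) g h zero = trans (coeff-*-zero a f g) (trans (cong (ℚ._* coeff g 0) (h 0)) (ℚ.*-zeroˡ (coeff g 0)))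
coeff-zero-* (a ∷ f) g h (suc i) = trans (coeff-*-suc a f g i)
  (cong₂ ℚ._+_ (trans (cong (ℚ._* coeff g (suc i)) (h 0)) (ℚ.*-zeroˡ (coeff g (suc i)))) (coeff-zero-* f g (h ∘ suc) i))

constant-isUnit : ∀ f → coeff f 0 ≢ 0ℚ → (∀ i → coeff f (suc i) ≡ 0ℚ) → IsUnit f
constant-isUnit [] f≢0 _ = ⊥-elim (f≢0 refl)
constant-isUnit (a ∷ f) a≢0 h = a⁻¹ ∷ [] , inverse
  where
  instance a-nonZero = ℚ.≢-nonZero a≢0
  a⁻¹ = ℚ.1/ a
  inverse : (a ∷ f) *ₚ (a⁻¹ ∷ []) ≈ₚ oneₚ
  inverse zero = trans (coeff-*-zero a f (a⁻¹ ∷ [])) (ℚ.*-inverseʳ a)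
  inverse (suc i) = trans (coeff-*-suc a f (a⁻¹ ∷ []) i) (cong₂ ℚ._+_ (ℚ.*-zeroʳ a) (coeff-zero-* f (a⁻¹ ∷ []) h i))

ι*≡0 : ∀ {d x} → d ≢ 0ℤ → ι d ℚ.* x ≡ 0ℚ → x ≡ 0ℚ
ι*≡0 {d} {x} d≢0 eq = trans (sym (ℚ.*-identityˡ x)) (trans (cong (ℚ._* x) (sym (ℚ.*-inverseˡ (ι d))))
  (trans (ℚ.*-assoc (ℚ.1/ ι d) (ι d) x) (trans (cong (ℚ.1/ ι d ℚ.*_) eq) (ℚ.*-zeroʳ (ℚ.1/ ι d)))))
  where instance ιd-nonZero = ℚ.≢-nonZero {ι d} (λ eq → d≢0 (ι-injective eq))

above-length : ∀ A i → length A ℕ.< i → ⟦ A ⟧ i ≡ 0ℤ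
above-length [] i _ = refl
above-length (a ∷ A) (suc i) (s≤s lt) = above-length A i lt

-- Degrees of factors and a criterion for irreducibility

degree : ∀ A → (∀ i → ⟦ A ⟧ i ≡ 0ℤ) ⊎ ∃ λ k → ⟦ A ⟧ k ≢ 0ℤ × (∀ i → k ℕ.< i → ⟦ A ⟧ i ≡ 0ℤ)
degree A with highest 0ℤ ⟦ A ⟧ (length A) (λ i lt → ≡0⇒∣ (above-length A i lt))
... | inj₁ all = inj₁ (0∣⇒≡0 ∘ all)
... | inj₂ (k , _ , ¬d , high) = inj₂ (k , ¬d ∘ ≡0⇒∣ , λ i lt → 0∣⇒≡0 (high i lt))

HasDegree : Series → ℕ → Set
HasDegree φ N = φ N ≢ 0ℤ × (∀ i → N ℕ.< i → φ i ≡ 0ℤ)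

record Split (f g : Poly) (φ : Series) (N : ℕ) : Set where
  field
    k l : ℕ
    k+l≡N : k ℕ.+ l ≡ N
    F : Factorisation φ k l
    f-const : k ≡ 0 → IsUnit f
    g-const : l ≡ 0 → IsUnit g
    f-deg : ∀ i → k ℕ.< i → coeff f i ≡ 0ℚ

split : ∀ f g φ N → HasDegree φ N → (∀ i → coeff (f *ₚ g) i ≡ ι (φ i)) → Split f g φ N
split f g φ N (φN≢0 , φ-above) fg≡φ with clear f | clear g
... | cleared A d d≢0 hA | cleared B e e≢0 hB = go (degree A) (degree B)
  where
  AB≡ : ∀ i → (⟦ A ⟧ ⊗ ⟦ B ⟧) i ≡ d ℤ.* e ℤ.* φ i
  AB≡ i = ι-injective (trans (sym (ι-⊗ f g ⟦ A ⟧ ⟦ B ⟧ d e hA hB i)) (trans (cong (ι (d ℤ.* e) ℚ.*_) (fg≡φ i)) (sym (ι-* (d ℤ.* e) (φ i)))))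
  de≢0 = ≢0-* d≢0 e≢0
  ABN≢0 : (⟦ A ⟧ ⊗ ⟦ B ⟧) N ≢ 0ℤ
  ABN≢0 eq = ≢0-* de≢0 φN≢0 (trans (sym (AB≡ N)) eq)
  constant : ∀ {h C x k} → x ≢ 0ℤ → (∀ i → ι x ℚ.* coeff h i ≡ ι (⟦ C ⟧ i)) → ⟦ C ⟧ k ≢ 0ℤ → (∀ i → k ℕ.< i → ⟦ C ⟧ i ≡ 0ℤ) → k ≡ 0 → IsUnit h
  constant {h} {C} {x} x≢0 hC Ck≢0 above refl = constant-isUnit h
    (λ eq → Ck≢0 (ι-injective (trans (sym (hC 0)) (trans (cong (ι x ℚ.*_) eq) (ℚ.*-zeroʳ (ι x))))))
    (λ i → ι*≡0 x≢0 (trans (hC (suc i)) (cong ι (above (suc i) (s≤s z≤n)))))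
  go : ((∀ i → ⟦ A ⟧ i ≡ 0ℤ) ⊎ ∃ λ k → ⟦ A ⟧ k ≢ 0ℤ × (∀ i → k ℕ.< i → ⟦ A ⟧ i ≡ 0ℤ)) →
       ((∀ i → ⟦ B ⟧ i ≡ 0ℤ) ⊎ ∃ λ l → ⟦ B ⟧ l ≢ 0ℤ × (∀ i → l ℕ.< i → ⟦ B ⟧ i ≡ 0ℤ)) → Split f g φ N
  go (inj₁ A≡0) _ = ⊥-elim (ABN≢0 (0∣⇒≡0 (⊗-∣ ⟦ A ⟧ ⟦ B ⟧ N λ a b _ → ≡0⇒∣ (trans (cong (ℤ._* ⟦ B ⟧ b) (A≡0 a)) (ℤ.*-zeroˡ (⟦ B ⟧ b))))))
  go (inj₂ _) (inj₁ B≡0) = ⊥-elim (ABN≢0 (0∣⇒≡0 (⊗-∣ ⟦ A ⟧ ⟦ B ⟧ N λ a b _ → ≡0⇒∣ (trans (cong (⟦ A ⟧ a ℤ.*_) (B≡0 b)) (ℤ.*-zeroʳ (⟦ A ⟧ a))))))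
  go (inj₂ (k , Ak≢0 , A-deg)) (inj₂ (l , Bl≢0 , B-deg)) = record
    { k = k ; l = l ; k+l≡N = ℕ.≤-antisym k+l≤N N≤k+l
    ; F = record { A = A ; B = B ; c = d ℤ.* e ; c≢0 = de≢0 ; AB≡cφ = AB≡ ; A-deg = A-deg ; B-deg = B-deg }
    ; f-const = constant {f} {A} d≢0 hA Ak≢0 A-deg ; g-const = constant {g} {B} e≢0 hB Bl≢0 B-deg
    ; f-deg = λ i lt → ι*≡0 d≢0 (trans (hA i) (cong ι (A-deg i lt))) }
    where
    k+l≤N : k ℕ.+ l ℕ.≤ N
    k+l≤N = ℕ.≮⇒≥ λ lt → ≢0-* Ak≢0 Bl≢0 (trans (sym (ℤ.i-j≡0⇒i≡j _ _ (0∣⇒≡0 (⊗-high ⟦ A ⟧ ⟦ B ⟧ k l (λ i q → ≡0⇒∣ (A-deg i q)) (λ i q → ≡0⇒∣ (B-deg i q))))))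
      (trans (AB≡ (k ℕ.+ l)) (trans (cong (d ℤ.* e ℤ.*_) (φ-above _ lt)) (ℤ.*-zeroʳ (d ℤ.* e)))))
    N≤k+l : N ℕ.≤ k ℕ.+ l
    N≤k+l = ℕ.≮⇒≥ λ lt → ABN≢0 (0∣⇒≡0 (⊗-beyond ⟦ A ⟧ ⟦ B ⟧ (suc k) (suc l) (λ i q → ≡0⇒∣ (A-deg i q)) (λ i q → ≡0⇒∣ (B-deg i q)) N
      (s≤s (ℕ.≤-trans (ℕ.≤-reflexive (ℕ.+-suc k l)) lt))))

irreducible-by-degree : ∀ f φ N → (∀ i → coeff f i ≡ ι (φ i)) → HasDegree φ N → 0 ℕ.< N →
  (∀ k l → 0 ℕ.< k → 0 ℕ.< l → k ℕ.+ l ≡ N → ¬ Factorisation φ k l) → Irreducible f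
irreducible-by-degree f φ N f≡φ φ-deg@(φN≢0 , _) 0<N no-factor = nonUnit , factors
  where
  nonUnit : ¬ IsUnit f
  -- A unit is a factor of the constant 1, so `split` with degree 0 makes its coefficient at N > 0
  -- vanish.
  nonUnit (g , fg≈1) = φN≢0 (ι-injective (trans (sym (f≡φ N)) (f-deg N (subst (ℕ._< N) (sym (ℕ.m+n≡0⇒m≡0 k k+l≡N)) 0<N))))
    where
    one≡ : ∀ i → coeff oneₚ i ≡ ι (const 1ℤ i)
    one≡ zero = refl
    one≡ (suc i) = refl
    splitting : Split f g (const 1ℤ) 0
    splitting = split f g (const 1ℤ) 0 ((λ ()) , λ { (suc i) _ → refl }) (λ i → trans (fg≈1 i) (one≡ i))
    open Split splitting
  factors : ∀ g h → f ≈ₚ g *ₚ h → IsUnit g ⊎ IsUnit h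
  factors g h f≈gh with split g h φ N φ-deg (λ i → trans (sym (f≈gh i)) (f≡φ i))
  ... | record { k = zero ; f-const = u } = inj₁ (u refl)
  ... | record { k = suc k ; l = zero ; g-const = u } = inj₂ (u refl)
  ... | record { k = suc k ; l = suc l ; k+l≡N = eq ; F = F } = ⊥-elim (no-factor (suc k) (suc l) (s≤s z≤n) (s≤s z≤n) eq F)

onePlusZ-irreducible : Irreducible onePlusZ
onePlusZ-irreducible = irreducible-by-degree onePlusZ ⟦ 1ℤ ∷ 1ℤ ∷ [] ⟧ 1 coeffs ((λ ()) , above) (s≤s z≤n) no-split
  where
  coeffs : ∀ i → coeff onePlusZ i ≡ ι (⟦ 1ℤ ∷ 1ℤ ∷ [] ⟧ i)
  coeffs zero = refl
  coeffs (suc zero) = refl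
  coeffs (suc (suc i)) = refl
  above : ∀ i → 1 ℕ.< i → ⟦ 1ℤ ∷ 1ℤ ∷ [] ⟧ i ≡ 0ℤ
  above (suc (suc i)) _ = refl
  above (suc zero) (s≤s ())
  no-split : ∀ k l → 0 ℕ.< k → 0 ℕ.< l → k ℕ.+ l ≡ 1 → ¬ Factorisation _ k l
  no-split (suc zero) (suc l) _ _ ()
  no-split (suc (suc k)) (suc l) _ _ ()

-- Coefficients of the given polynomials

-- A name for the local function go of fromCoeffs: the type of fromCoeffs-suc determines it by unification.
mutual
  fromCoeffs-go : ℕ → (ℕ → ℚ) → ℕ → ℕ → Poly
  fromCoeffs-go = _

  fromCoeffs-suc : ∀ d c → fromCoeffs (suc d) c ≡ c 0 ∷ c 1 ∷ fromCoeffs-go (suc d) c d 2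
  -- After this abstraction the unknown function is applied to the distinct variables `w`, `c`, `d`,
  -- `v`, a pattern that determines it.
  fromCoeffs-suc d c with suc d | 2
  ... | w | v = refl

coeff-go : ∀ d c r i k → k < r → coeff (fromCoeffs-go d c r i) k ≡ c (i ℕ.+ k)
coeff-go d c (suc r) i zero _ = cong c (sym (ℕ.+-identityʳ i))
coeff-go d c (suc r) i (suc k) (s≤s lt) = trans (coeff-go d c r (suc i) k lt) (cong c (sym (ℕ.+-suc i k)))

coeff-go-beyond : ∀ d c r i k → r ≤ k → coeff (fromCoeffs-go d c r i) k ≡ 0ℚ
coeff-go-beyond d c zero i k _ = refl
coeff-go-beyond d c (suc r) i (suc k) (s≤s le) = coeff-go-beyond d c r (suc i) k le

coeff-fromCoeffs : ∀ d c k → k ≤ d → coeff (fromCoeffs d c) k ≡ c k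
coeff-fromCoeffs d c k k≤d = coeff-go d c (suc d) 0 k (s≤s k≤d)

coeff-fromCoeffs-beyond : ∀ d c k → d < k → coeff (fromCoeffs d c) k ≡ 0ℚ
coeff-fromCoeffs-beyond d c k = coeff-go-beyond d c (suc d) 0 k

compSq-coeffs : ∀ f Q → (∀ i → coeff f i ≡ ι (⟦ Q ⟧ i)) → ∀ i → coeff (compSq f) i ≡ ι (⟦ compSqᶻ Q ⟧ i)
compSq-coeffs [] [] h i = refl
compSq-coeffs [] (b ∷ Q) h zero = h 0
compSq-coeffs [] (b ∷ Q) h (suc zero) = refl
compSq-coeffs [] (b ∷ Q) h (suc (suc i)) = compSq-coeffs [] Q (h ∘ suc) i
compSq-coeffs (a ∷ f) [] h zero = h 0
compSq-coeffs (a ∷ f) [] h (suc zero) = refl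
compSq-coeffs (a ∷ f) [] h (suc (suc i)) = compSq-coeffs f [] (h ∘ suc) i
compSq-coeffs (a ∷ f) (b ∷ Q) h zero = h 0
compSq-coeffs (a ∷ f) (b ∷ Q) h (suc zero) = refl
compSq-coeffs (a ∷ f) (b ∷ Q) h (suc (suc i)) = compSq-coeffs f Q (h ∘ suc) i

compSq-even : ∀ Q i → ⟦ compSqᶻ Q ⟧ (i ℕ.+ i) ≡ ⟦ Q ⟧ i
compSq-even [] i = refl
compSq-even (a ∷ Q) zero = refl
compSq-even (a ∷ Q) (suc i) = trans (cong (λ t → ⟦ compSqᶻ (a ∷ Q) ⟧ (suc t)) (ℕ.+-suc i i)) (compSq-even Q i)

compSq-odd : ∀ Q i → ⟦ compSqᶻ Q ⟧ (suc (i ℕ.+ i)) ≡ 0ℤ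
compSq-odd [] i = refl
compSq-odd (a ∷ Q) zero = refl
compSq-odd (a ∷ Q) (suc i) = trans (cong (λ t → ⟦ compSqᶻ (a ∷ Q) ⟧ (suc (suc t))) (ℕ.+-suc i i)) (compSq-odd Q i)

double≡*2 : ∀ i → i ℕ.+ i ≡ i ℕ.* 2
double≡*2 i = trans (cong (i ℕ.+_) (sym (ℕ.+-identityʳ i))) (ℕ.*-comm 2 i)

double/2 : ∀ i → (i ℕ.+ i) / 2 ≡ i
double/2 i = trans (cong (_/ 2) (double≡*2 i)) (m*n/n≡m i 2)

suc-double/2 : ∀ i → suc (i ℕ.+ i) / 2 ≡ i
suc-double/2 i = trans (+-distrib-/-∣ʳ 1 (ℕ∣.divides i (double≡*2 i))) (double/2 i)

-- What a prime says about the degrees of the factors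

-- This is (1 + x)^(j+p) ≡ (1 + x)^j (1 + x^p) read below degree p, by Pascal's rule from j = 0.
binom-mod : ∀ {p} → Prime p → ∀ j i → i < p → + p ∣ + binom (j ℕ.+ p) i - + binom j i
binom-mod {p} pp j zero i<p = ≡0⇒∣ refl
binom-mod {p} pp zero (suc i) i<p = ∣-cong (sym (ℤ.+-identityʳ (+ binom p (suc i))))
  (∣ᵤ⇒∣ (subst (λ t → p ℕ∣.∣ binom t (suc i)) (ℕ.m+[n∸m]≡n (ℕ.<⇒≤ i<p))
    (∣binom pp (suc i) (p ∸ suc i) i<p (ℕ.∸-monoʳ-< {o = 0} (s≤s z≤n) (ℕ.<⇒≤ i<p)) (ℕ.≤-reflexive (sym (ℕ.m+[n∸m]≡n (ℕ.<⇒≤ i<p)))))))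
binom-mod {p} pp (suc j) (suc i) i<p = ∣-cong (s (+ binom (j ℕ.+ p) i) (+ binom (j ℕ.+ p) (suc i)) (+ binom j i) (+ binom j (suc i)))
  (∣m∣n⇒∣m+n (binom-mod pp j i (ℕ.<-trans (ℕ.n<1+n i) i<p)) (binom-mod pp j (suc i) i<p))
  where s : ∀ a b c d → (a - c) ℤ.+ (b - d) ≡ (a ℤ.+ b) - (c ℤ.+ d)
        s = solve-∀

Meets : ℕ → ℕ → ℕ → Set
Meets k l j = (k ≡ j ⊎ k ≡ j ℕ.+ j) ⊎ (l ≡ j ⊎ l ≡ j ℕ.+ j)

meets? : ∀ k l j → Dec (Meets k l j)
meets? k l j = (k ℕ.≟ j ⊎-dec k ℕ.≟ j ℕ.+ j) ⊎-dec (l ℕ.≟ j ⊎-dec l ℕ.≟ j ℕ.+ j)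

∤-ℕ : ∀ {p x} → ¬ (p ℕ.* p) ℕ∣.∣ x → ¬ + p * + p ∣ + x
∤-ℕ {p} {x} ¬d d = ¬d (subst (ℕ∣._∣ x) (ℤ.abs-* (+ p) (+ p)) (∣⇒∣ᵤ d))

-- q_n for n = 2 m + 1
Qᶻ : ℕ → Polyᶻ
Qᶻ m = tabulateᶻ (suc m) (λ i → + binom (suc (m ℕ.+ m)) i)

Qᶻ-at : ∀ m i → i ≤ m → ⟦ Qᶻ m ⟧ i ≡ + binom (suc (m ℕ.+ m)) i
Qᶻ-at m i i≤m = ⟦tabulate⟧ (suc m) (λ i → + binom (suc (m ℕ.+ m)) i) i (s≤s i≤m)

Qᶻ-beyond : ∀ m i → m < i → ⟦ Qᶻ m ⟧ i ≡ 0ℤ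
Qᶻ-beyond m i m<i = ⟦tabulate⟧-beyond (suc m) (λ i → + binom (suc (m ℕ.+ m)) i) i m<i

φ : ℕ → Series
φ m = ⟦ compSqᶻ (Qᶻ m) ⟧

φ-degree : ∀ m → HasDegree (φ m) (m ℕ.+ m)
φ-degree m = (λ eq → ℕ.<⇒≢ (binom-pos (ℕ.m≤n⇒m≤1+n (ℕ.m≤m+n m m))) (sym (ℤ.+-injective (trans (sym (φ-top m)) eq)))) , above
  where
  φ-top : ∀ m → φ m (m ℕ.+ m) ≡ + mid m
  φ-top m = trans (compSq-even (Qᶻ m) m) (Qᶻ-at m m ℕ.≤-refl)
  above : ∀ i → m ℕ.+ m < i → φ m i ≡ 0ℤ
  above i lt with halve i
  ... | inj₁ (h , refl) = trans (compSq-even (Qᶻ m) h) (Qᶻ-beyond m h (ℕ.≰⇒> λ h≤m → ℕ.<⇒≱ lt (ℕ.+-mono-≤ h≤m h≤m)))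
  ... | inj₂ (h , refl) = compSq-odd (Qᶻ m) h

module _ (m k l : ℕ) (0<k : 0 < k) (0<l : 0 < l) (k+l≡ : k ℕ.+ l ≡ m ℕ.+ m) (F : Factorisation (φ m) k l) where

  -- The condition on the leading coefficient stays inside the conclusion because the prime 3
  -- violates it at n = 15, where 9 divides C(15, 7) = 6435; the bounds s ≤ k and t ≤ l still hold
  -- there.
  localised-degrees : ∀ {p} → Prime p → ∀ j → j ≤ m → (∀ i → i ≤ m → + p ∣ + binom (suc (m ℕ.+ m)) i - + binom j i) →
    ¬ + p * + p ∣ + binom (m ℕ.+ m) m → (F′ : Factorisation (φ m) k l) → ¬ + p ∣ Factorisation.c F′ →
    ∃₂ λ s t → s ℕ.+ t ≡ j ℕ.+ j × s ≤ k × t ≤ l × (s ≡ 0 ⊎ s ≡ j ⊎ t ≡ 0) × (¬ + p * + p ∣ + mid m → s ≡ k ⊎ t ≡ l)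
  localised-degrees {p} pp j j≤m cong-p ¬p² F′ p∤c =
    let s , t , s+t , s≤k , t≤l , tri , hs , ht = local-degrees pp {Qᶻ m} j F′ p∤c Q≡ Q-1
    in s , t , s+t , s≤k , t≤l , tri , top hs ht
    where
    open Factorisation F′
    Q≡ : ∀ i → + p ∣ ⟦ Qᶻ m ⟧ i - + binom j i
    Q≡ i with i ℕ.≤? m
    ... | yes i≤m = ∣-cong (cong (_- + binom j i) (sym (Qᶻ-at m i i≤m))) (cong-p i i≤m)
    ... | no i≰m = ≡0⇒∣ (cong₂ _-_ (Qᶻ-beyond m i (ℕ.≰⇒> i≰m)) (cong +_ (binom-zero (ℕ.≤-<-trans j≤m (ℕ.≰⇒> i≰m)))))
    Q-1 : ¬ + p * + p ∣ T (Qᶻ m) 0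
    Q-1 d = ¬p² (∣[-1]^* m (+ binom (m ℕ.+ m) m) (∣-cong (alternating-sum (m ℕ.+ m) m) d))
    AkBl : ⟦ A ⟧ k * ⟦ B ⟧ l ≡ c * + mid m
    AkBl = trans (sym (ℤ.i-j≡0⇒i≡j ((⟦ A ⟧ ⊗ ⟦ B ⟧) (k ℕ.+ l)) (⟦ A ⟧ k * ⟦ B ⟧ l) (0∣⇒≡0 (⊗-high ⟦ A ⟧ ⟦ B ⟧ k l (λ i q → ≡0⇒∣ (A-deg i q)) (λ i q → ≡0⇒∣ (B-deg i q))))))
      (trans (AB≡cφ (k ℕ.+ l)) (cong (c *_) (trans (cong (φ m) k+l≡) (trans (compSq-even (Qᶻ m) m) (Qᶻ-at m m ℕ.≤-refl)))))
    top : ∀ {s t} → (¬ + p ∣ ⟦ A ⟧ k → s ≡ k) → (¬ + p ∣ ⟦ B ⟧ l → t ≡ l) → ¬ + p * + p ∣ + mid m → s ≡ k ⊎ t ≡ l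
    top hs ht ¬lead with + p ∣? ⟦ A ⟧ k | + p ∣? ⟦ B ⟧ l
    ... | no ¬A | _ = inj₁ (hs ¬A)
    ... | yes _ | no ¬B = inj₂ (ht ¬B)
    ... | yes dA | yes dB = ⊥-elim (¬lead (p²∣*⇒p²∣ pp c (+ mid m) p∤c (∣-cong AkBl (∣-*-mono dA dB))))

  degrees-at : ∀ {p} → Prime p → ∀ j → j ≤ m → (∀ i → i ≤ m → + p ∣ + binom (suc (m ℕ.+ m)) i - + binom j i) →
    ¬ + p * + p ∣ + binom (m ℕ.+ m) m →
    ∃₂ λ s t → s ℕ.+ t ≡ j ℕ.+ j × s ≤ k × t ≤ l × (s ≡ 0 ⊎ s ≡ j ⊎ t ≡ 0) × (¬ + p * + p ∣ + mid m → s ≡ k ⊎ t ≡ l)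
  degrees-at pp j j≤m cong-p ¬p² = let F′ , p∤c = localise pp F in localised-degrees pp j j≤m cong-p ¬p² F′ p∤c

  meets-from : ∀ {j s t} → s ℕ.+ t ≡ j ℕ.+ j → s ≡ 0 ⊎ s ≡ j ⊎ t ≡ 0 → s ≡ k ⊎ t ≡ l → Meets k l j
  meets-from s+t (inj₁ s≡0) (inj₁ refl) = ⊥-elim (ℕ.<⇒≢ 0<k (sym s≡0))
  meets-from s+t (inj₂ (inj₁ s≡j)) (inj₁ refl) = inj₁ (inj₁ s≡j)
  meets-from s+t (inj₂ (inj₂ refl)) (inj₁ refl) = inj₁ (inj₂ (trans (sym (ℕ.+-identityʳ k)) s+t))
  meets-from s+t (inj₁ refl) (inj₂ refl) = inj₂ (inj₂ s+t)
  meets-from {j} s+t (inj₂ (inj₁ refl)) (inj₂ refl) = inj₂ (inj₁ (ℕ.+-cancelˡ-≡ j l j s+t))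
  meets-from s+t (inj₂ (inj₂ t≡0)) (inj₂ refl) = ⊥-elim (ℕ.<⇒≢ 0<l (sym t≡0))

  meets-at : ∀ {p} → Prime p → ∀ j → j ≤ m → (∀ i → i ≤ m → + p ∣ + binom (suc (m ℕ.+ m)) i - + binom j i) →
    ¬ + p * + p ∣ + binom (m ℕ.+ m) m → ¬ + p * + p ∣ + mid m → Meets k l j
  meets-at pp j j≤m cong-p ¬p² ¬lead =
    let s , t , s+t , _ , _ , tri , top = degrees-at pp j j≤m cong-p ¬p² in meets-from s+t tri (top ¬lead)

  m>0 : 0 < m
  m>0 = ℕ.n≢0⇒n>0 λ { refl → ℕ.<⇒≢ 0<k (sym (ℕ.m+n≡0⇒m≡0 k k+l≡)) }

  -- A prime power dividing C(N, i) is at most N, while p² ≥ (m + 1)² > 2m + 1 since m > 0. So p²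
  -- divides neither of the two binomial coefficients concerned.
  meets-prime : ∀ {p} → Prime p → m < p → ∀ j → j ℕ.+ p ≡ suc (m ℕ.+ m) → Meets k l j
  meets-prime {p} pp m<p j j+p≡ = meets-at pp j j≤m
    (λ i i≤m → subst (λ n → + p ∣ + binom n i - + binom j i) j+p≡ (binom-mod pp j i (ℕ.≤-<-trans i≤m m<p)))
    (∤-ℕ {p} (p²∤ (m ℕ.+ m) m (ℕ.m≤m+n m m) (ℕ.n≤1+n _))) (∤-ℕ {p} (p²∤ (suc (m ℕ.+ m)) m (ℕ.m≤n⇒m≤1+n (ℕ.m≤m+n m m)) ℕ.≤-refl))
    where
    j≤m : j ≤ m
    j≤m = ℕ.+-cancelʳ-≤ (suc m) j m (subst (j ℕ.+ suc m ≤_) (trans j+p≡ (sym (ℕ.+-suc m m))) (ℕ.+-monoʳ-≤ j m<p))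
    p²∤ : ∀ N i → i ≤ N → N ≤ suc (m ℕ.+ m) → ¬ (p ℕ.* p) ℕ∣.∣ binom N i
    p²∤ N i i≤N N≤ d = ℕ.<⇒≱ lt (ℕ.≤-trans (ℕ.≤-trans (ℕ.*-mono-≤ m<p m<p) (subst (_≤ N) (cong (p ℕ.*_) (ℕ.*-identityʳ p))
        (p^e∣binom⇒p^e≤n pp 1 N i i≤N (subst (ℕ∣._∣ binom N i) (cong (p ℕ.*_) (sym (ℕ.*-identityʳ p))) d)))) N≤)
      where
      lt : suc (m ℕ.+ m) < suc m ℕ.* suc m
      lt = s≤s (ℕ.+-monoʳ-< m (subst (m <_) (ℕ.*-comm (suc m) m) (ℕ.m<m+n m (ℕ.*-mono-< {0} {m} {0} {m} m>0 m>0))))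

  exceptions : k ≤ l → ThreeExceptions m (suc (m ℕ.+ m) ∸ k) (suc (m ℕ.+ m) ∸ ⌊ k /2⌋) (suc (m ℕ.+ m) ∸ ⌊ l /2⌋)
  exceptions k≤l {p} pp m<p p≤ = classify (meets-prime pp m<p j j+p≡)
    where
    j = suc (m ℕ.+ m) ∸ p
    j+p≡ : j ℕ.+ p ≡ suc (m ℕ.+ m)
    j+p≡ = ℕ.m∸n+n≡m p≤
    p≡ : p ≡ suc (m ℕ.+ m) ∸ j
    p≡ = sym (ℕ.m∸[m∸n]≡n p≤)
    j≤m : j ≤ m
    j≤m = ℕ.≤-trans (ℕ.∸-monoʳ-≤ (suc (m ℕ.+ m)) m<p) (ℕ.≤-reflexive (ℕ.m+n∸m≡n m m))
    classify : Meets k l j → _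
    classify (inj₁ (inj₁ eq)) = inj₁ (trans p≡ (cong (suc (m ℕ.+ m) ∸_) (sym eq)))
    classify (inj₁ (inj₂ eq)) = inj₂ (inj₁ (trans p≡ (cong (suc (m ℕ.+ m) ∸_) (trans (ℕ.n≡⌊n+n/2⌋ j) (cong ⌊_/2⌋ (sym eq))))))
    classify (inj₂ (inj₂ eq)) = inj₂ (inj₂ (trans p≡ (cong (suc (m ℕ.+ m) ∸_) (trans (ℕ.n≡⌊n+n/2⌋ j) (cong ⌊_/2⌋ (sym eq))))))
    -- The case l = j needs no fourth exception: j ≤ m, k ≤ l and k + l = 2m force k = l = m = j.
    classify (inj₂ (inj₁ eq)) = inj₁ (trans p≡ (cong (suc (m ℕ.+ m) ∸_) (sym k≡j)))
      where
      k≤m : k ≤ m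
      k≤m = ℕ.≤-trans k≤l (subst (_≤ m) (sym eq) j≤m)
      k≡j : k ≡ j
      k≡j = trans (+-bounded k≤m (subst (_≤ m) (sym eq) j≤m) k+l≡) (sym (ℕ.≤-antisym j≤m (ℕ.+-cancelˡ-≤ m m j
              (ℕ.≤-trans (ℕ.≤-reflexive (sym k+l≡)) (ℕ.+-mono-≤ k≤m (ℕ.≤-reflexive eq))))))

-- Exclusion of every factorisation

swap-factorisation : ∀ {ψ k l} → Factorisation ψ k l → Factorisation ψ l k
swap-factorisation F = record
  { A = B ; B = A ; c = c ; c≢0 = c≢0 ; AB≡cφ = λ i → trans (⊗-comm ⟦ B ⟧ ⟦ A ⟧ i) (AB≡cφ i) ; A-deg = B-deg ; B-deg = A-deg }
  where open Factorisation F

NoFactorisation : ℕ → Set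
NoFactorisation m = ∀ k l → 0 < k → 0 < l → k ℕ.+ l ≡ m ℕ.+ m → ¬ Factorisation (φ m) k l

no-exceptions⇒no-factorisation : ∀ m → (∀ x₁ x₂ x₃ → ¬ ThreeExceptions m x₁ x₂ x₃) → NoFactorisation m
no-exceptions⇒no-factorisation m ¬exc k l 0<k 0<l k+l≡ F with ℕ.≤-total k l
... | inj₁ k≤l = ¬exc _ _ _ (exceptions m k l 0<k 0<l k+l≡ F k≤l)
... | inj₂ l≤k = ¬exc _ _ _ (exceptions m l k 0<l 0<k (trans (ℕ.+-comm l k) k+l≡) (swap-factorisation F) l≤k)

prime⇒no-factorisation : ∀ m → 0 < m → Prime (suc (m ℕ.+ m)) → NoFactorisation m
prime⇒no-factorisation m 0<m pp k l 0<k 0<l k+l≡ F = trivial 0<k 0<l (meets-prime m k l 0<k 0<l k+l≡ F pp (s≤s (ℕ.m≤m+n m m)) 0 refl)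
  where
  trivial : ∀ {k l} → 0 < k → 0 < l → ¬ Meets k l 0
  trivial () _ (inj₁ (inj₁ refl))
  trivial () _ (inj₁ (inj₂ refl))
  trivial _ () (inj₂ (inj₁ refl))
  trivial _ () (inj₂ (inj₂ refl))

-- The prime 5 leaves k = l = 4, and 2 excludes it: q_9 ≡ 1 + x modulo 2.
no-factorisation-4 : NoFactorisation 4
no-factorisation-4 k l 0<k 0<l k+l≡ F = excluded (ℕ.≤-<-trans (ℕ.m≤m+n k l) (ℕ.≤-<-trans (ℕ.≤-reflexive k+l≡) (ℕ.n<1+n 8)))
    0<k 0<l l≡
    (meets-prime 4 k l 0<k 0<l k+l≡ F (from-yes (prime? 5)) (ℕ.n<1+n 4) 4 refl)
    (meets-at 4 k l 0<k 0<l k+l≡ F (from-yes (prime? 2)) 1 (s≤s z≤n) (λ i i≤4 → mod2 (s≤s i≤4))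
      (from-no (+ 2 * + 2 ∣? + binom 8 4)) (from-no (+ 2 * + 2 ∣? + binom 9 4)))
  where
  l≡ : l ≡ 8 ∸ k
  l≡ = trans (sym (ℕ.m+n∸m≡n k l)) (cong (_∸ k) k+l≡)
  mod2 : ∀ {i} → i < 5 → + 2 ∣ + binom 9 i - + binom 1 i
  mod2 = from-yes (ℕ.allUpTo? (λ i → + 2 ∣? + binom 9 i - + binom 1 i) 5)
  excluded : k < 9 → 0 < k → 0 < l → l ≡ 8 ∸ k → Meets k l 4 → Meets k l 1 → ⊥
  excluded k<9 0<k 0<l refl h₁ h₂ =
    from-yes (ℕ.allUpTo? (λ k → ¬? (0 ℕ.<? k ×-dec 0 ℕ.<? (8 ∸ k) ×-dec meets? k (8 ∸ k) 4 ×-dec meets? k (8 ∸ k) 1)) 9) k<9 (0<k , 0<l , h₁ , h₂)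

-- The primes 11 and 13 leave k = 4 and k = 10, and 3 excludes them: q_15 ≡ (1 + x)^6 modulo 3.
no-factorisation-7 : NoFactorisation 7
no-factorisation-7 k l 0<k 0<l k+l≡ F = excluded k<15 l≡
    (meets-prime 7 k l 0<k 0<l k+l≡ F (from-yes (prime? 11)) (s≤s (ℕ.m≤m+n 7 3)) 4 refl)
    (meets-prime 7 k l 0<k 0<l k+l≡ F (from-yes (prime? 13)) (s≤s (ℕ.m≤m+n 7 5)) 2 refl)
    (let s , t , s+t≡ , s≤k , t≤l , tri , _ = degrees-at 7 k l 0<k 0<l k+l≡ F (from-yes (prime? 3)) 6 (ℕ.n≤1+n 6)
                                                  (λ i i≤7 → mod3 (s≤s i≤7)) (from-no (+ 3 * + 3 ∣? + binom 14 7))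
     in wide s+t≡ s≤k t≤l tri)
  where
  mod3 : ∀ {i} → i < 8 → + 3 ∣ + binom 15 i - + binom 6 i
  mod3 = from-yes (ℕ.allUpTo? (λ i → + 3 ∣? + binom 15 i - + binom 6 i) 8)
  k<15 : k < 15
  k<15 = ℕ.≤-<-trans (ℕ.m≤m+n k l) (ℕ.≤-<-trans (ℕ.≤-reflexive k+l≡) (ℕ.n<1+n 14))
  l≡ : l ≡ 14 ∸ k
  l≡ = trans (sym (ℕ.m+n∸m≡n k l)) (cong (_∸ k) k+l≡)
  wide : ∀ {s t} → s ℕ.+ t ≡ 12 → s ≤ k → t ≤ l → s ≡ 0 ⊎ s ≡ 6 ⊎ t ≡ 0 → 12 ≤ l ⊎ (6 ≤ k × 6 ≤ l) ⊎ 12 ≤ k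
  wide s+t≡ s≤k t≤l (inj₁ refl) = inj₁ (subst (_≤ l) s+t≡ t≤l)
  wide {t = t} s+t≡ s≤k t≤l (inj₂ (inj₁ refl)) = inj₂ (inj₁ (s≤k , subst (_≤ l) (ℕ.+-cancelˡ-≡ 6 t 6 s+t≡) t≤l))
  wide {s} s+t≡ s≤k t≤l (inj₂ (inj₂ refl)) = inj₂ (inj₂ (subst (_≤ k) (trans (sym (ℕ.+-identityʳ s)) s+t≡) s≤k))
  excluded : k < 15 → l ≡ 14 ∸ k → Meets k l 4 → Meets k l 2 → 12 ≤ l ⊎ (6 ≤ k × 6 ≤ l) ⊎ 12 ≤ k → ⊥
  excluded k<15 refl h₁ h₂ h₃ = from-yes (ℕ.allUpTo? (λ k → ¬? (meets? k (14 ∸ k) 4 ×-dec meets? k (14 ∸ k) 2 ×-dec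
    (12 ℕ.≤? 14 ∸ k ⊎-dec (6 ℕ.≤? k ×-dec 6 ℕ.≤? 14 ∸ k) ⊎-dec 12 ℕ.≤? k) ×-dec 0 ℕ.<? k ×-dec 0 ℕ.<? 14 ∸ k)) 15) k<15 (h₁ , h₂ , h₃ , 0<k , 0<l)

-- Three primes are too few for counting, but here their values suffice: j = 10 and j = 8 leave k =
-- 10 or k = 16, and j = 4 excludes both.
no-factorisation-13 : NoFactorisation 13
no-factorisation-13 k l 0<k 0<l k+l≡ F = excluded k<27 l≡
    (meets-prime 13 k l 0<k 0<l k+l≡ F (from-yes (prime? 17)) (s≤s (ℕ.m≤m+n 13 3)) 10 refl)
    (meets-prime 13 k l 0<k 0<l k+l≡ F (from-yes (prime? 19)) (s≤s (ℕ.m≤m+n 13 5)) 8 refl)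
    (meets-prime 13 k l 0<k 0<l k+l≡ F (from-yes (prime? 23)) (s≤s (ℕ.m≤m+n 13 9)) 4 refl)
  where
  k<27 : k < 27
  k<27 = ℕ.≤-<-trans (ℕ.m≤m+n k l) (ℕ.≤-<-trans (ℕ.≤-reflexive k+l≡) (ℕ.n<1+n 26))
  l≡ : l ≡ 26 ∸ k
  l≡ = trans (sym (ℕ.m+n∸m≡n k l)) (cong (_∸ k) k+l≡)
  excluded : k < 27 → l ≡ 26 ∸ k → Meets k l 10 → Meets k l 8 → Meets k l 4 → ⊥
  excluded k<27 refl h₁ h₂ h₃ = from-yes (ℕ.allUpTo? (λ k → ¬? (meets? k (26 ∸ k) 10 ×-dec meets? k (26 ∸ k) 8 ×-dec
    meets? k (26 ∸ k) 4)) 27) k<27 (h₁ , h₂ , h₃)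

-- Below 14, n is prime for m = 1, 2, 3, 5, 6, 8, and (m, n] already holds four primes for m = 9 to
-- 12. This leaves n = 9, 15 and 27.
no-factorisation : ∀ m → 0 < m → NoFactorisation m
no-factorisation 1 0<m = prime⇒no-factorisation 1 0<m (from-yes (prime? 3))
no-factorisation 2 0<m = prime⇒no-factorisation 2 0<m (from-yes (prime? 5))
no-factorisation 3 0<m = prime⇒no-factorisation 3 0<m (from-yes (prime? 7))
no-factorisation 4 _ = no-factorisation-4
no-factorisation 5 0<m = prime⇒no-factorisation 5 0<m (from-yes (prime? 11))
no-factorisation 6 0<m = prime⇒no-factorisation 6 0<m (from-yes (prime? 13))
no-factorisation 7 _ = no-factorisation-7
no-factorisation 8 0<m = prime⇒no-factorisation 8 0<m (from-yes (prime? 17))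
no-factorisation 9 _ = no-exceptions⇒no-factorisation 9 (cluster-excludes 9 10 11 13 17 19 tt 9 ℕ.≤-refl (ℕ.n≤1+n 9))
no-factorisation 10 _ = no-exceptions⇒no-factorisation 10 (cluster-excludes 9 10 11 13 17 19 tt 10 (ℕ.n≤1+n 9) ℕ.≤-refl)
no-factorisation 11 _ = no-exceptions⇒no-factorisation 11 (cluster-excludes 11 12 13 17 19 23 tt 11 ℕ.≤-refl (ℕ.n≤1+n 11))
no-factorisation 12 _ = no-exceptions⇒no-factorisation 12 (cluster-excludes 11 12 13 17 19 23 tt 12 (ℕ.n≤1+n 11) ℕ.≤-refl)
no-factorisation 13 _ = no-factorisation-13
no-factorisation (suc (suc (suc (suc (suc (suc (suc (suc (suc (suc (suc (suc (suc (suc r)))))))))))))) _ =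
  no-exceptions⇒no-factorisation _ (¬ThreeExceptions _ (ℕ.m≤m+n 14 r))

-- The identity for P_n and the resulting factorisation

Q-coeff P-coeff : ℕ → ℕ → ℚ
Q-coeff n k = ℕ→ℚ (n C k)
P-coeff n j = ℕ→ℚ (𝓑 n (n ∸ j))

q-coeffs : ∀ m i → coeff (q (suc (m ℕ.+ m))) i ≡ ι (⟦ Qᶻ m ⟧ i)
q-coeffs m i with i ℕ.≤? m
... | yes i≤m = trans (coeff-fromCoeffs (suc (m ℕ.+ m) / 2) (Q-coeff (suc (m ℕ.+ m))) i (subst (i ≤_) (sym (suc-double/2 m)) i≤m))
  (cong ι (trans (cong +_ (C≡binom (suc (m ℕ.+ m)) i)) (sym (Qᶻ-at m i i≤m))))
... | no i≰m = trans (coeff-fromCoeffs-beyond (suc (m ℕ.+ m) / 2) (Q-coeff (suc (m ℕ.+ m))) i (subst (_< i) (sym (suc-double/2 m)) (ℕ.≰⇒> i≰m)))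
  (cong ι (sym (Qᶻ-beyond m i (ℕ.≰⇒> i≰m))))

module _ (m : ℕ) where
  private
    n = suc (m ℕ.+ m)

    E : Poly
    E = compSq (q n)

  E-coeffs : ∀ i → coeff E i ≡ ι (φ m i)
  E-coeffs = compSq-coeffs (q n) (Qᶻ m) (q-coeffs m)

  -- The integer coefficients of (1 + z) q_n(z²), of which the top one, at z^n, comes from the
  -- factor z.
  ρ : ℕ → ℤ
  ρ zero    = φ m zero
  ρ (suc i) = φ m (suc i) ℤ.+ φ m i

  product-coeffs : ∀ i → coeff (onePlusZ *ₚ E) i ≡ ι (ρ i)
  product-coeffs zero = trans (coeff-*-zero 1ℚ (1ℚ ∷ []) E) (trans (ℚ.*-identityˡ (coeff E 0)) (E-coeffs 0))
  product-coeffs (suc i) = trans (coeff-*-suc 1ℚ (1ℚ ∷ []) E i)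
    (trans (cong₂ ℚ._+_ (trans (ℚ.*-identityˡ (coeff E (suc i))) (E-coeffs (suc i))) (trans (1*E i) (E-coeffs i))) (sym (ι-+ (φ m (suc i)) (φ m i))))
    where
    1*E : ∀ i → coeff ((1ℚ ∷ []) *ₚ E) i ≡ coeff E i
    1*E zero = trans (coeff-*-zero 1ℚ [] E) (ℚ.*-identityˡ (coeff E 0))
    1*E (suc i) = trans (coeff-*-suc 1ℚ [] E i) (trans (ℚ.+-identityʳ _) (ℚ.*-identityˡ (coeff E (suc i))))

  ρ-even : ∀ i → ρ (i ℕ.+ i) ≡ ⟦ Qᶻ m ⟧ i
  ρ-even zero = compSq-even (Qᶻ m) 0
  ρ-even (suc i) = trans (cong₂ ℤ._+_ (compSq-even (Qᶻ m) (suc i)) (trans (cong (φ m) (ℕ.+-suc i i)) (compSq-odd (Qᶻ m) i))) (ℤ.+-identityʳ _)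

  ρ-odd : ∀ i → ρ (suc (i ℕ.+ i)) ≡ ⟦ Qᶻ m ⟧ i
  ρ-odd i = trans (cong₂ ℤ._+_ (compSq-odd (Qᶻ m) i) (compSq-even (Qᶻ m) i)) (ℤ.+-identityˡ _)

  -- Of the exponents j and j - 1 only the even one occurs in q_n(z²), and its half is j / 2 rounded
  -- down; this is the origin of the floor in `𝓑`.
  ρ≡Q : ∀ j i → j / 2 ≡ i → ρ j ≡ ⟦ Qᶻ m ⟧ i
  ρ≡Q j i eq with halve j
  ... | inj₁ (h , refl) = trans (ρ-even h) (cong ⟦ Qᶻ m ⟧ (trans (sym (double/2 h)) eq))
  ... | inj₂ (h , refl) = trans (ρ-odd h) (cong ⟦ Qᶻ m ⟧ (trans (sym (suc-double/2 h)) eq))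

  𝓑≡ρ : ∀ j → j ≤ n → + 𝓑 n (n ∸ j) ≡ ρ j
  𝓑≡ρ j j≤n = begin
    + 𝓑 n (n ∸ j)      ≡⟨ cong +_ (C≡binom n ((n ∸ (n ∸ j)) / 2)) ⟩
    + binom n ((n ∸ (n ∸ j)) / 2) ≡⟨ cong (λ t → + binom n (t / 2)) (ℕ.m∸[m∸n]≡n j≤n) ⟩
    + binom n (j / 2)  ≡⟨ Qᶻ-at m (j / 2) (subst (j / 2 ≤_) (suc-double/2 m) (/-monoˡ-≤ 2 j≤n)) ⟨
    ⟦ Qᶻ m ⟧ (j / 2)   ≡⟨ ρ≡Q j (j / 2) refl ⟨
    ρ j                ∎
    where open ≡-Reasoning

  ρ-beyond : ∀ j → n < j → ρ j ≡ 0ℤ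
  ρ-beyond j n<j = trans (ρ≡Q j (j / 2) refl) (Qᶻ-beyond m (j / 2) m<j/2)
    where
    m<j/2 : m < j / 2
    m<j/2 = subst (_≤ j / 2) (double/2 (suc m)) (/-monoˡ-≤ 2 (subst (_≤ j) (cong suc (sym (ℕ.+-suc m m))) n<j))

  P-coeffs : ∀ j → Dec (j ≤ n) → coeff (P n) j ≡ ι (ρ j)
  P-coeffs j (yes j≤n) = trans (coeff-fromCoeffs n (P-coeff n) j j≤n) (cong ι (𝓑≡ρ j j≤n))
  P-coeffs j (no j≰n) = trans (coeff-fromCoeffs-beyond n (P-coeff n) j (ℕ.≰⇒> j≰n)) (cong ι (sym (ρ-beyond j (ℕ.≰⇒> j≰n))))

  P-identity : P n ≈ₚ onePlusZ *ₚ E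
  P-identity j = trans (P-coeffs j (j ℕ.≤? n)) (sym (product-coeffs j))

  compSq-q-irreducible : 0 < m → Irreducible E
  compSq-q-irreducible 0<m = irreducible-by-degree E (φ m) (m ℕ.+ m) E-coeffs (φ-degree m) (ℕ.<-≤-trans 0<m (ℕ.m≤m+n m m))
    (no-factorisation m 0<m)

Factorises : ℕ → Set
Factorises n = (P n ≈ₚ onePlusZ *ₚ compSq (q n)) × Irreducible onePlusZ × Irreducible (compSq (q n))

factorises-odd : ∀ m → 3 ≤ suc (m ℕ.+ m) → Factorises (suc (m ℕ.+ m))
factorises-odd m 3≤n = P-identity m , onePlusZ-irreducible , compSq-q-irreducible m (ℕ.n≢0⇒n>0 λ { refl → ℕ.<⇒≱ 3≤n (s≤s z≤n) })

double%2 : ∀ m → (m ℕ.+ m) % 2 ≡ 0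
double%2 m = trans (cong (_% 2) (double≡*2 m)) (m*n%n≡0 m 2)

theorem6p2 : (n : ℕ) → 3 ≤ n → n % 2 ≡ 1 →
    (P n ≈ₚ onePlusZ *ₚ compSq (q n)) × Irreducible onePlusZ × Irreducible (compSq (q n))
theorem6p2 n 3≤n odd = [ (λ { (m , n≡) → ⊥-elim (0≢1 (trans (sym (double%2 m)) (trans (cong (_% 2) (sym n≡)) odd))) })
                       , (λ { (m , n≡) → subst Factorises (sym n≡) (factorises-odd m (subst (3 ≤_) n≡ 3≤n)) }) ]′ (halve n)
  where
  0≢1 : 0 ≢ 1
  0≢1 ()
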